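{- (a) For every model $A$ of the theory $\mathbf T$, there exists a commutative residuated complete lattice $\mathcal L$ such that the quotient of the MacNeille completion $\bar A$ of $A$ by the equivalence relation $\simeq$ induced by the preorder $\preceq$ is isomorphic (as a structure in the language of $\mathbf T$) to $USC(\mathcal L)$. (b) For every model $A$ of $\mathbf T$, there exists a commutative residuated complete lattice $\mathcal L$ such that the quotient of $A$ by $\simeq$ embeds into $USC(\mathcal L)$.
   Context: **Language** $\{\vee,\wedge,\dot+,\dot-,\frac{\cdot}{2},2,j_*,j,\alpha,\underline 0,\underline 1\}$, with $\vee,\wedge,\dot+,\dot-$ binary, $\frac{\cdot}{2},2,j_*,j,\alpha$ unary, $\underline 0,\underline 1$ constants. For a dyadic $d\in[0,1)$, with $n$ the least non-negative integer such that $2^nd$ is an integer, $\underline d$ denotes the $\dot+$-sum of $2^nd$ copies of $\frac{j_*(\underline 0)}{2^{n-1}}$ (halving iterated $n-1$ times; empty sum $=\underline 0$). **Theory $\mathbf T$** (all variables universally quantified; equalities abbreviate two inequalities): 1. $(\vee,\wedge,\underline 0,\underline 1)$ is a bounded lattice with least element $\underline 0$ and greatest element $\underline 1$; $(\dot+,\underline 0)$ is a commutative monoid; $w\le u\dot+v\iff w\dot-v\le u$. 2. $2,\frac{\cdot}{2},j_*,j,\alpha$ are non-decreasing. 3. $\frac{2v}{2}\le v$, $v\le2\frac v2$, $j(j_*(v))\le v$, $v\le j_*(j(v))$. 4. $2(u\dot+v)=2u\dot+2v$; $j_*(2v\dot+u)=v\dot+j_*(u)$; $v\le 2v$; $v\le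 j_*(v)$; $\alpha(2v\wedge j_*(v))=v$; $2\alpha(v)\wedge j_*(\alpha(v))=v$; $\underline 1\le 2j_*(\underline 0)$; $2v\le v\dot+v$; and, for all $n\ge1$, $\alpha^n(j_*(\underline 0))\dot+\alpha^n(j_*(\underline 0))\le\alpha^{n-1}(j_*(\underline 0))$. 5. For all dyadic $d\in[0,1]$ and $n\in\mathbb N$: $v\le\underline d\dot+\alpha^n(v\dot+\underline{1-d})$. For all $n\in\mathbb N$: $\bigwedge_{k=1}^{2^{n+1}-1}\Big(\underline{1-\tfrac{k}{2^{n+1}}}\dot+\alpha^{n+1}\big(v\dot+\underline{\tfrac{k}{2^{n+1}}}\big)\Big)\le v\dot+\underline{\tfrac1{2^n}}$. **Relations.** $u\preceq v$ iff $u\le v\dot+\underline{\frac1{2^n}}$ for all $n\in\mathbb N$; $u\simeq v$ iff $u\preceq v$ and $v\preceq u$. **MacNeille completion.** $\phi:A\to\bar A$ is the order completion in which each element of $\bar A$ is both a supremum and an infimum of elements of $\phi(A)$. $\bar A$ carries: $\vee,\wedge$ binary join and meet; $\underline 0,\underline 1$ least and greatest elements; $\bigwedge_i\phi(a_i)\dot+\bigwedge_j\phi(b_j)=\bigwedge_{i,j}\phi(a_i\dot+b_j)$; $\bigvee_i\phi(a_i)\dot-\bigwedge_j\phi(b_j)=\bigvee_{i,j}\phi(a_i\dot-b_j)$; for $h\in\{2,j_*,\alpha\}$, $h(\bigwedge_i\phi(a_i))=\bigwedge_i\phi(h(a_i))$; $\frac{\cdot}{2}$ and $j$ are the left adjoints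 of $2$ and $j_*$. The relations $\preceq,\simeq$ on $\bar A$ are defined by the same formulas. **$USC(\mathcal L)$.** A commutative residuated complete lattice is a complete lattice $\mathcal L$ (least $\bot$, greatest $\top$) with a commutative associative operation $\otimes$ with neutral element $\top$ and an operation $\nrightarrow$ with $u\otimes v\le w\iff u\le v\nrightarrow w$. $USC(\mathcal L)$ is the set of maps $f:[0,1]\to\mathcal L$ preserving arbitrary suprema (so $f(0)=\bot$), ordered by $f\le g\iff g(q)\le f(q)$ for all $q$; $\vee,\wedge$ are join and meet for this order, and - $(f\dot+g)(q)=\bigvee\{f(p)\otimes g(r):p,r\in[0,1],\ p+r<q\}$; $f\dot-g$ is the least $h$ with $f\le g\dot+h$; - $(2f)(q)=f(q/2)$; $(\frac f2)(q)=f(2q)$ if $q\le\frac12$ and $\top$ if $q>\frac12$; - $j_*(f)(q)=f(\max(2q-1,0))$; $j(f)(q)=f(\frac{1+q}2)$ if $q>0$ and $\bot$ if $q=0$; $\alpha(f)(q)=f(\min(2q,\frac{1+q}2))$; - $\underline 0(q)=\top$ for $q>0$, $\underline 0(0)=\bot$; $\underline 1(q)=\bot$ for all $q$. -}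

module Defs where

open import Algebra.Core using (Op₁; Op₂)
open import Algebra.Structures using (IsCommutativeMonoid)
open import Axiom.ExcludedMiddle using (ExcludedMiddle)
open import Data.Bool.Base using (if_then_else_)
open import Data.Empty using (⊥-elim)
open import Data.List.Base using (foldr; applyUpTo)
open import Data.Nat.Base as ℕ using (ℕ; zero; suc; _^_; ⌊_/2⌋)
open import Data.Nat.Divisibility using (_∣?_)
open import Data.Nat.GeneralisedArithmetic using (fold)
open import Data.Product.Base using (Σ; Σ-syntax; ∃; ∃-syntax; _×_; _,_; proj₁; proj₂)
open import Data.Rational.Base as ℚ using (ℚ; 0ℚ; 1ℚ; ½; -_)
import Data.Rational.Properties as ℚ
open import Data.Sum.Base using (_⊎_; inj₁; inj₂; [_,_]′)
open import Function.Base using (flip)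
open import Function.Bundles using (_⇔_; mk⇔; Equivalence)
open import Level using (Level; Setω; _⊔_) renaming (suc to lsuc)
open import Relation.Binary.Core using (Rel)
open import Relation.Binary.Definitions using (Monotonic₁; tri<; tri≈; tri>)
open import Relation.Binary.Lattice.Structures using (IsBoundedLattice)
open import Relation.Binary.Morphism.Structures using (IsOrderMonomorphism; IsOrderIsomorphism)
open import Relation.Binary.PropositionalEquality.Core using (_≡_; refl; sym; trans; subst)
open import Relation.Binary.Structures using (IsPartialOrder)
open import Relation.Nullary.Decidable.Core using (Dec; yes; no; does)
open import Relation.Nullary.Negation.Core using (¬_)

private
  variable
    a c c₁ c₂ ℓ ℓ₁ ℓ₂ p : Level

-- The results are classical; excluded middle is an explicit hypothesis.
Classical : Setω
Classical = ∀ {a} → ExcludedMiddle a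

IsSupremum : {A : Set a} → Rel A ℓ → (A → Set p) → A → Set (a ⊔ ℓ ⊔ p)
IsSupremum _≤_ P s = (∀ x → P x → x ≤ s) × (∀ y → (∀ x → P x → x ≤ y) → s ≤ y)

IsInfimum : {A : Set a} → Rel A ℓ → (A → Set p) → A → Set (a ⊔ ℓ ⊔ p)
IsInfimum _≤_ = IsSupremum (flip _≤_)

------------------------------------------------------------------------

record Structure c ℓ : Set (lsuc (c ⊔ ℓ)) where
  infix  4 _≈_ _≤_ _≲_ _≃_
  infixl 7 _∧_
  infixl 6 _∔_ _∸_ _∨_
  field
    Carrier  : Set c
    _≈_ _≤_  : Rel Carrier ℓ
    _∨_ _∧_  : Op₂ Carrier
    _∔_ _∸_  : Op₂ Carrier
    halve double j⁎ j α : Op₁ Carrier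
    𝟎 𝟏      : Carrier

  α^ : ℕ → Op₁ Carrier
  α^ n v = fold v α n

  -- dyadic k n is the term for the number k / 2ⁿ (0 ≤ k ≤ 2ⁿ).  The fraction
  -- is first brought to lowest terms; the number 1 is denoted by 𝟏.
  dyadic : ℕ → ℕ → Carrier
  dyadic k zero    = if k ℕ.≡ᵇ 0 then 𝟎 else 𝟏
  dyadic k (suc m) = if does (2 ∣? k)
    then dyadic ⌊ k /2⌋ m
    else fold 𝟎 (fold (j⁎ 𝟎) halve m ∔_) k

  -- t 1 ∧ … ∧ t n
  meet : ℕ → (ℕ → Carrier) → Carrier
  meet n t = foldr _∧_ 𝟏 (applyUpTo (λ i → t (suc i)) n)

  _≲_ : Rel Carrier ℓ
  u ≲ v = ∀ n → u ≤ v ∔ dyadic 1 n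

  _≃_ : Rel Carrier ℓ
  u ≃ v = u ≲ v × v ≲ u

-- Quotients are setoids: same carrier and operations, coarser equality and
-- order.
_/≃ : Structure c ℓ → Structure c ℓ
S /≃ = record S { _≈_ = Structure._≃_ S ; _≤_ = Structure._≲_ S }

record IsHomomorphic (S : Structure c₁ ℓ₁) (T : Structure c₂ ℓ₂)
                     (f : Structure.Carrier S → Structure.Carrier T) : Set (c₁ ⊔ ℓ₂) where
  private
    module S = Structure S
    open Structure T
  field
    ∨-homo      : ∀ u v → f (u S.∨ v) ≈ f u ∨ f v
    ∧-homo      : ∀ u v → f (u S.∧ v) ≈ f u ∧ f v
    ∔-homo      : ∀ u v → f (u S.∔ v) ≈ f u ∔ f v
    ∸-homo      : ∀ u v → f (u S.∸ v) ≈ f u ∸ f v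
    halve-homo  : ∀ v → f (S.halve v) ≈ halve (f v)
    double-homo : ∀ v → f (S.double v) ≈ double (f v)
    j⁎-homo     : ∀ v → f (S.j⁎ v) ≈ j⁎ (f v)
    j-homo      : ∀ v → f (S.j v) ≈ j (f v)
    α-homo      : ∀ v → f (S.α v) ≈ α (f v)
    𝟎-homo      : f S.𝟎 ≈ 𝟎
    𝟏-homo      : f S.𝟏 ≈ 𝟏

record Embedding (S : Structure c₁ ℓ₁) (T : Structure c₂ ℓ₂) : Set (c₁ ⊔ c₂ ⊔ ℓ₁ ⊔ ℓ₂) where
  private
    module S = Structure S
    module T = Structure T
  field
    to                  : S.Carrier → T.Carrier
    isOrderMonomorphism : IsOrderMonomorphism S._≈_ T._≈_ S._≤_ T._≤_ to
    isHomomorphic       : IsHomomorphic S T to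

record Isomorphism (S : Structure c₁ ℓ₁) (T : Structure c₂ ℓ₂) : Set (c₁ ⊔ c₂ ⊔ ℓ₁ ⊔ ℓ₂) where
  private
    module S = Structure S
    module T = Structure T
  field
    to                 : S.Carrier → T.Carrier
    isOrderIsomorphism : IsOrderIsomorphism S._≈_ T._≈_ S._≤_ T._≤_ to
    isHomomorphic      : IsHomomorphic S T to

------------------------------------------------------------------------

record IsModel (S : Structure c ℓ) : Set (c ⊔ ℓ) where
  open Structure S
  field
    isBoundedLattice      : IsBoundedLattice _≈_ _≤_ _∨_ _∧_ 𝟏 𝟎
    ∔-isCommutativeMonoid : IsCommutativeMonoid _≈_ _∔_ 𝟎
    ∸-residual            : ∀ u v w → w ≤ u ∔ v ⇔ w ∸ v ≤ u

    double-mono : Monotonic₁ _≤_ _≤_ double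
    halve-mono  : Monotonic₁ _≤_ _≤_ halve
    j⁎-mono     : Monotonic₁ _≤_ _≤_ j⁎
    j-mono      : Monotonic₁ _≤_ _≤_ j
    α-mono      : Monotonic₁ _≤_ _≤_ α

    halve-double : ∀ v → halve (double v) ≤ v
    double-halve : ∀ v → v ≤ double (halve v)
    j-j⁎         : ∀ v → j (j⁎ v) ≤ v
    j⁎-j         : ∀ v → v ≤ j⁎ (j v)

    double-∔     : ∀ u v → double (u ∔ v) ≈ double u ∔ double v
    j⁎-∔         : ∀ u v → j⁎ (double v ∔ u) ≈ v ∔ j⁎ u
    double-infl  : ∀ v → v ≤ double v
    j⁎-infl      : ∀ v → v ≤ j⁎ v
    α-left       : ∀ v → α (double v ∧ j⁎ v) ≈ v
    α-right      : ∀ v → double (α v) ∧ j⁎ (α v) ≈ v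
    𝟏≤double-j⁎𝟎 : 𝟏 ≤ double (j⁎ 𝟎)
    double≤∔     : ∀ v → double v ≤ v ∔ v
    α^-halves    : ∀ n → α^ (suc n) (j⁎ 𝟎) ∔ α^ (suc n) (j⁎ 𝟎) ≤ α^ n (j⁎ 𝟎)

    α^-lower : ∀ k m → k ℕ.≤ 2 ^ m → ∀ n v →
               v ≤ dyadic k m ∔ α^ n (v ∔ dyadic (2 ^ m ℕ.∸ k) m)
    α^-upper : ∀ n v →
               meet (2 ^ suc n ℕ.∸ 1)
                    (λ k → dyadic (2 ^ suc n ℕ.∸ k) (suc n) ∔ α^ (suc n) (v ∔ dyadic k (suc n)))
               ≤ v ∔ dyadic 1 n

record Model ℓ : Set (lsuc ℓ) where
  field
    structure : Structure ℓ ℓ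
    isModel   : IsModel structure
  open Structure structure public
  open IsModel isModel public

------------------------------------------------------------------------

-- The MacNeille completion, realised by Dedekind–MacNeille cuts
module Completion {ℓ} (A : Model ℓ) where
  private
    module A = Model A
    module L = IsBoundedLattice A.isBoundedLattice
    module M = IsCommutativeMonoid A.∔-isCommutativeMonoid
    open A using (Carrier; _≤_)
    open Equivalence

  record Cut : Set (lsuc ℓ) where
    field
      lower upper : Carrier → Set ℓ
      lower≤upper : ∀ {x y} → lower x → upper y → x ≤ y
      lower-max   : ∀ {x} → (∀ y → upper y → x ≤ y) → lower x
      upper-max   : ∀ {y} → (∀ x → lower x → x ≤ y) → upper y
  open Cut public

  infix 4 _⊑_ _≋_
  _⊑_ _≋_ : Rel Cut ℓ
  u ⊑ v = ∀ x → lower u x → lower v x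
  u ≋ v = u ⊑ v × v ⊑ u

  φ : Carrier → Cut
  φ a = record
    { lower       = _≤ a
    ; upper       = a ≤_
    ; lower≤upper = L.trans
    ; lower-max   = λ h → h a L.refl
    ; upper-max   = λ h → h a L.refl
    }

  -- The infimum and the supremum of the φ (a i); see ⋀φ-isInfimum and
  -- ⋁φ-isSupremum below.
  ⋀φ ⋁φ : {I : Set ℓ} → (I → Carrier) → Cut
  ⋀φ a = record
    { lower       = λ x → ∀ i → x ≤ a i
    ; upper       = λ y → ∀ x → (∀ i → x ≤ a i) → x ≤ y
    ; lower≤upper = λ l u → u _ l
    ; lower-max   = λ h i → h (a i) (λ _ l → l i)
    ; upper-max   = λ h → h
    }
  ⋁φ a = record
    { lower       = λ x → ∀ y → (∀ i → a i ≤ y) → x ≤ y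
    ; upper       = λ y → ∀ i → a i ≤ y
    ; lower≤upper = λ l u → l _ u
    ; lower-max   = λ h → h
    ; upper-max   = λ h i → h (a i) (λ _ u → u i)
    }

  Lower Upper : Cut → Set ℓ
  Lower u = ∃ (lower u)
  Upper u = ∃ (upper u)

  -- Each operation is given by its defining formula on the canonical families
  -- Lower and Upper; the lemmas below extend the formulas to all families.
  structure : Structure (lsuc ℓ) ℓ
  structure = record
    { Carrier = Cut
    ; _≈_     = _≋_
    ; _≤_     = _⊑_
    ; _∨_     = λ u v → ⋀φ {I = ∃ λ y → upper u y × upper v y} proj₁
    ; _∧_     = λ u v → ⋁φ {I = ∃ λ x → lower u x × lower v x} proj₁
    ; _∔_     = λ u v → ⋀φ {I = Upper u × Upper v} λ ((a , _) , (b , _)) → a A.∔ b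
    ; _∸_     = λ u v → ⋁φ {I = Lower u × Upper v} λ ((a , _) , (b , _)) → a A.∸ b
    ; halve   = λ u → ⋁φ {I = Lower u} λ (a , _) → A.halve a
    ; double  = λ u → ⋀φ {I = Upper u} λ (a , _) → A.double a
    ; j⁎      = λ u → ⋀φ {I = Upper u} λ (a , _) → A.j⁎ a
    ; j       = λ u → ⋁φ {I = Lower u} λ (a , _) → A.j a
    ; α       = λ u → ⋀φ {I = Upper u} λ (a , _) → A.α a
    ; 𝟎       = ⋁φ {I = ∃ λ x → ∀ y → x ≤ y} proj₁
    ; 𝟏       = ⋀φ {I = ∃ λ y → ∀ x → x ≤ y} proj₁
    }
  open Structure structure using (_∨_; _∧_; _∔_; _∸_; halve; double; j⁎; j; α; 𝟎; 𝟏)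

  ⊑⇒upper : ∀ {u v} → u ⊑ v → ∀ {y} → upper v y → upper u y
  ⊑⇒upper {u} {v} h vy = upper-max u λ x ux → lower≤upper v (h x ux) vy

  φ-order : ∀ a b → φ a ⊑ φ b ⇔ a ≤ b
  φ-order a b = mk⇔ (λ h → h a L.refl) (λ a≤b _ x≤a → L.trans x≤a a≤b)

  ⋀φ-isInfimum : {I : Set ℓ} (a : I → Carrier) →
                 IsInfimum _⊑_ (λ w → ∃ λ i → w ≋ φ (a i)) (⋀φ a)
  ⋀φ-isInfimum a = (λ { _ (i , w≋) x l → proj₂ w≋ x (l i) })
                 , (λ _ h x wx i → h (φ (a i)) (i , (λ _ z → z) , (λ _ z → z)) x wx)

  ⋁φ-isSupremum : {I : Set ℓ} (a : I → Carrier) →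
                  IsSupremum _⊑_ (λ w → ∃ λ i → w ≋ φ (a i)) (⋁φ a)
  ⋁φ-isSupremum a =
      (λ { _ (i , w≋) x wx y h → L.trans (proj₁ w≋ x wx) (h i) })
    , (λ w h x l → lower-max w λ y wy → l y λ i →
        lower≤upper w (h (φ (a i)) (i , (λ _ z → z) , (λ _ z → z)) (a i) L.refl) wy)

  dense : ∀ u → (u ≋ ⋀φ {I = Upper u} proj₁) × (u ≋ ⋁φ {I = Lower u} proj₁)
  dense u = ( (λ _ ux (_ , uy) → lower≤upper u ux uy)
            , (λ _ h → lower-max u λ y uy → h (y , uy)))
          , ( (λ x ux _ h → h (x , ux))
            , (λ _ h → lower-max u λ y uy → h y λ (_ , ux) → lower≤upper u ux uy))

  complete : {I : Set ℓ} (u : I → Cut) →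
             (∃ λ s → IsSupremum _⊑_ (λ w → ∃ λ i → w ≋ u i) s) ×
             (∃ λ s → IsInfimum _⊑_ (λ w → ∃ λ i → w ≋ u i) s)
  complete {I} u =
      (⋁φ {I = Σ I λ i → Lower (u i)} (λ (_ , (x , _)) → x)
      , (λ { w (i , w≋) x wx y h → h (i , x , proj₁ w≋ x wx) })
      , (λ v h _ l → lower-max v λ y vy → l y λ (i , x , ux) →
          lower≤upper v (h (u i) (i , (λ _ z → z) , (λ _ z → z)) x ux) vy))
    , (⋀φ {I = Σ I λ i → Upper (u i)} (λ (_ , (y , _)) → y)
      , (λ { w (i , w≋) x l → proj₂ w≋ x (lower-max (u i) λ y uy → l (i , y , uy)) })
      , (λ v h x vx (i , y , uy) →
          lower≤upper (u i) (h (u i) (i , (λ _ z → z) , (λ _ z → z)) x vx) uy))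

  ∨-join : ∀ u v w → (u ∨ v) ⊑ w ⇔ (u ⊑ w × v ⊑ w)
  ∨-join u v w = mk⇔
    (λ h → (λ x ux → h x λ (_ , uy , _) → lower≤upper u ux uy)
         , (λ x vx → h x λ (_ , _ , vy) → lower≤upper v vx vy))
    (λ (h , k) _ l → lower-max w λ y wy →
       l (y , ⊑⇒upper {u} {w} h wy , ⊑⇒upper {v} {w} k wy))

  ∧-meet : ∀ u v w → w ⊑ (u ∧ v) ⇔ (w ⊑ u × w ⊑ v)
  ∧-meet u v w = mk⇔
    (λ h → (λ x wx → lower-max u λ y uy → h x wx y λ (_ , ux , _) → lower≤upper u ux uy)
         , (λ x wx → lower-max v λ y vy → h x wx y λ (_ , _ , vx) → lower≤upper v vx vy))
    (λ (h , k) x wx y b → b (x , h x wx , k x wx))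

  𝟎-least : ∀ u → 𝟎 ⊑ u
  𝟎-least u _ l = lower-max u λ y _ → l y λ (_ , h) → h y

  𝟏-greatest : ∀ u → u ⊑ 𝟏
  𝟏-greatest u _ _ (_ , h) = h _

  swap-∔ : ∀ {x a b} → x ≤ a A.∔ b → x ≤ b A.∔ a
  swap-∔ h = L.trans h (L.reflexive (M.comm _ _))

  to-∸ : ∀ {w u v} → w ≤ u A.∔ v → w A.∸ v ≤ u
  to-∸ = to (A.∸-residual _ _ _)

  from-∸ : ∀ {w u v} → w A.∸ v ≤ u → w ≤ u A.∔ v
  from-∸ = from (A.∸-residual _ _ _)

  ∔-⋀ : {I J : Set ℓ} (a : I → Carrier) (b : J → Carrier) →
        (⋀φ a ∔ ⋀φ b) ≋ ⋀φ {I = I × J} λ (i , k) → a i A.∔ b k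
  ∔-⋀ a b =
      (λ _ h (i , k) → h ((a i , λ _ l → l i) , (b k , λ _ l → l k)))
    , (λ _ h ((_ , ua) , (_ , ub)) → swap-∔ (from-∸ (ub _ λ k → to-∸ (swap-∔
         (from-∸ (ua _ λ i → to-∸ (h (i , k))))))))

  ∸-⋁⋀ : {I J : Set ℓ} (a : I → Carrier) (b : J → Carrier) →
         (⋁φ a ∸ ⋀φ b) ≋ ⋁φ {I = I × J} λ (i , k) → a i A.∸ b k
  ∸-⋁⋀ a b =
      (λ _ l y h → l y λ ((_ , la) , (_ , ub)) → to-∸ (swap-∔ (from-∸ (ub _ λ k →
         to-∸ (swap-∔ (la _ λ i → from-∸ (h (i , k))))))))
    , (λ _ l y h → l y λ (i , k) → h ((a i , λ _ u → u i) , (b k , λ _ l′ → l′ k)))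

  preserves : (h h⁻ : Op₁ Carrier) → (∀ {x y} → h⁻ x ≤ y → x ≤ h y) → (∀ {x y} → x ≤ h y → h⁻ x ≤ y) →
              {I : Set ℓ} (a : I → Carrier) →
              ⋀φ {I = Upper (⋀φ a)} (λ (y , _) → h y) ≋ ⋀φ λ i → h (a i)
  preserves h h⁻ r l a =
      (λ _ k i → k (a i , λ _ z → z i))
    , (λ _ k (_ , ua) → r (ua _ λ i → l (k i)))

  adjoint : (h h⁻ : Op₁ Carrier) → (∀ {x y} → h⁻ x ≤ y → x ≤ h y) → (∀ {x y} → x ≤ h y → h⁻ x ≤ y) →
            ∀ u v → ⋁φ {I = Lower u} (λ (x , _) → h⁻ x) ⊑ v ⇔ u ⊑ ⋀φ {I = Upper v} (λ (y , _) → h y)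
  adjoint h h⁻ r l u v = mk⇔
    (λ k x ux (y , vy) → r (lower≤upper v (k (h⁻ x) λ _ z → z (x , ux)) vy))
    (λ k _ z → lower-max v λ y vy → z y λ (x , ux) → l (k x ux (y , vy)))

  double⇐ : ∀ {x y} → A.halve x ≤ y → x ≤ A.double y
  double⇐ h = L.trans (A.double-halve _) (A.double-mono h)
  double⇒ : ∀ {x y} → x ≤ A.double y → A.halve x ≤ y
  double⇒ h = L.trans (A.halve-mono h) (A.halve-double _)
  j⁎⇐ : ∀ {x y} → A.j x ≤ y → x ≤ A.j⁎ y
  j⁎⇐ h = L.trans (A.j⁎-j _) (A.j⁎-mono h)
  j⁎⇒ : ∀ {x y} → x ≤ A.j⁎ y → A.j x ≤ y
  j⁎⇒ h = L.trans (A.j-mono h) (A.j-j⁎ _)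

  α⁻ : Op₁ Carrier
  α⁻ v = A.double v A.∧ A.j⁎ v
  α⁻-mono : ∀ {x y} → x ≤ y → α⁻ x ≤ α⁻ y
  α⁻-mono h = L.∧-greatest (L.trans (L.x∧y≤x _ _) (A.double-mono h))
                           (L.trans (L.x∧y≤y _ _) (A.j⁎-mono h))
  α⇐ : ∀ {x y} → α⁻ x ≤ y → x ≤ A.α y
  α⇐ h = L.trans (L.reflexive (L.Eq.sym (A.α-left _))) (A.α-mono h)
  α⇒ : ∀ {x y} → x ≤ A.α y → α⁻ x ≤ y
  α⇒ h = L.trans (α⁻-mono h) (L.reflexive (A.α-right _))

  double-⋀ : {I : Set ℓ} (a : I → Carrier) → double (⋀φ a) ≋ ⋀φ λ i → A.double (a i)
  double-⋀ = preserves A.double A.halve double⇐ double⇒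

  j⁎-⋀ : {I : Set ℓ} (a : I → Carrier) → j⁎ (⋀φ a) ≋ ⋀φ λ i → A.j⁎ (a i)
  j⁎-⋀ = preserves A.j⁎ A.j j⁎⇐ j⁎⇒

  α-⋀ : {I : Set ℓ} (a : I → Carrier) → α (⋀φ a) ≋ ⋀φ λ i → A.α (a i)
  α-⋀ = preserves A.α α⁻ α⇐ α⇒

  halve-adjoint : ∀ u v → halve u ⊑ v ⇔ u ⊑ double v
  halve-adjoint = adjoint A.double A.halve double⇐ double⇒

  j-adjoint : ∀ u v → j u ⊑ v ⇔ u ⊑ j⁎ v
  j-adjoint = adjoint A.j⁎ A.j j⁎⇐ j⁎⇒

------------------------------------------------------------------------

-- Real numbers are given by the lower halves of Dedekind cuts.
record ℝ : Set₁ where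
  field
    cut       : ℚ → Set
    inhabited : ∃ cut
    bounded   : ∃ λ s → ¬ cut s
    downward  : ∀ {r s} → r ℚ.≤ s → cut s → cut r
    rounded   : ∀ {r} → cut r → ∃ λ s → r ℚ.< s × cut s
open ℝ

infix 4 _≤ʳ_ _<ʳ_
infixl 6 _+ʳ_

_≤ʳ_ _<ʳ_ : ℝ → ℝ → Set
x ≤ʳ y = ∀ {s} → cut x s → cut y s
x <ʳ y = ∃ λ s → cut y s × ¬ cut x s

halfℚ : ℚ → ℚ
halfℚ s = ½ ℚ.* s

halfℚ+halfℚ : ∀ s → halfℚ s ℚ.+ halfℚ s ≡ s
halfℚ+halfℚ s = trans (sym (ℚ.*-distribʳ-+ s ½ ½)) (ℚ.*-identityˡ s)

≤halves : ∀ s → s ℚ.≤ halfℚ s ℚ.+ halfℚ s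
≤halves s = ℚ.≤-reflexive (sym (halfℚ+halfℚ s))

double-cancel : ∀ {r s} → r ℚ.+ r ℚ.< s ℚ.+ s → r ℚ.< s
double-cancel {r} {s} h with ℚ.<-cmp r s
... | tri< r<s _ _ = r<s
... | tri≈ _ refl _ = ⊥-elim (ℚ.<-irrefl refl h)
... | tri> _ _ s<r = ⊥-elim (ℚ.<-asym h (ℚ.+-mono-< s<r s<r))

split : ∀ r s → (r ℚ.< s) ⊎ (s ℚ.≤ r)
split r s with r ℚ.<? s
... | yes r<s = inj₁ r<s
... | no r≮s  = inj₂ (ℚ.≮⇒≥ r≮s)

cut-< : ∀ x {r s} → cut x r → ¬ cut x s → r ℚ.< s
cut-< x {r} {s} xr ¬xs = [ (λ h → h) , (λ s≤r → ⊥-elim (¬xs (downward x s≤r xr))) ]′ (split r s)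

fromℚ : ℚ → ℝ
fromℚ q = record
  { cut       = ℚ._< q
  ; inhabited = q ℚ.+ (- 1ℚ)
              , ℚ.<-≤-trans (ℚ.+-monoʳ-< q (ℚ.negative⁻¹ (- 1ℚ))) (ℚ.≤-reflexive (ℚ.+-identityʳ q))
  ; bounded   = q , ℚ.<-irrefl refl
  ; downward  = ℚ.≤-<-trans
  ; rounded   = λ r<q → let s , r<s , s<q = ℚ.<-dense r<q in s , r<s , s<q
  }

0ʳ ½ʳ 1ʳ : ℝ
0ʳ = fromℚ 0ℚ
½ʳ = fromℚ ½
1ʳ = fromℚ 1ℚ

_+ʳ_ : ℝ → ℝ → ℝ
x +ʳ y = record
  { cut       = λ s → ∃[ a ] ∃[ b ] cut x a × cut y b × s ℚ.≤ a ℚ.+ b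
  ; inhabited = let a , xa = inhabited x ; b , yb = inhabited y in
                a ℚ.+ b , a , b , xa , yb , ℚ.≤-refl
  ; bounded   = let c , ¬xc = bounded x ; d , ¬yd = bounded y in
                c ℚ.+ d , λ (a , b , xa , yb , h) →
                  ℚ.<-irrefl refl (ℚ.≤-<-trans h (ℚ.+-mono-< (cut-< x xa ¬xc) (cut-< y yb ¬yd)))
  ; downward  = λ r≤s (a , b , xa , yb , h) → a , b , xa , yb , ℚ.≤-trans r≤s h
  ; rounded   = λ (a , b , xa , yb , h) → let a′ , a<a′ , xa′ = rounded x xa in
                a′ ℚ.+ b , ℚ.≤-<-trans h (ℚ.+-monoˡ-< b a<a′) , a′ , b , xa′ , yb , ℚ.≤-refl
  }

_/2ʳ : ℝ → ℝ
x /2ʳ = record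
  { cut       = λ s → cut x (s ℚ.+ s)
  ; inhabited = let a , xa = inhabited x in halfℚ a , subst (cut x) (sym (halfℚ+halfℚ a)) xa
  ; bounded   = let c , ¬xc = bounded x in halfℚ c , λ h → ¬xc (subst (cut x) (halfℚ+halfℚ c) h)
  ; downward  = λ r≤s → downward x (ℚ.+-mono-≤ r≤s r≤s)
  ; rounded   = λ {r} xr → let t , r+r<t , xt = rounded x xr in
                halfℚ t , double-cancel (subst (r ℚ.+ r ℚ.<_) (sym (halfℚ+halfℚ t)) r+r<t)
                        , subst (cut x) (sym (halfℚ+halfℚ t)) xt
  }

maxʳ minʳ : ℝ → ℝ → ℝ
maxʳ x y = record
  { cut       = λ s → cut x s ⊎ cut y s
  ; inhabited = let a , xa = inhabited x in a , inj₁ xa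
  ; bounded   = let c , ¬xc = bounded x ; d , ¬yd = bounded y in
                c ℚ.⊔ d , [ (λ h → ¬xc (downward x (ℚ.p≤p⊔q c d) h))
                          , (λ h → ¬yd (downward y (ℚ.p≤q⊔p c d) h)) ]′
  ; downward  = λ r≤s → [ (λ h → inj₁ (downward x r≤s h)) , (λ h → inj₂ (downward y r≤s h)) ]′
  ; rounded   = [ (λ h → let s , r<s , xs = rounded x h in s , r<s , inj₁ xs)
                , (λ h → let s , r<s , ys = rounded y h in s , r<s , inj₂ ys) ]′
  }
minʳ x y = record
  { cut       = λ s → cut x s × cut y s
  ; inhabited = let a , xa = inhabited x ; b , yb = inhabited y in
                a ℚ.⊓ b , downward x (ℚ.p⊓q≤p a b) xa , downward y (ℚ.p⊓q≤q a b) yb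
  ; bounded   = let c , ¬xc = bounded x in c , λ (h , _) → ¬xc h
  ; downward  = λ r≤s (h , k) → downward x r≤s h , downward y r≤s k
  ; rounded   = λ (h , k) → let s , r<s , xs = rounded x h ; t , r<t , yt = rounded y k in
                [ (λ s≤t → s , r<s , xs , downward y s≤t yt)
                , (λ t≤s → t , r<t , downward x t≤s xs , yt) ]′ (ℚ.≤-total s t)
  }

0≤2x : ∀ x → 0ʳ ≤ʳ x → 0ʳ ≤ʳ x +ʳ x
0≤2x x 0≤x {s} s<0 = halfℚ s , halfℚ s , 0≤x h<0 , 0≤x h<0 , ≤halves s
  where h<0 = double-cancel {halfℚ s} {0ℚ} (subst (ℚ._< 0ℚ) (sym (halfℚ+halfℚ s)) s<0)

0≤[1+x]/2 : ∀ x → 0ʳ ≤ʳ x → 0ʳ ≤ʳ (1ʳ +ʳ x) /2ʳ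
0≤[1+x]/2 x 0≤x {s} s<0 =
  0ℚ , s ℚ.+ s , ℚ.positive⁻¹ 1ℚ , 0≤x (ℚ.+-mono-< s<0 s<0) , ℚ.≤-reflexive (sym (ℚ.+-identityˡ _))

[1+x]/2≤1 : ∀ x → x ≤ʳ 1ʳ → (1ʳ +ʳ x) /2ʳ ≤ʳ 1ʳ
[1+x]/2≤1 x x≤1 (a , b , a<1 , xb , h) = double-cancel (ℚ.≤-<-trans h (ℚ.+-mono-< a<1 (x≤1 xb)))

------------------------------------------------------------------------

record 𝕀 : Set₁ where
  constructor mk𝕀
  field
    value : ℝ
    0≤    : 0ʳ ≤ʳ value
    ≤1    : value ≤ʳ 1ʳ
open 𝕀

infix 4 _≤ⁱ_ _<ⁱ_
_≤ⁱ_ _<ⁱ_ : 𝕀 → 𝕀 → Set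
p ≤ⁱ q = value p ≤ʳ value q
p <ⁱ q = value p <ʳ value q

half : 𝕀 → 𝕀
half q = mk𝕀 (value q /2ʳ) (λ s<0 → 0≤ q (ℚ.+-mono-< s<0 s<0)) (λ h → double-cancel (ℚ.<-trans (≤1 q h) 1<2))
  where 1<2 = ℚ.+-monoʳ-< 1ℚ (ℚ.positive⁻¹ 1ℚ)

twice : ∀ q → value q ≤ʳ ½ʳ → 𝕀
twice q q≤½ = mk𝕀 (value q +ʳ value q) (0≤2x (value q) (0≤ q))
  (λ (a , b , qa , qb , h) → ℚ.≤-<-trans h (ℚ.+-mono-< (q≤½ qa) (q≤½ qb)))

stretch : 𝕀 → 𝕀
stretch q = mk𝕀 (maxʳ (value q +ʳ value q +ʳ fromℚ (- 1ℚ)) 0ʳ) inj₂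
  [ (λ (t , c , (a , b , qa , qb , h) , c<-1 , k) →
      ℚ.≤-<-trans k (ℚ.+-mono-< (ℚ.≤-<-trans h (ℚ.+-mono-< (≤1 q qa) (≤1 q qb))) c<-1))
  , (λ s<0 → ℚ.<-trans s<0 (ℚ.positive⁻¹ 1ℚ)) ]′

upperHalf : 𝕀 → 𝕀
upperHalf q = mk𝕀 ((1ʳ +ʳ value q) /2ʳ) (0≤[1+x]/2 (value q) (0≤ q)) ([1+x]/2≤1 (value q) (≤1 q))

bend : 𝕀 → 𝕀
bend q = mk𝕀 (minʳ (value q +ʳ value q) ((1ʳ +ʳ value q) /2ʳ))
  (λ s<0 → 0≤2x (value q) (0≤ q) s<0 , 0≤[1+x]/2 (value q) (0≤ q) s<0)
  (λ (_ , h) → [1+x]/2≤1 (value q) (≤1 q) h)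

rational : ∀ s → 0ℚ ℚ.≤ s → s ℚ.≤ 1ℚ → 𝕀
rational s 0≤s s≤1 = mk𝕀 (fromℚ s) (λ h → ℚ.<-≤-trans h 0≤s) (λ h → ℚ.<-≤-trans h s≤1)

∉⇒≥0 : ∀ q {s} → ¬ cut (value q) s → 0ℚ ℚ.≤ s
∉⇒≥0 q {s} ¬qs = [ (λ s<0 → ⊥-elim (¬qs (0≤ q s<0))) , (λ h → h) ]′ (split s 0ℚ)

below : ∀ q s → 0ℚ ℚ.≤ s → cut (value q) s → Σ[ p ∈ 𝕀 ] p <ⁱ q × (∀ {r} → r ℚ.< s → cut (value p) r)
below q s 0≤s qs = rational s 0≤s (ℚ.<⇒≤ (≤1 q qs)) , (s , qs , ℚ.<-irrefl refl) , (λ h → h)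

between : ∀ q s → 0ℚ ℚ.≤ s → cut (value q) s → Σ[ p ∈ 𝕀 ] p <ⁱ q × cut (value p) s
between q s 0≤s qs with rounded (value q) qs
... | t , s<t , qt with below q t (ℚ.≤-trans 0≤s (ℚ.<⇒≤ s<t)) qt
...   | p , p<q , h = p , p<q , h s<t

⊔-cut : ∀ x {a b} → cut x a → cut x b → cut x (a ℚ.⊔ b)
⊔-cut x {a} {b} xa xb with ℚ.≤-total a b
... | inj₁ a≤b = subst (cut x) (sym (ℚ.p≤q⇒p⊔q≡q a≤b)) xb
... | inj₂ b≤a = subst (cut x) (sym (ℚ.p≥q⇒p⊔q≡p b≤a)) xa

⊔≥0 : ∀ {a b} → 0ℚ ℚ.≤ a ℚ.+ b → 0ℚ ℚ.≤ a ℚ.⊔ b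
⊔≥0 {a} {b} h with split a 0ℚ | split b 0ℚ
... | inj₂ 0≤a | _        = ℚ.≤-trans 0≤a (ℚ.p≤p⊔q a b)
... | inj₁ _   | inj₂ 0≤b = ℚ.≤-trans 0≤b (ℚ.p≤q⊔p a b)
... | inj₁ a<0 | inj₁ b<0 = ⊥-elim (ℚ.<-irrefl refl (ℚ.≤-<-trans h (ℚ.+-mono-< a<0 b<0)))

LeftContinuous : (𝕀 → 𝕀) → Set₁
LeftContinuous g = ∀ p q → p <ⁱ g q → Σ[ p′ ∈ 𝕀 ] p′ <ⁱ q × p ≤ⁱ g p′

half-lc : LeftContinuous half
half-lc p q (s , qs , ¬ps) with ∉⇒≥0 p ¬ps
... | 0≤s with below q (s ℚ.+ s) (ℚ.+-mono-≤ 0≤s 0≤s) qs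
...   | p′ , p′<q , k = p′ , p′<q , λ pr → let r<s = cut-< (value p) pr ¬ps in k (ℚ.+-mono-< r<s r<s)

twice-lc : ∀ p q → value p <ʳ value q +ʳ value q → Σ[ p′ ∈ 𝕀 ] p′ <ⁱ q × value p ≤ʳ value p′ +ʳ value p′
twice-lc p q (s , (a , b , qa , qb , h) , ¬ps)
  with between q (a ℚ.⊔ b) (⊔≥0 {a} {b} (ℚ.≤-trans (∉⇒≥0 p ¬ps) h)) (⊔-cut (value q) qa qb)
... | p′ , p′<q , m = p′ , p′<q , λ pr →
      a , b , downward (value p′) (ℚ.p≤p⊔q a b) m , downward (value p′) (ℚ.p≤q⊔p a b) m
        , ℚ.≤-trans (ℚ.<⇒≤ (cut-< (value p) pr ¬ps)) h

stretch-lc : LeftContinuous stretch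
stretch-lc p q (s , inj₂ s<0 , ¬ps) = ⊥-elim (¬ps (0≤ p s<0))
stretch-lc p q (s , inj₁ (t , c , (a , b , qa , qb , h) , c<-1 , k) , ¬ps)
  with between q (a ℚ.⊔ b) (⊔≥0 {a} {b} 0≤a+b) (⊔-cut (value q) qa qb)
  where
    0≤t : 0ℚ ℚ.≤ t
    0≤t = ℚ.≤-trans (∉⇒≥0 p ¬ps) (ℚ.≤-trans k (ℚ.≤-trans
            (ℚ.+-monoʳ-≤ t (ℚ.<⇒≤ (ℚ.<-trans c<-1 (ℚ.negative⁻¹ (- 1ℚ))))) (ℚ.≤-reflexive (ℚ.+-identityʳ t))))
    0≤a+b = ℚ.≤-trans 0≤t h
... | p′ , p′<q , m = p′ , p′<q , λ pr → inj₁ (t , c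
        , (a , b , downward (value p′) (ℚ.p≤p⊔q a b) m , downward (value p′) (ℚ.p≤q⊔p a b) m , h)
        , c<-1 , ℚ.≤-trans (ℚ.<⇒≤ (cut-< (value p) pr ¬ps)) k)

upperHalf-lc : ∀ p q → 0ʳ <ʳ value q → p <ⁱ upperHalf q → Σ[ p′ ∈ 𝕀 ] p′ <ⁱ q × 0ʳ <ʳ value p′ × p ≤ⁱ upperHalf p′
upperHalf-lc p q (z , qz , z≮0) (s , (a , b , a<1 , qb , h) , ¬ps)
  with between q (b ℚ.⊔ z) (ℚ.≤-trans (ℚ.≮⇒≥ z≮0) (ℚ.p≤q⊔p b z)) (⊔-cut (value q) qb qz)
... | p′ , p′<q , m = p′ , p′<q , (z , downward (value p′) (ℚ.p≤q⊔p b z) m , z≮0) , λ pr →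
      let r≤s = ℚ.<⇒≤ (cut-< (value p) pr ¬ps) in
      a , b , a<1 , downward (value p′) (ℚ.p≤p⊔q b z) m , ℚ.≤-trans (ℚ.+-mono-≤ r≤s r≤s) h

bend-lc : LeftContinuous bend
bend-lc p q (s , ((a , b , qa , qb , h) , (c , d , c<1 , qd , k)) , ¬ps)
  with between q ((a ℚ.⊔ b) ℚ.⊔ d)
         (ℚ.≤-trans (⊔≥0 {a} {b} (ℚ.≤-trans (∉⇒≥0 p ¬ps) h)) (ℚ.p≤p⊔q (a ℚ.⊔ b) d))
         (⊔-cut (value q) (⊔-cut (value q) qa qb) qd)
... | p′ , p′<q , m = p′ , p′<q , λ pr →
      let r≤s = ℚ.<⇒≤ (cut-< (value p) pr ¬ps)
          ab  = downward (value p′) (ℚ.p≤p⊔q (a ℚ.⊔ b) d) m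
      in (a , b , downward (value p′) (ℚ.p≤p⊔q a b) ab , downward (value p′) (ℚ.p≤q⊔p a b) ab , ℚ.≤-trans r≤s h)
       , (c , d , c<1 , downward (value p′) (ℚ.p≤q⊔p (a ℚ.⊔ b) d) m , ℚ.≤-trans (ℚ.+-mono-≤ r≤s r≤s) k)

sum-≥0 : ∀ p r {s} → ¬ cut (value p +ʳ value r) s → 0ℚ ℚ.≤ s
sum-≥0 p r {s} ¬s = [ (λ s<0 → ⊥-elim (¬s (halfℚ s , halfℚ s , 0≤ p (h s<0) , 0≤ r (h s<0) , ≤halves s)))
                    , (λ z → z) ]′ (split s 0ℚ)
  where h : s ℚ.< 0ℚ → halfℚ s ℚ.< 0ℚ
        h s<0 = double-cancel {halfℚ s} {0ℚ} (subst (ℚ._< 0ℚ) (sym (halfℚ+halfℚ s)) s<0)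

sum-mono : ∀ x y → x ≤ʳ y → x +ʳ x ≤ʳ y +ʳ y
sum-mono x y h (a , b , xa , xb , k) = a , b , h xa , h xb , k

upperHalf-mono : ∀ x y → x ≤ʳ y → (1ʳ +ʳ x) /2ʳ ≤ʳ (1ʳ +ʳ y) /2ʳ
upperHalf-mono x y h (a , b , a<1 , xb , k) = a , b , a<1 , h xb , k

stretch-mono : ∀ p q → p ≤ⁱ q → stretch p ≤ⁱ stretch q
stretch-mono p q h (inj₁ (t , c , u , c<-1 , k)) = inj₁ (t , c , sum-mono (value p) (value q) h u , c<-1 , k)
stretch-mono p q h (inj₂ s<0) = inj₂ s<0

bend-mono : ∀ p q → p ≤ⁱ q → bend p ≤ⁱ bend q
bend-mono p q h {s} (u , v) = sum-mono (value p) (value q) h u , upperHalf-mono (value p) (value q) h {s} v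

------------------------------------------------------------------------

-- Completeness concerns subsets of Carrier : Set ℓ given as predicates in
-- Set ℓ; under excluded middle this covers predicates at every level.
record CommutativeResiduatedCompleteLattice ℓ : Set (lsuc ℓ) where
  infix 4 _≈_ _≤_
  infixl 7 _⊗_
  infixr 5 _↛_
  field
    Carrier        : Set ℓ
    _≈_ _≤_        : Rel Carrier ℓ
    isPartialOrder : IsPartialOrder _≈_ _≤_
    ⋁ ⋀            : (Carrier → Set ℓ) → Carrier
    ⋁-isSupremum   : ∀ P → IsSupremum _≤_ P (⋁ P)
    ⋀-isInfimum    : ∀ P → IsInfimum _≤_ P (⋀ P)
    ⊥ ⊤            : Carrier
    ⊥-least        : ∀ u → ⊥ ≤ u
    ⊤-greatest     : ∀ u → u ≤ ⊤
    _⊗_ _↛_        : Op₂ Carrier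
    ⊗-isCommutativeMonoid : IsCommutativeMonoid _≈_ _⊗_ ⊤
    residual       : ∀ u v w → u ⊗ v ≤ w ⇔ u ≤ v ↛ w

------------------------------------------------------------------------

module USC (em : Classical) {ℓ} (L : CommutativeResiduatedCompleteLattice (lsuc ℓ)) where
  open CommutativeResiduatedCompleteLattice L
  private
    module O = IsPartialOrder isPartialOrder
    module M = IsCommutativeMonoid ⊗-isCommutativeMonoid

  -- Subsets of [0,1] are given as predicates in Set; under excluded middle
  -- these are all subsets.
  record Map : Set (lsuc ℓ) where
    field
      fun       : 𝕀 → Carrier
      preserves : ∀ (P : 𝕀 → Set) s → IsSupremum _≤ⁱ_ P s →
                  IsSupremum _≤_ (λ y → ∃ λ q → P q × y ≈ fun q) (fun s)

    mono : ∀ {p q} → p ≤ⁱ q → fun p ≤ fun q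
    mono {p} {q} p≤q = proj₁ (preserves P q sup) (fun p) (p , inj₁ ((λ z → z) , (λ z → z)) , O.Eq.refl)
      where
        P : 𝕀 → Set
        P x = (x ≤ⁱ p × p ≤ⁱ x) ⊎ (x ≤ⁱ q × q ≤ⁱ x)
        sup : IsSupremum _≤ⁱ_ P q
        sup = (λ { x (inj₁ (x≤p , _)) xr → p≤q (x≤p xr) ; x (inj₂ (x≤q , _)) → x≤q })
            , (λ y h → h q (inj₂ ((λ z → z) , (λ z → z))))

    leftCts : ∀ q y → (∀ p → p <ⁱ q → fun p ≤ y) → fun q ≤ y
    leftCts q y h = proj₂ (preserves (_<ⁱ q) q sup) y
                      λ { _ (p , p<q , e) → O.trans (O.reflexive e) (h p p<q) }
      where
        sup : IsSupremum _≤ⁱ_ (_<ⁱ q) q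
        sup = (λ { x (s , qs , ¬xs) xr → downward (value q) (ℚ.<⇒≤ (cut-< (value x) xr ¬xs)) qs })
            , (λ z k {s} qs → [ 0≤ z
                              , (λ 0≤s → let x , x<q , xs = between q s 0≤s qs in k x x<q xs) ]′ (split s 0ℚ))
  open Map public

  infix 4 _≋_ _⊑_
  _≋_ _⊑_ : Rel Map (lsuc ℓ)
  f ≋ g = ∀ q → fun f q ≈ fun g q
  f ⊑ g = ∀ q → fun g q ≤ fun f q

  ≮⇒≥ : ∀ {x y} → ¬ (x <ʳ y) → y ≤ʳ x
  ≮⇒≥ {x} {y} ¬x<y {s} ys with em {P = cut x s}
  ... | yes xs = xs
  ... | no ¬xs = ⊥-elim (¬x<y (s , ys , ¬xs))

  ≰⇒> : ∀ {x y} → ¬ (x ≤ʳ y) → y <ʳ x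
  ≰⇒> {x} {y} ¬x≤y with em {P = y <ʳ x}
  ... | yes y<x = y<x
  ... | no ¬y<x = ⊥-elim (¬x≤y (≮⇒≥ {y} {x} ¬y<x))

  <-≤ : ∀ x y z → x <ʳ y → y ≤ʳ z → x <ʳ z
  <-≤ x y z (s , ys , ¬xs) y≤z = s , y≤z ys , ¬xs

  mkMap : (f : 𝕀 → Carrier) → (∀ p q → p ≤ⁱ q → f p ≤ f q) →
          (∀ q y → (∀ p → p <ⁱ q → f p ≤ y) → f q ≤ y) → Map
  mkMap f f-mono f-lc = record { fun = f ; preserves = λ P s sup →
      (λ { _ (q , Pq , e) → O.trans (O.reflexive e) (f-mono q s (proj₁ sup q Pq)) })
    , (λ y h → f-lc s y λ p p<s → let q , Pq , p≤q = larger P s sup p p<s in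
               O.trans (f-mono p q p≤q) (h (f q) (q , Pq , O.Eq.refl))) }
    where
      larger : ∀ P s → IsSupremum _≤ⁱ_ P s → ∀ p → p <ⁱ s → ∃ λ q → P q × p ≤ⁱ q
      larger P s sup p (t , st , ¬pt) with em {P = ∃ λ q → P q × p <ⁱ q}
      ... | yes (q , Pq , (r , qr , ¬pr)) =
            q , Pq , λ pt → downward (value q) (ℚ.<⇒≤ (cut-< (value p) pt ¬pr)) qr
      ... | no none = ⊥-elim (¬pt (proj₂ sup p (λ q Pq → ≮⇒≥ {value p} {value q} λ p<q → none (q , Pq , p<q)) st))

  precompose : (g : 𝕀 → 𝕀) → (∀ p q → p ≤ⁱ q → g p ≤ⁱ g q) → LeftContinuous g → Map → Map
  precompose g g-mono g-lc f = mkMap (λ q → fun f (g q)) (λ p q h → mono f (g-mono p q h))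
    λ q y h → leftCts f (g q) y λ p p<gq → let p′ , p′<q , p≤ = g-lc p q p<gq in
      O.trans (mono f p≤) (h p′ p′<q)

  ⋁-upper : ∀ {P x} → P x → x ≤ ⋁ P
  ⋁-upper {P} = proj₁ (⋁-isSupremum P) _

  ⋁-least : ∀ {P y} → (∀ x → P x → x ≤ y) → ⋁ P ≤ y
  ⋁-least {P} = proj₂ (⋁-isSupremum P) _

  -- Infima in USC(L) are pointwise suprema, as the order is reversed.
  inf : (Map → Set (lsuc ℓ)) → Map
  inf P = mkMap (λ q → ⋁ λ x → ∃ λ h → P h × x ≈ fun h q)
    (λ p q p≤q → ⋁-least λ { x (h , Ph , e) →
       O.trans (O.reflexive e) (O.trans (mono h p≤q) (⋁-upper (h , Ph , O.Eq.refl))) })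
    (λ q y k → ⋁-least λ { x (h , Ph , e) → O.trans (O.reflexive e) (leftCts h q y λ p p<q →
       O.trans (⋁-upper (h , Ph , O.Eq.refl)) (k p p<q)) })

  inf-isInfimum : ∀ P → IsInfimum _⊑_ P (inf P)
  inf-isInfimum P = (λ h Ph q → ⋁-upper (h , Ph , O.Eq.refl))
                  , (λ h k q → ⋁-least λ { x (g , Pg , e) → O.trans (O.reflexive e) (k g Pg q) })

  infixl 6 _∔_ _∸_
  _∔_ _∸_ : Op₂ Map
  f ∔ g = mkMap
    (λ q → ⋁ λ x → ∃[ p ] ∃[ r ] value p +ʳ value r <ʳ value q × x ≈ fun f p ⊗ fun g r)
    (λ q q′ q≤q′ → ⋁-least λ { x (p , r , p+r<q , e) →
       ⋁-upper (p , r , <-≤ (value p +ʳ value r) (value q) (value q′) p+r<q q≤q′ , e) })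
    (λ q y k → ⋁-least λ { x (p , r , (s , qs , ¬s) , e) →
       let q′ , q′<q , q′s = between q s (sum-≥0 p r ¬s) qs in
       O.trans (⋁-upper (p , r , (s , q′s , ¬s) , e)) (k q′ q′<q) })
  f ∸ g = inf λ h → f ⊑ g ∔ h

  when : ∀ {P : Set} → Dec P → (P → Carrier) → Carrier → Carrier
  when (yes x) t e = t x
  when (no _)  t e = e

  halve : Op₁ Map
  halve f = mkMap at at-mono at-lc
    where
      at : 𝕀 → Carrier
      at q = when (em {P = value q ≤ʳ ½ʳ}) (λ q≤½ → fun f (twice q q≤½)) ⊤

      at-mono : ∀ p q → p ≤ⁱ q → at p ≤ at q
      at-mono p q p≤q with em {P = value p ≤ʳ ½ʳ} | em {P = value q ≤ʳ ½ʳ}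
      ... | yes _   | yes _   = mono f (sum-mono (value p) (value q) p≤q)
      ... | no ¬p≤½ | yes q≤½ = ⊥-elim (¬p≤½ λ pr → q≤½ (p≤q pr))
      ... | _       | no _    = ⊤-greatest _

      at-small : ∀ p (h : value p ≤ʳ ½ʳ) → fun f (twice p h) ≤ at p
      at-small p h with em {P = value p ≤ʳ ½ʳ}
      ... | yes _ = mono f λ z → z
      ... | no ¬h = ⊥-elim (¬h h)

      at-large : ∀ p → ½ʳ <ʳ value p → ⊤ ≤ at p
      at-large p (s , ps , s≮½) with em {P = value p ≤ʳ ½ʳ}
      ... | yes h = ⊥-elim (s≮½ (h ps))
      ... | no _  = O.refl

      at-lc : ∀ q y → (∀ p → p <ⁱ q → at p ≤ y) → at q ≤ y
      at-lc q y k with em {P = value q ≤ʳ ½ʳ}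
      ... | yes q≤½ = leftCts f (twice q q≤½) y λ p p<2q →
              let p′ , p′<q , p≤2p′ = twice-lc p q p<2q
                  s , qs , ¬ps = p′<q
                  p′≤½ = λ {r} pr → ℚ.<-trans (cut-< (value p′) {r} pr ¬ps) (q≤½ qs)
              in O.trans (mono f p≤2p′) (O.trans (at-small p′ p′≤½) (k p′ p′<q))
      ... | no ¬q≤½ =
              let s , qs , s≮½ = ≰⇒> {value q} {½ʳ} ¬q≤½
                  p , p<q , ps = between q s (ℚ.≤-trans (ℚ.<⇒≤ (ℚ.positive⁻¹ ½)) (ℚ.≮⇒≥ s≮½)) qs
              in O.trans (at-large p (s , ps , s≮½)) (k p p<q)

  double j⁎ α : Op₁ Map
  double = precompose half (λ _ _ h → h) half-lc
  j⁎     = precompose stretch stretch-mono stretch-lc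
  α      = precompose bend bend-mono bend-lc

  -- q ↦ t q for q > 0, and 0 ↦ ⊥
  onPositive : (t : 𝕀 → Carrier) → (∀ p q → p ≤ⁱ q → t p ≤ t q) →
               (∀ q y → 0ʳ <ʳ value q → (∀ p → 0ʳ <ʳ value p → p <ⁱ q → t p ≤ y) → t q ≤ y) → Map
  onPositive t t-mono t-lc = mkMap at at-mono at-lc
    where
      at : 𝕀 → Carrier
      at q = when (em {P = 0ʳ <ʳ value q}) (λ _ → t q) ⊥

      at-mono : ∀ p q → p ≤ⁱ q → at p ≤ at q
      at-mono p q p≤q with em {P = 0ʳ <ʳ value p} | em {P = 0ʳ <ʳ value q}
      ... | yes _   | yes _  = t-mono p q p≤q
      ... | yes 0<p | no 0≮q = ⊥-elim (0≮q (<-≤ 0ʳ (value p) (value q) 0<p p≤q))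
      ... | no _    | _      = ⊥-least _

      at-pos : ∀ p → 0ʳ <ʳ value p → t p ≤ at p
      at-pos p 0<p with em {P = 0ʳ <ʳ value p}
      ... | yes _  = O.refl
      ... | no 0≮p = ⊥-elim (0≮p 0<p)

      at-lc : ∀ q y → (∀ p → p <ⁱ q → at p ≤ y) → at q ≤ y
      at-lc q y k with em {P = 0ʳ <ʳ value q}
      ... | yes 0<q = t-lc q y 0<q λ p 0<p p<q → O.trans (at-pos p 0<p) (k p p<q)
      ... | no _    = ⊥-least y

  j : Op₁ Map
  j f = onPositive (λ q → fun f (upperHalf q)) (λ p q h → mono f λ {s} → upperHalf-mono (value p) (value q) h {s})
    λ q y 0<q k → leftCts f (upperHalf q) y λ p p< →
      let p′ , p′<q , 0<p′ , p≤ = upperHalf-lc p q 0<q p< in O.trans (mono f p≤) (k p′ 0<p′ p′<q)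

  𝟎 𝟏 : Map
  𝟎 = onPositive (λ _ → ⊤) (λ _ _ _ → O.refl)
    λ { q y (s , qs , s≮0) k → let p , p<q , ps = between q s (ℚ.≮⇒≥ s≮0) qs in k p (s , ps , s≮0) p<q }
  𝟏 = mkMap (λ _ → ⊥) (λ _ _ _ → O.refl) (λ _ y _ → ⊥-least y)

  structure : Structure (lsuc ℓ) (lsuc ℓ)
  structure = record
    { Carrier = Map
    ; _≈_     = _≋_
    ; _≤_     = _⊑_
    ; _∨_     = λ f g → inf λ h → f ⊑ h × g ⊑ h
    ; _∧_     = λ f g → inf λ h → h ≋ f ⊎ h ≋ g
    ; _∔_     = _∔_
    ; _∸_     = _∸_
    ; halve   = halve
    ; double  = double
    ; j⁎      = j⁎
    ; j       = j
    ; α       = α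
    ; 𝟎       = 𝟎
    ; 𝟏       = 𝟏
    }

  -- The infimum defining f ∸ g is attained.
  ∸-least : ∀ f g → f ⊑ g ∔ (f ∸ g) × (∀ h → f ⊑ g ∔ h → (f ∸ g) ⊑ h)
  ∸-least f g =
      (λ q → ⋁-least λ { x (p , r , p+r<q , e) → O.trans (O.reflexive (O.Eq.trans e (M.comm _ _)))
         (Equivalence.from (residual _ _ _) (⋁-least λ { y (h , f⊑ , e′) →
           O.trans (O.reflexive e′) (Equivalence.to (residual _ _ _)
             (O.trans (⋁-upper (p , r , p+r<q , M.comm _ _)) (f⊑ q))) })) })
    , proj₁ (inf-isInfimum _)

{-# OPTIONS --safe #-}
-- Call an element c of a model crisp if 2c ≤ c; in [0,1] the crisp numbers are 0 and 1.  In a model Q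
-- that is complete and archimedean (u ≲ v implies u ≤ v), such as the quotient of the completion of A,
-- the crisp elements with the reversed order and ∔ as product form the lattice L.  An element w has a
-- largest crisp element κ w = ⋀ₙ αⁿ w below it, and u is sent to F u : q ↦ ⋀_{r<q} κ (u ∔ (1 − r)),
-- r ranging over the dyadic numbers; conversely f is sent to G f = ⋀_d (d ∔ f d).  The last two axioms
-- say that G (F u) = u.  That F (G f) = f, and that F preserves ∔, 2 and j⁎, rests on the fact that a
-- crisp c with c ≤ j⁎ v satisfies c ≤ v, whence c ≤ e ∔ d with e crisp and d < 1 gives c ≤ e.  The
-- remaining operations are determined by the order or by an adjunction.
module Submission where

open import Defs
open import Algebra.Bundles using (CommutativeMonoid)
import Algebra.Properties.CommutativeMonoid.Mult as Mult
import Algebra.Properties.CommutativeSemigroup as CommutativeSemigroup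
open import Algebra.Structures using (IsCommutativeMonoid)
open import Data.Bool.Base using (if_then_else_)
open import Data.Empty using (⊥-elim)
open import Data.Integer.Base as ℤ using (+_; +≤+)
import Data.Integer.Properties as ℤ
open import Data.Nat.Base as ℕ using (ℕ; zero; _^_; ⌊_/2⌋)
open import Data.Nat.Divisibility using (_∣_; _∣?_; divides)
open import Data.Nat.GeneralisedArithmetic using (fold)
import Data.Nat.Properties as ℕ
open import Data.Product using (∃; Σ; Σ-syntax; _×_; _,_; proj₁; proj₂)
open import Data.Rational.Base as ℚ using (ℚ; 0ℚ; 1ℚ; ½; mkℚ; 1/_; -_)
import Data.Rational.Properties as ℚ
open import Data.Rational.Solver using (module +-*-Solver)
import Data.Rational.Unnormalised.Base as ℚᵘ
import Data.Rational.Unnormalised.Properties as ℚᵘ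
open import Data.Sum.Base using (_⊎_; inj₁; inj₂; [_,_]′)
open import Function.Bundles using (_⇔_; mk⇔; Equivalence)
open import Level using (Level; suc; _⊔_; Lift; lift; lower)
open import Relation.Binary.Bundles using (Setoid)
open import Relation.Binary.Definitions using (Transitive)
open import Relation.Binary.Lattice.Structures using (IsBoundedLattice)
open import Relation.Binary.Morphism.Structures using (IsOrderMonomorphism; IsOrderIsomorphism)
open import Relation.Binary.PropositionalEquality.Core using (_≡_; refl; sym; trans; cong; cong₂; subst; subst₂)
import Relation.Binary.Reasoning.Setoid as SetoidReasoning
open import Relation.Binary.Structures using (IsEquivalence; IsPartialOrder)
open import Relation.Nullary.Decidable.Core using (Dec; yes; no; does; True; toWitness; fromWitness)
open import Relation.Nullary.Negation.Core using (¬_)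

open Equivalence using (to; from)
open ℝ
open 𝕀
open +-*-Solver using (solve; _:+_; _:=_; con; :-_)

-- Dyadic numbers

-- By its axioms `α` is inverse to w ↦ 2w ∧ j⁎ w, so it is an order automorphism and commutes with
-- all infima. This is why it extends to the completion by the formula for infima, and why ⋀ₙ αⁿ w
-- is a fixed point of `α`. In [0,1] it is w ↦ max(w/2, 2w - 1): its fixed points are 0 and 1, and
-- its iterates keep 1 and drive every w < 1 to 0. Thus κ (u ∔ (1 - r)) is 1 if r ≤ u and 0
-- otherwise, and F u records which numbers lie below u. Completeness supplies these infima; a model
-- A without it is handled by embedding its quotient into that of its completion. Truncation is the
-- obstacle: ∔ cannot be cancelled in a model. Inequalities are therefore proved up to an error 2⁻ⁿ,
-- by inductions that halve the error, and the archimedean property removes it at the end. Infima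
-- are moved through ∔ by residuation.

infix 8 _/2^_
infixl 6 _⊕_

-- Fractions are neither reduced nor bounded by 1, so that sums and halves are formed without case
-- distinctions. They are compared only through their interpretations `val` in the rationals and `D`
-- in a model.
record 𝔻 : Set where
  constructor _/2^_
  field
    num exp : ℕ


_⊕_ : 𝔻 → 𝔻 → 𝔻
k /2^ m ⊕ l /2^ n = (k ℕ.* 2 ^ n ℕ.+ l ℕ.* 2 ^ m) /2^ (m ℕ.+ n)

half𝔻 : 𝔻 → 𝔻
half𝔻 (k /2^ m) = k /2^ ℕ.suc m

-- Stated for any commutative monoid with a halving sequence, because it is applied twice: to the
-- rationals, giving `val`, and to a model under `∔`, giving `D`.
module Halving {c ℓ} (M : CommutativeMonoid c ℓ) (δ : ℕ → CommutativeMonoid.Carrier M)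
  (halves : ∀ n → CommutativeMonoid._≈_ M (CommutativeMonoid._∙_ M (δ (ℕ.suc n)) (δ (ℕ.suc n))) (δ n)) where
  open CommutativeMonoid M renaming (refl to ≈-refl; sym to ≈-sym; trans to ≈-trans)
  open Mult M public using () renaming
    (_×_ to _·_; ×-homo-+ to ·-homo-+; ×-assocˡ to ·-assocˡ; ×-distrib-+ to ·-distrib-∙; ×-congʳ to ·-congʳ; ×-congˡ to ·-congˡ)
  open import Relation.Binary.Reasoning.Setoid setoid

  ⟦_⟧ : 𝔻 → Carrier
  ⟦ k /2^ m ⟧ = k · δ m

  double-refine : ∀ k m → (k ℕ.* 2) · δ (ℕ.suc m) ≈ k · δ m
  double-refine k m = begin
    (k ℕ.* 2) · δ (ℕ.suc m)   ≈⟨ ·-assocˡ (δ (ℕ.suc m)) k 2 ⟨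
    k · (2 · δ (ℕ.suc m))     ≈⟨ ·-congʳ k (∙-congˡ (identityʳ _)) ⟩
    k · (δ (ℕ.suc m) ∙ δ (ℕ.suc m)) ≈⟨ ·-congʳ k (halves m) ⟩
    k · δ m                 ∎

  refine : ∀ i k m → (k ℕ.* 2 ^ i) · δ (i ℕ.+ m) ≈ k · δ m
  refine zero    k m = ·-congˡ (ℕ.*-identityʳ k)
  refine (ℕ.suc i) k m = begin
    (k ℕ.* 2 ^ ℕ.suc i) · δ (ℕ.suc (i ℕ.+ m))
      ≈⟨ ·-congˡ (trans (cong (k ℕ.*_) (ℕ.*-comm 2 (2 ^ i))) (sym (ℕ.*-assoc k (2 ^ i) 2))) ⟩
    (k ℕ.* 2 ^ i ℕ.* 2) · δ (ℕ.suc (i ℕ.+ m)) ≈⟨ double-refine (k ℕ.* 2 ^ i) (i ℕ.+ m) ⟩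
    (k ℕ.* 2 ^ i) · δ (i ℕ.+ m) ≈⟨ refine i k m ⟩
    k · δ m ∎

  refineʳ : ∀ i k m → (k ℕ.* 2 ^ i) · δ (m ℕ.+ i) ≈ k · δ m
  refineʳ i k m rewrite ℕ.+-comm m i = refine i k m

  ⟦⊕⟧ : ∀ x y → ⟦ x ⊕ y ⟧ ≈ ⟦ x ⟧ ∙ ⟦ y ⟧
  ⟦⊕⟧ (k /2^ m) (l /2^ n) = begin
    (k ℕ.* 2 ^ n ℕ.+ l ℕ.* 2 ^ m) · δ (m ℕ.+ n)
      ≈⟨ ·-homo-+ _ (k ℕ.* 2 ^ n) (l ℕ.* 2 ^ m) ⟩
    (k ℕ.* 2 ^ n) · δ (m ℕ.+ n) ∙ (l ℕ.* 2 ^ m) · δ (m ℕ.+ n)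
      ≈⟨ ∙-cong (refineʳ n k m) (refine m l n) ⟩
    k · δ m ∙ l · δ n ∎

  ⟦half⊕half⟧ : ∀ x → ⟦ half𝔻 x ⟧ ∙ ⟦ half𝔻 x ⟧ ≈ ⟦ x ⟧
  ⟦half⊕half⟧ (k /2^ m) = begin
    k · δ (ℕ.suc m) ∙ k · δ (ℕ.suc m) ≈⟨ ·-distrib-∙ _ _ k ⟨
    k · (δ (ℕ.suc m) ∙ δ (ℕ.suc m))   ≈⟨ ·-congʳ k (halves m) ⟩
    k · δ m                       ∎

-- Dyadic numbers as rationals

unit : ℕ → ℚ
unit zero    = 1ℚ
unit (ℕ.suc n) = halfℚ (unit n)

unit-halves : ∀ n → unit (ℕ.suc n) ℚ.+ unit (ℕ.suc n) ≡ unit n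
unit-halves n = halfℚ+halfℚ (unit n)

open Halving ℚ.+-0-commutativeMonoid unit unit-halves public using () renaming
  ( _·_ to _·ℚ_; ⟦_⟧ to val; refine to unit-refine; refineʳ to unit-refineʳ; ·-homo-+ to ·ℚ-homo-+
  ; ⟦⊕⟧ to val-⊕; ⟦half⊕half⟧ to val-half)

unit-pos : ∀ n → 0ℚ ℚ.< unit n
unit-pos zero    = ℚ.positive⁻¹ 1ℚ
unit-pos (ℕ.suc n) = double-cancel {0ℚ} (subst (0ℚ ℚ.<_) (sym (unit-halves n)) (unit-pos n))

·ℚ-nonNeg : ∀ k {x} → 0ℚ ℚ.≤ x → 0ℚ ℚ.≤ k ·ℚ x
·ℚ-nonNeg zero    h = ℚ.≤-refl
·ℚ-nonNeg (ℕ.suc k) h = ℚ.+-mono-≤ h (·ℚ-nonNeg k h)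

·ℚ-mono : ∀ {k l x} → k ℕ.≤ l → 0ℚ ℚ.≤ x → k ·ℚ x ℚ.≤ l ·ℚ x
·ℚ-mono {l = l} ℕ.z≤n   h = ·ℚ-nonNeg l h
·ℚ-mono {x = x} (ℕ.s≤s k) h = ℚ.+-monoʳ-≤ x (·ℚ-mono k h)

·ℚ-mono-< : ∀ {k l x} → k ℕ.< l → 0ℚ ℚ.< x → k ·ℚ x ℚ.< l ·ℚ x
·ℚ-mono-< {k} {l} {x} k<l h = ℚ.<-≤-trans
  (subst (ℚ._< ℕ.suc k ·ℚ x) (ℚ.+-identityˡ _) (ℚ.+-monoˡ-< (k ·ℚ x) h)) (·ℚ-mono k<l (ℚ.<⇒≤ h))

·ℚ-cancel : ∀ k l {x} → 0ℚ ℚ.< x → k ·ℚ x ℚ.≤ l ·ℚ x → k ℕ.≤ l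
·ℚ-cancel k l h le = ℕ.≮⇒≥ λ l<k → ℚ.<-irrefl refl (ℚ.≤-<-trans le (·ℚ-mono-< l<k h))

val-nonNeg : ∀ x → 0ℚ ℚ.≤ val x
val-nonNeg (k /2^ m) = ·ℚ-nonNeg k (ℚ.<⇒≤ (unit-pos m))

2^·unit : ∀ n → (2 ^ n) ·ℚ unit n ≡ 1ℚ
2^·unit n = trans (cong₂ (λ k l → k ·ℚ unit l) (sym (ℕ.*-identityˡ (2 ^ n))) (sym (ℕ.+-identityʳ n)))
                  (unit-refine n 1 0)

val≤1 : ∀ {k m} → k ℕ.≤ 2 ^ m → val (k /2^ m) ℚ.≤ 1ℚ
val≤1 {m = m} h = ℚ.≤-trans (·ℚ-mono h (ℚ.<⇒≤ (unit-pos m))) (ℚ.≤-reflexive (2^·unit m))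

val≤1⁻¹ : ∀ k m → val (k /2^ m) ℚ.≤ 1ℚ → k ℕ.≤ 2 ^ m
val≤1⁻¹ k m h = ·ℚ-cancel k (2 ^ m) (unit-pos m) (ℚ.≤-trans h (ℚ.≤-reflexive (sym (2^·unit m))))

val<1⁻¹ : ∀ k m → val (k /2^ m) ℚ.< 1ℚ → k ℕ.< 2 ^ m
val<1⁻¹ k m h = ℕ.≰⇒> λ le → ℚ.<-irrefl refl (ℚ.<-≤-trans h
  (ℚ.≤-trans (ℚ.≤-reflexive (sym (2^·unit m))) (·ℚ-mono le (ℚ.<⇒≤ (unit-pos m)))))

-- Over the common denominator 2^(m + n) the unit cancels. The result speaks of natural numbers
-- only, so it can be carried over to multiples of `δ (m + n)` in a model, where nothing cancels.
val-cross : ∀ k m l n → val (k /2^ m) ℚ.≤ val (l /2^ n) → k ℕ.* 2 ^ n ℕ.≤ l ℕ.* 2 ^ m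
val-cross k m l n h = ·ℚ-cancel (k ℕ.* 2 ^ n) (l ℕ.* 2 ^ m) (unit-pos (m ℕ.+ n))
  (ℚ.≤-trans (ℚ.≤-reflexive (unit-refineʳ n k m)) (ℚ.≤-trans h (ℚ.≤-reflexive (sym (unit-refine m l n)))))

co : 𝔻 → 𝔻
co (k /2^ m) = (2 ^ m ℕ.∸ k) /2^ m

val-co : ∀ x → val x ℚ.≤ 1ℚ → val x ℚ.+ val (co x) ≡ 1ℚ
val-co (k /2^ m) h = trans (sym (·ℚ-homo-+ (unit m) k (2 ^ m ℕ.∸ k)))
  (trans (cong (_·ℚ unit m) (ℕ.m+[n∸m]≡n (val≤1⁻¹ k m h))) (2^·unit m))

n≤2^n : ∀ n → n ℕ.≤ 2 ^ n
n≤2^n zero    = ℕ.z≤n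
n≤2^n (ℕ.suc n) = ℕ.+-mono-≤ (ℕ.m^n>0 2 n) (ℕ.≤-trans (n≤2^n n) (ℕ.m≤m+n (2 ^ n) 0))

toℚᵘ-· : ∀ n → ℚ.toℚᵘ (n ·ℚ 1ℚ) ℚᵘ.≃ ℚᵘ.mkℚᵘ (+ n) 0
toℚᵘ-· zero    = ℚᵘ.≃-refl
toℚᵘ-· (ℕ.suc n) = ℚᵘ.≃-trans (ℚ.toℚᵘ-homo-+ 1ℚ (n ·ℚ 1ℚ)) (ℚᵘ.≃-trans (ℚᵘ.+-congʳ (ℚ.toℚᵘ 1ℚ) (toℚᵘ-· n))
  (ℚᵘ.*≡* (cong (ℤ._* + 1) (cong (λ z → + 1 ℤ.+ z) (ℤ.*-identityʳ (+ n))))))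

ℕ-bound : ∀ p → ∃ λ n → p ℚ.≤ n ·ℚ 1ℚ
ℕ-bound (mkℚ i d c) = ℤ.∣ i ∣ , ℚ.toℚᵘ-cancel-≤ (ℚᵘ.≤-respʳ-≃ (ℚᵘ.≃-sym (toℚᵘ-· ℤ.∣ i ∣))
  (ℚᵘ.*≤* (ℤ.≤-trans (ℤ.≤-reflexive (ℤ.*-identityʳ i)) (ℤ.≤-trans (i≤∣i∣ i) (subst (+ ℤ.∣ i ∣ ℤ.≤_) (ℤ.pos-* ℤ.∣ i ∣ (ℕ.suc d))
    (+≤+ (ℕ.m≤m*n ℤ.∣ i ∣ (ℕ.suc d))))))))
  where
  i≤∣i∣ : ∀ i → i ℤ.≤ + ℤ.∣ i ∣
  i≤∣i∣ (+ n)        = ℤ.≤-refl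
  i≤∣i∣ (ℤ.-[1+ n ]) = ℤ.-≤+

·ℚ-as-* : ∀ n x → n ·ℚ x ≡ (n ·ℚ 1ℚ) ℚ.* x
·ℚ-as-* zero    x = sym (ℚ.*-zeroˡ x)
·ℚ-as-* (ℕ.suc n) x = trans (cong₂ ℚ._+_ (sym (ℚ.*-identityˡ x)) (·ℚ-as-* n x)) (sym (ℚ.*-distribʳ-+ x 1ℚ (n ·ℚ 1ℚ)))

abstract
  -- For n ≥ 1/ε one has 2ⁿ · ε ≥ n · ε ≥ 1 = 2ⁿ · `unit n`, and the positive factor 2ⁿ cancels.
  unit-small : ∀ ε → 0ℚ ℚ.< ε → ∃ λ n → unit n ℚ.≤ ε
  unit-small ε 0<ε with ℕ-bound ((1/ ε) {{ℚ.>-nonZero 0<ε}})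
  ... | n , 1/ε≤n = n , ℚ.*-cancelˡ-≤-pos r (ℚ.≤-trans (ℚ.≤-reflexive (trans (sym (·ℚ-as-* (2 ^ n) (unit n))) (2^·unit n)))
                      (ℚ.≤-trans 1≤nε (ℚ.*-monoʳ-≤-nonNeg ε {{ℚ.nonNegative (ℚ.<⇒≤ 0<ε)}} (·ℚ-mono (n≤2^n n) (ℚ.nonNegative⁻¹ 1ℚ)))))
    where
    instance
      nz : ℚ.NonZero ε
      nz = ℚ.>-nonZero 0<ε
    r : ℚ
    r = (2 ^ n) ·ℚ 1ℚ
    instance
      r-pos : ℚ.Positive r
      r-pos = ℚ.positive (·ℚ-mono-< {0} (ℕ.m^n>0 2 n) (ℚ.positive⁻¹ 1ℚ))
    1≤nε : 1ℚ ℚ.≤ (n ·ℚ 1ℚ) ℚ.* ε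
    1≤nε = ℚ.≤-trans (ℚ.≤-reflexive (sym (ℚ.*-inverseˡ ε)))
             (ℚ.*-monoʳ-≤-nonNeg ε {{ℚ.nonNegative (ℚ.<⇒≤ 0<ε)}} 1/ε≤n)

-- Models and their quotients by ≃

module ModelProperties {c ℓ} {S : Structure c ℓ} (isModel : IsModel S) where
  open Structure S
  open IsModel isModel
  open Equivalence

  open IsBoundedLattice isBoundedLattice public
    using (isPartialOrder; antisym; maximum; minimum; x≤x∨y; y≤x∨y; ∨-least; x∧y≤x; x∧y≤y; ∧-greatest; module Eq)
    renaming (refl to ≤-refl; trans to ≤-trans; reflexive to ≤-reflexive)
  open IsCommutativeMonoid ∔-isCommutativeMonoid public
    using () renaming (assoc to ∔-assoc; comm to ∔-comm; identityˡ to ∔-identityˡ; identityʳ to ∔-identityʳ; ∙-cong to ∔-cong)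

  ∔-commutativeMonoid : CommutativeMonoid c ℓ
  ∔-commutativeMonoid = record { isCommutativeMonoid = ∔-isCommutativeMonoid }

  ≥-reflexive : ∀ {u v} → u ≈ v → v ≤ u
  ≥-reflexive e = ≤-reflexive (Eq.sym e)

  to-∸ : ∀ {u v w} → w ≤ u ∔ v → w ∸ v ≤ u
  to-∸ = to (∸-residual _ _ _)

  from-∸ : ∀ {u v w} → w ∸ v ≤ u → w ≤ u ∔ v
  from-∸ = from (∸-residual _ _ _)

  ∔-monoˡ : ∀ {u u′ v} → u ≤ u′ → u ∔ v ≤ u′ ∔ v
  ∔-monoˡ h = from-∸ (≤-trans (to-∸ ≤-refl) h)

  ∔-swap : ∀ {u v} → u ∔ v ≤ v ∔ u
  ∔-swap = ≤-reflexive (∔-comm _ _)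

  ∔-mono : ∀ {u u′ v v′} → u ≤ u′ → v ≤ v′ → u ∔ v ≤ u′ ∔ v′
  ∔-mono h k = ≤-trans (∔-monoˡ h) (≤-trans ∔-swap (≤-trans (∔-monoˡ k) ∔-swap))

  ∔-monoʳ : ∀ {u v v′} → v ≤ v′ → u ∔ v ≤ u ∔ v′
  ∔-monoʳ = ∔-mono ≤-refl

  ≤-∔ʳ : ∀ {u v} → u ≤ u ∔ v
  ≤-∔ʳ = ≤-trans (≥-reflexive (∔-identityʳ _)) (∔-monoʳ (minimum _))

  ≤-∔ˡ : ∀ {u v} → v ≤ u ∔ v
  ≤-∔ˡ = ≤-trans ≤-∔ʳ ∔-swap

  ∔-assoc≤ : ∀ {u v w} → u ∔ v ∔ w ≤ u ∔ (v ∔ w)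
  ∔-assoc≤ = ≤-reflexive (∔-assoc _ _ _)

  ∔-assoc≥ : ∀ {u v w} → u ∔ (v ∔ w) ≤ u ∔ v ∔ w
  ∔-assoc≥ = ≥-reflexive (∔-assoc _ _ _)

  ∔-swapʳ : ∀ {u v w} → u ∔ v ∔ w ≤ u ∔ w ∔ v
  ∔-swapʳ = ≤-trans ∔-assoc≤ (≤-trans (∔-monoʳ ∔-swap) ∔-assoc≥)

  -- `_∔ w` is right adjoint to `_∸ w` and therefore preserves meets.
  ∔-∧ : ∀ {u v w x} → x ≤ u ∔ w → x ≤ v ∔ w → x ≤ (u ∧ v) ∔ w
  ∔-∧ h k = from-∸ (∧-greatest (to-∸ h) (to-∸ k))

  halve⇒ : ∀ {u v} → halve u ≤ v → u ≤ double v
  halve⇒ h = ≤-trans (double-halve _) (double-mono h)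

  halve⇐ : ∀ {u v} → u ≤ double v → halve u ≤ v
  halve⇐ h = ≤-trans (halve-mono h) (halve-double _)

  j⇒ : ∀ {u v} → j u ≤ v → u ≤ j⁎ v
  j⇒ h = ≤-trans (j⁎-j _) (j⁎-mono h)

  j⇐ : ∀ {u v} → u ≤ j⁎ v → j u ≤ v
  j⇐ h = ≤-trans (j-mono h) (j-j⁎ _)

  -- `α` is inverse to the monotone map v ↦ 2v ∧ j⁎ v, hence its left adjoint. The adjunction is
  -- split into this rule and the two converses that follow.
  α⇐ : ∀ {u v} → u ≤ double v → u ≤ j⁎ v → α u ≤ v
  α⇐ h k = ≤-trans (α-mono (∧-greatest h k)) (≤-reflexive (α-left _))

  α⇒double : ∀ {u v} → α u ≤ v → u ≤ double v
  α⇒double h = ≤-trans (≥-reflexive (α-right _)) (≤-trans (x∧y≤x _ _) (double-mono h))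

  α⇒j⁎ : ∀ {u v} → α u ≤ v → u ≤ j⁎ v
  α⇒j⁎ h = ≤-trans (≥-reflexive (α-right _)) (≤-trans (x∧y≤y _ _) (j⁎-mono h))

  α-cong : ∀ {u v} → u ≈ v → α u ≈ α v
  α-cong e = antisym (α-mono (≤-reflexive e)) (α-mono (≥-reflexive e))

  j⁎-cong : ∀ {u v} → u ≈ v → j⁎ u ≈ j⁎ v
  j⁎-cong e = antisym (j⁎-mono (≤-reflexive e)) (j⁎-mono (≥-reflexive e))

  α^-mono : ∀ n {u v} → u ≤ v → α^ n u ≤ α^ n v
  α^-mono zero    h = h
  α^-mono (ℕ.suc n) h = α-mono (α^-mono n h)

  meet-greatest : ∀ n {t w} → (∀ i → i ℕ.< n → w ≤ t (ℕ.suc i)) → w ≤ meet n t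
  meet-greatest zero    h = maximum _
  meet-greatest (ℕ.suc n) {t} h = ∧-greatest (h 0 ℕ.z<s) (meet-greatest n {λ k → t (ℕ.suc k)} λ i i<n → h (ℕ.suc i) (ℕ.s<s i<n))

  halves : ℕ → Carrier
  halves = fold (j⁎ 𝟎) halve

  halve-defl : ∀ {v} → halve v ≤ v
  halve-defl = halve⇐ (double-infl _)

  halves≤j⁎𝟎 : ∀ n → halves n ≤ j⁎ 𝟎
  halves≤j⁎𝟎 zero    = ≤-refl
  halves≤j⁎𝟎 (ℕ.suc n) = ≤-trans halve-defl (halves≤j⁎𝟎 n)

  -- α v = halve v ∨ j v, and j vanishes below j⁎ 𝟎.
  α-halves : ∀ n → α^ n (j⁎ 𝟎) ≈ halves n
  α-halves zero    = Eq.refl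
  α-halves (ℕ.suc n) = Eq.trans (α-cong (α-halves n)) (antisym
    (α⇐ (double-halve _) (≤-trans (halves≤j⁎𝟎 n) (j⁎-mono (minimum _))))
    (halve⇐ (α⇒double ≤-refl)))

  halves-∔ : ∀ n → halves (ℕ.suc n) ∔ halves (ℕ.suc n) ≤ halves n
  halves-∔ n = ≤-trans (∔-mono (≥-reflexive (α-halves (ℕ.suc n))) (≥-reflexive (α-halves (ℕ.suc n))))
                       (≤-trans (α^-halves n) (≤-reflexive (α-halves n)))

  δ : ℕ → Carrier
  δ = dyadic 1

  -- The test `2 ∣? 1` computes to no, so `dyadic 1 (suc n)` is the sum of a single copy,
  -- `halves n ∔ 𝟎`.
  δ≈halves : ∀ n → δ (ℕ.suc n) ≈ halves n
  δ≈halves n = ∔-identityʳ _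

  δ≤double-δ : ∀ n → δ n ≤ double (δ (ℕ.suc n))
  δ≤double-δ zero    = ≤-trans 𝟏≤double-j⁎𝟎 (double-mono (≥-reflexive (δ≈halves 0)))
  δ≤double-δ (ℕ.suc n) = ≤-trans (≤-reflexive (δ≈halves n))
    (≤-trans (double-halve _) (double-mono (≥-reflexive (δ≈halves (ℕ.suc n)))))

  δ-∔-≤ : ∀ n → δ (ℕ.suc n) ∔ δ (ℕ.suc n) ≤ δ n
  δ-∔-≤ zero    = maximum _
  δ-∔-≤ (ℕ.suc n) = ≤-trans (∔-mono (≤-reflexive (δ≈halves (ℕ.suc n))) (≤-reflexive (δ≈halves (ℕ.suc n))))
                    (≤-trans (halves-∔ n) (≥-reflexive (δ≈halves n)))

  -- One inequality is the axiom `α^-halves`, translated by `α-halves`; the other is the adjunction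
  -- of `halve` and `double` followed by `double≤∔`. At n = 0 the term `δ 0` is 𝟏, and
  -- `𝟏≤double-j⁎𝟎` takes the place of the adjunction.
  δ-∔ : ∀ n → δ (ℕ.suc n) ∔ δ (ℕ.suc n) ≈ δ n
  δ-∔ n = antisym (δ-∔-≤ n) (≤-trans (δ≤double-δ n) (double≤∔ _))

  double-δ : ∀ n → double (δ (ℕ.suc n)) ≈ δ n
  double-δ n = antisym (≤-trans (double≤∔ _) (δ-∔-≤ n)) (δ≤double-δ n)

  δ-mono : ∀ n → δ (ℕ.suc n) ≤ δ n
  δ-mono n = ≤-trans (double-infl _) (≤-reflexive (double-δ n))

  double-𝟎 : double 𝟎 ≈ 𝟎
  double-𝟎 = antisym (≤-trans (double≤∔ _) (≤-reflexive (∔-identityʳ _))) (minimum _)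

  open Halving ∔-commutativeMonoid δ δ-∔ public
    renaming (⟦_⟧ to D; ⟦⊕⟧ to D-⊕; refine to δ-refine; refineʳ to δ-refineʳ)

  ·-mono : ∀ {k l u} → k ℕ.≤ l → k · u ≤ l · u
  ·-mono ℕ.z≤n     = minimum _
  ·-mono (ℕ.s≤s h) = ∔-monoʳ (·-mono h)

  D-mono : ∀ x y → val x ℚ.≤ val y → D x ≤ D y
  D-mono (k /2^ m) (l /2^ n) h = ≤-trans (≥-reflexive (δ-refineʳ n k m))
    (≤-trans (·-mono (val-cross k m l n h)) (≤-reflexive (δ-refine m l n)))

  D-cong : ∀ x y → val x ≡ val y → D x ≈ D y
  D-cong x y e = antisym (D-mono x y (ℚ.≤-reflexive e)) (D-mono y x (ℚ.≤-reflexive (sym e)))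

  𝟏≤D : ∀ x → 1ℚ ℚ.≤ val x → 𝟏 ≤ D x
  𝟏≤D x h = ≤-trans ≤-∔ʳ (D-mono (1 /2^ 0) x (ℚ.≤-trans (ℚ.≤-reflexive (ℚ.+-identityʳ 1ℚ)) h))

  double-· : ∀ k n → double (k · δ (ℕ.suc n)) ≈ k · δ n
  double-· zero    n = double-𝟎
  double-· (ℕ.suc k) n = Eq.trans (double-∔ _ _) (∔-cong (double-δ n) (double-· k n))

  double-D : ∀ x → double (D (half𝔻 x)) ≈ D x
  double-D (k /2^ m) = double-· k m

  δ≈D : ∀ n → D (1 /2^ n) ≈ δ n
  δ≈D n = ∔-identityʳ _

  D1≈j⁎𝟎 : D (1 /2^ 1) ≈ j⁎ 𝟎
  D1≈j⁎𝟎 = Eq.trans (δ≈D 1) (δ≈halves 0)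

  -- The axiom `j⁎-∔` with u = 𝟎 and v = x/2: on dyadic numbers `j⁎` is x ↦ (1 + x)/2.
  j⁎-D : ∀ x → j⁎ (D x) ≈ D (half𝔻 x ⊕ 1 /2^ 1)
  j⁎-D x = Eq.trans (j⁎-cong (Eq.sym (Eq.trans (∔-identityʳ _) (double-D x))))
    (Eq.trans (j⁎-∔ _ _) (Eq.trans (∔-cong Eq.refl (Eq.sym D1≈j⁎𝟎)) (Eq.sym (D-⊕ (half𝔻 x) (1 /2^ 1)))))

  fold≈· : ∀ {u v} → u ≈ v → ∀ k → fold 𝟎 (u ∔_) k ≈ k · v
  fold≈· e zero    = Eq.refl
  fold≈· e (ℕ.suc k) = ∔-cong e (fold≈· e k)

  -- `dyadic` reduces the fraction and `D` does not; each cancelled factor 2 is restored by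
  -- `double-refine`. The bound on k excludes numerators above 1 at exponent 0, which `dyadic` would
  -- truncate to 𝟏.
  dyadic≈D : ∀ k m → k ℕ.≤ 2 ^ m → dyadic k m ≈ D (k /2^ m)
  dyadic≈D zero          zero    h = Eq.refl
  dyadic≈D (ℕ.suc zero)    zero    h = Eq.sym (δ≈D 0)
  dyadic≈D (ℕ.suc (ℕ.suc k)) zero    (ℕ.s≤s ())
  dyadic≈D k             (ℕ.suc m) h = by (2 ∣? k)
    where
    by : (d : Dec (2 ∣ k)) → (if does d then dyadic ⌊ k /2⌋ m else fold 𝟎 (halves m ∔_) k) ≈ D (k /2^ ℕ.suc m)
    by (no _) = fold≈· (Eq.sym (δ≈halves m)) k
    by (yes (divides q refl)) = Eq.trans (dyadic≈D ⌊ q ℕ.* 2 /2⌋ m (subst (ℕ._≤ 2 ^ m) q≡ q≤))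
        (Eq.trans (Eq.sym (double-refine ⌊ q ℕ.* 2 /2⌋ m)) (·-congˡ {δ (ℕ.suc m)} (cong (ℕ._* 2) (sym q≡))))
      where
      q≡ : q ≡ ⌊ q ℕ.* 2 /2⌋
      q≡ = trans (ℕ.n≡⌊n+n/2⌋ q) (cong ⌊_/2⌋ (trans (cong (q ℕ.+_) (sym (ℕ.+-identityʳ q))) (ℕ.*-comm 2 q)))
      q≤ : q ℕ.≤ 2 ^ m
      q≤ = ℕ.*-cancelʳ-≤ q (2 ^ m) 2 (ℕ.≤-trans h (ℕ.≤-reflexive (ℕ.*-comm 2 (2 ^ m))))

-- The quotient by ≃ as an archimedean model

module _ {c ℓ} {S : Structure c ℓ} (isModel : IsModel S) where
  open Structure S
  open IsModel isModel
  open ModelProperties isModel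
  open Equivalence

  -- The two structures share their operations, but `dyadic` is stuck on a variable exponent, so the
  -- two terms agree only by induction.
  dyadic-/≃ : ∀ k m → Structure.dyadic (S /≃) k m ≡ dyadic k m
  dyadic-/≃ k zero    = refl
  dyadic-/≃ k (ℕ.suc m) = cong (if does (2 ∣? k) then_else fold 𝟎 (halves m ∔_) k) (dyadic-/≃ ⌊ k /2⌋ m)

  meet-cong : ∀ n {t t′} → (∀ k → t k ≡ t′ k) → meet n t ≡ meet n t′
  meet-cong zero    e = refl
  meet-cong (ℕ.suc n) e = cong₂ _∧_ (e 1) (meet-cong n λ k → e (ℕ.suc k))

  ≤⇒≲ : ∀ {u v} → u ≤ v → u ≲ v
  ≤⇒≲ h n = ≤-trans h ≤-∔ʳ

  ≈⇒≃ : ∀ {u v} → u ≈ v → u ≃ v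
  ≈⇒≃ e = ≤⇒≲ (≤-reflexive e) , ≤⇒≲ (≥-reflexive e)

  -- Two errors 2⁻⁽ⁿ⁺¹⁾ add up to one error 2⁻ⁿ. Transitivity of `_≲_` and the archimedean property
  -- of the quotient both come from this.
  ≲-archimedean : ∀ {u v} → (∀ n → u ≲ v ∔ δ n) → u ≲ v
  ≲-archimedean h n = ≤-trans (h (ℕ.suc n) (ℕ.suc n)) (≤-trans ∔-assoc≤ (∔-monoʳ (δ-∔-≤ n)))

  ≲-trans : ∀ {u v w} → u ≲ v → v ≲ w → u ≲ w
  ≲-trans h k = ≲-archimedean λ n m → ≤-trans (h n) (≤-trans (∔-monoˡ (k m)) ∔-swapʳ)

  ≲-isPartialOrder : IsPartialOrder _≃_ _≲_
  ≲-isPartialOrder = record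
    { isPreorder = record
      { isEquivalence = record
        { refl  = ≈⇒≃ Eq.refl
        ; sym   = λ (h , k) → k , h
        ; trans = λ (h , h′) (k , k′) → ≲-trans h k , ≲-trans k′ h′
        }
      ; reflexive = proj₁
      ; trans     = ≲-trans
      }
    ; antisym = _,_
    }

  ∔-mono-≲ : ∀ {u u′ v v′} → u ≲ u′ → v ≲ v′ → u ∔ v ≲ u′ ∔ v′
  ∔-mono-≲ h k n = ≤-trans (∔-mono (h (ℕ.suc n)) (k (ℕ.suc n))) (≤-trans ∔-assoc≤ (≤-trans
    (∔-monoʳ (≤-trans ∔-assoc≥ (≤-trans (∔-monoˡ ∔-swap) (≤-trans ∔-assoc≤ (∔-monoʳ (δ-∔-≤ n)))))) ∔-assoc≥))

  -- The axioms that are plain inequalities are inherited; the work lies in monotonicity for `_≲_`.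
  -- Each unary operation at most doubles an error: `halve` and `j⁎` use the hypothesis at n, while
  -- `double`, `j` and `α` use it at `suc n`.
  /≃-isModel : IsModel (S /≃)
  /≃-isModel = record
    { isBoundedLattice = record
      { isLattice = record
        { isPartialOrder = ≲-isPartialOrder
        ; supremum = λ u v → ≤⇒≲ (x≤x∨y u v) , ≤⇒≲ (y≤x∨y u v) , λ w h k n → ∨-least (h n) (k n)
        ; infimum  = λ u v → ≤⇒≲ (x∧y≤x u v) , ≤⇒≲ (x∧y≤y u v) , λ w h k n → ∔-∧ (h n) (k n)
        }
      ; maximum = λ u → ≤⇒≲ (maximum u)
      ; minimum = λ u → ≤⇒≲ (minimum u)
      }
    ; ∔-isCommutativeMonoid = record
      { isMonoid = record
        { isSemigroup = record
          { isMagma = record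
            { isEquivalence = IsPartialOrder.isEquivalence ≲-isPartialOrder
            ; ∙-cong = λ (h , h′) (k , k′) → ∔-mono-≲ h k , ∔-mono-≲ h′ k′
            }
          ; assoc = λ u v w → ≈⇒≃ (∔-assoc u v w)
          }
        ; identity = (λ u → ≈⇒≃ (∔-identityˡ u)) , (λ u → ≈⇒≃ (∔-identityʳ u))
        }
      ; comm = λ u v → ≈⇒≃ (∔-comm u v)
      }
    ; ∸-residual = λ u v w → mk⇔
        (λ h n → to-∸ (≤-trans (h n) ∔-swapʳ))
        (λ h n → ≤-trans (from-∸ (h n)) ∔-swapʳ)
    ; double-mono = λ h n → ≤-trans (double-mono (h (ℕ.suc n)))
        (≤-trans (≤-reflexive (double-∔ _ _)) (∔-monoʳ (≤-reflexive (double-δ n))))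
    ; halve-mono = λ h n → halve⇐ (≤-trans (h n) (≤-trans
        (∔-mono (double-halve _) (double-infl _)) (≥-reflexive (double-∔ _ _))))
    ; j⁎-mono = λ h n → ≤-trans (j⁎-mono (≤-trans (h n) (≤-trans (∔-monoʳ (double-infl _)) ∔-swap)))
        (≤-trans (≤-reflexive (j⁎-∔ _ _)) ∔-swap)
    ; j-mono = λ h n → j⇐ (≤-trans (h (ℕ.suc n)) (≤-trans (∔-monoˡ (j⁎-j _)) (∔-δ-≤-j⁎ n)))
    ; α-mono = λ h n → α⇐
        (≤-trans (h (ℕ.suc n)) (≤-trans (∔-mono (α⇒double ≤-refl) (≤-trans (δ-mono n) (double-infl _)))
          (≥-reflexive (double-∔ _ _))))
        (≤-trans (h (ℕ.suc n)) (≤-trans (∔-monoˡ (α⇒j⁎ ≤-refl)) (∔-δ-≤-j⁎ n)))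
    ; halve-double = λ v → ≤⇒≲ (halve-double v)
    ; double-halve = λ v → ≤⇒≲ (double-halve v)
    ; j-j⁎         = λ v → ≤⇒≲ (j-j⁎ v)
    ; j⁎-j         = λ v → ≤⇒≲ (j⁎-j v)
    ; double-∔     = λ u v → ≈⇒≃ (double-∔ u v)
    ; j⁎-∔         = λ u v → ≈⇒≃ (j⁎-∔ u v)
    ; double-infl  = λ v → ≤⇒≲ (double-infl v)
    ; j⁎-infl      = λ v → ≤⇒≲ (j⁎-infl v)
    ; α-left       = λ v → ≈⇒≃ (α-left v)
    ; α-right      = λ v → ≈⇒≃ (α-right v)
    ; 𝟏≤double-j⁎𝟎 = ≤⇒≲ 𝟏≤double-j⁎𝟎
    ; double≤∔     = λ v → ≤⇒≲ (double≤∔ v)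
    ; α^-halves    = λ n → ≤⇒≲ (α^-halves n)
    ; α^-lower     = λ k m h n v → subst₂ (λ d e → v ≲ d ∔ α^ n (v ∔ e))
        (sym (dyadic-/≃ k m)) (sym (dyadic-/≃ (2 ^ m ℕ.∸ k) m)) (≤⇒≲ (α^-lower k m h n v))
    ; α^-upper     = λ n v → subst₂ _≲_
        (meet-cong (2 ^ ℕ.suc n ℕ.∸ 1) λ k → sym (cong₂ (λ d e → d ∔ α^ (ℕ.suc n) (v ∔ e))
          (dyadic-/≃ (2 ^ ℕ.suc n ℕ.∸ k) (ℕ.suc n)) (dyadic-/≃ k (ℕ.suc n))))
        (sym (cong (v ∔_) (dyadic-/≃ 1 n))) (≤⇒≲ (α^-upper n v))
    }
    where
    ∔-δ-≤-j⁎ : ∀ n {u} → j⁎ u ∔ δ (ℕ.suc n) ≤ j⁎ (u ∔ δ n)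
    ∔-δ-≤-j⁎ n = ≤-trans ∔-swap (≤-trans (≥-reflexive (j⁎-∔ _ _))
      (j⁎-mono (≤-trans ∔-swap (∔-monoʳ (≤-reflexive (double-δ n))))))

Archimedean : ∀ {c ℓ} → Structure c ℓ → Set (c ⊔ ℓ)
Archimedean S = ∀ u v → u ≲ v → u ≤ v
  where open Structure S

/≃-archimedean : ∀ {c ℓ} {S : Structure c ℓ} → IsModel S → Archimedean (S /≃)
/≃-archimedean {S = S} isModel u v h = ≲-archimedean isModel λ n →
  subst (λ d → u ≲ v ∔ d) (dyadic-/≃ isModel 1 n) (h n)
  where open Structure S

-- The MacNeille completion

Complete : ∀ {c ℓ} → Structure c ℓ → Set (suc c ⊔ ℓ)
Complete {c} S = ∀ (P : Carrier → Set c) → ∃ (IsInfimum _≤_ P)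
  where open Structure S

-- An infimum for `_≤_` stays one for `_≲_`: if y lies below P up to 2⁻ⁿ, then y ∸ 2⁻ⁿ is an exact
-- lower bound of P.
/≃-complete : ∀ {c ℓ} {S : Structure c ℓ} → IsModel S → Complete S → Complete (S /≃)
/≃-complete isModel complete P = let w , isLower , isGreatest = complete P in
  w , (λ x Px → ≤⇒≲ isModel (isLower x Px))
    , (λ y h n → from-∸ (isGreatest _ λ x Px → to-∸ (h x Px n)))
  where open ModelProperties isModel

module CompletionProperties {ℓ} (A : Model ℓ) where
  private
    module A = Model A
    module P = ModelProperties A.isModel
  open P using (≤-refl; ≤-trans)
  open Completion A hiding (structure; lower)
  open Structure (Completion.structure A) hiding (Carrier; _≤_; _≈_; _≃_; _≲_)
  open Equivalence

  infix 4 _≅_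
  -- _≋_ unfolds, which would prevent the inference of its arguments.
  record _≅_ (u v : Cut) : Set ℓ where
    constructor ⟪_⟫
    field un : u ≋ v
  open _≅_

  ≅-isEquivalence : IsEquivalence _≅_
  ≅-isEquivalence = record
    { refl  = ⟪ (λ _ z → z) , (λ _ z → z) ⟫
    ; sym   = λ (⟪ h , k ⟫) → ⟪ k , h ⟫
    ; trans = λ (⟪ h , k ⟫) (⟪ h′ , k′ ⟫) → ⟪ (λ x z → h′ x (h x z)) , (λ x z → k x (k′ x z)) ⟫
    }

  cut-setoid : Setoid _ _
  cut-setoid = record { isEquivalence = ≅-isEquivalence }
  open IsEquivalence ≅-isEquivalence renaming (refl to ≅-refl; sym to ≅-sym; trans to ≅-trans)
  open SetoidReasoning cut-setoid

  ⋀φ-mono : {I : Set ℓ} {a b : I → A.Carrier} → (∀ i → a i A.≤ b i) → ⋀φ a ⊑ ⋀φ b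
  ⋀φ-mono h _ l i = ≤-trans (l i) (h i)

  ⋀φ-cong : {I : Set ℓ} {a b : I → A.Carrier} → (∀ i → a i A.≈ b i) → ⋀φ a ≅ ⋀φ b
  ⋀φ-cong e = ⟪ ⋀φ-mono (λ i → P.≤-reflexive (e i)) , ⋀φ-mono (λ i → P.≥-reflexive (e i)) ⟫

  φ-mono : ∀ {a b} → a A.≤ b → φ a ⊑ φ b
  φ-mono = from (φ-order _ _)

  inf : ∀ u → ⋀φ {I = Upper u} proj₁ ≅ u
  inf u = ≅-sym ⟪ proj₁ (dense u) ⟫

  ⊑-upper : ∀ {u v} → u ⊑ v → ∀ {y} → upper v y → upper u y
  ⊑-upper {u} {v} h = ⊑⇒upper {u} {v} h

  ∔-mono : ∀ {u u′ v v′} → u ⊑ u′ → v ⊑ v′ → (u ∔ v) ⊑ (u′ ∔ v′)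
  ∔-mono {u} {u′} {v} {v′} h k x l ((a , ua) , (b , vb)) =
    l ((a , ⊑-upper {u} {u′} h ua) , (b , ⊑-upper {v} {v′} k vb))

  ∔-cong : ∀ {u u′ v v′} → u ≅ u′ → v ≅ v′ → (u ∔ v) ≅ (u′ ∔ v′)
  ∔-cong {u} {u′} {v} {v′} ⟪ h , h′ ⟫ ⟪ k , k′ ⟫ =
    ⟪ ∔-mono {u} {u′} {v} {v′} h k , ∔-mono {u′} {u} {v′} {v} h′ k′ ⟫

  ∔-comm : ∀ u v → (u ∔ v) ≅ (v ∔ u)
  ∔-comm u v = ⟪ (λ x l (b , a) → swap-∔ (l (a , b))) , (λ x l (a , b) → swap-∔ (l (b , a))) ⟫

  ∔-φ : {I : Set ℓ} (a : I → A.Carrier) (b : A.Carrier) → (⋀φ a ∔ φ b) ≅ ⋀φ λ i → a i A.∔ b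
  ∔-φ a b = ⟪ (λ x l i → l ((a i , λ _ k → k i) , (b , ≤-refl)))
          , (λ x l ((c , ac) , (d , b≤d)) → ≤-trans (from-∸ (ac _ λ i → to-∸ (l i))) (P.∔-monoʳ b≤d)) ⟫

  ∔-upper : ∀ u v {a b} → upper u a → upper v b → upper (u ∔ v) (a A.∔ b)
  ∔-upper u v ua vb _ l = l ((_ , ua) , (_ , vb))

  -- An upper bound e of an inner sum need not itself be a sum of upper bounds. Residuation moves
  -- the other summand to the left of the inequality, and then it suffices to test against such
  -- sums.
  ∔-assoc : ∀ u v w → (u ∔ v ∔ w) ≅ (u ∔ (v ∔ w))
  ∔-assoc u v w = ⟪
      (λ x l ((a , ua) , (e , vwe)) → swap-∔ (from-∸ (vwe _ λ ((b , vb) , (c , wc)) →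
        to-∸ (≤-trans (l ((_ , ∔-upper u v ua vb) , (c , wc))) (≤-trans P.∔-assoc≤ P.∔-swap)))))
    , (λ x l ((d , uvd) , (c , wc)) → from-∸ (uvd _ λ ((a , ua) , (b , vb)) →
        to-∸ (≤-trans (l ((a , ua) , (_ , ∔-upper v w vb wc))) P.∔-assoc≥))) ⟫

  ∔-identityʳ : ∀ u → (u ∔ 𝟎) ≅ u
  ∔-identityʳ u = ⟪
      (λ x l → lower-max u λ a ua → ≤-trans (l ((a , ua) , (A.𝟎 , λ (_ , h) → h _))) (P.≤-reflexive (P.∔-identityʳ a)))
    , (λ x ux ((a , ua) , _) → ≤-trans (lower≤upper u ux ua) P.≤-∔ʳ) ⟫

  double-mono : ∀ {u v} → u ⊑ v → double u ⊑ double v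
  double-mono {u} {v} h x l (a , va) = l (a , ⊑-upper {u} {v} h va)

  j⁎-mono : ∀ {u v} → u ⊑ v → j⁎ u ⊑ j⁎ v
  j⁎-mono {u} {v} h x l (a , va) = l (a , ⊑-upper {u} {v} h va)

  α-mono : ∀ {u v} → u ⊑ v → α u ⊑ α v
  α-mono {u} {v} h x l (a , va) = l (a , ⊑-upper {u} {v} h va)

  halve-mono : ∀ {u v} → u ⊑ v → halve u ⊑ halve v
  halve-mono h x l y k = l y λ (a , ua) → k (a , h a ua)

  j-mono : ∀ {u v} → u ⊑ v → j u ⊑ j v
  j-mono h x l y k = l y λ (a , ua) → k (a , h a ua)

  j⁎-cong : ∀ {u v} → u ≅ v → j⁎ u ≅ j⁎ v
  j⁎-cong {u} {v} ⟪ h , k ⟫ = ⟪ j⁎-mono {u} {v} h , j⁎-mono {v} {u} k ⟫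

  α-cong : ∀ {u v} → u ≅ v → α u ≅ α v
  α-cong {u} {v} ⟪ h , k ⟫ = ⟪ α-mono {u} {v} h , α-mono {v} {u} k ⟫

  halve-cong : ∀ {u v} → u ≅ v → halve u ≅ halve v
  halve-cong {u} {v} ⟪ h , k ⟫ = ⟪ halve-mono {u} {v} h , halve-mono {v} {u} k ⟫

  ∧-⋀ : {I : Set ℓ} (a b : I → A.Carrier) → (⋀φ a ∧ ⋀φ b) ≅ ⋀φ λ i → a i A.∧ b i
  ∧-⋀ a b = ⟪
      (λ x l i → let h , k = to (∧-meet (⋀φ a) (⋀φ b) (⋀φ a ∧ ⋀φ b)) (λ _ z → z) in
        P.∧-greatest (h x l i) (k x l i))
    , from (∧-meet (⋀φ a) (⋀φ b) (⋀φ λ i → a i A.∧ b i))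
        ((λ x l i → ≤-trans (l i) (P.x∧y≤x _ _)) , (λ x l i → ≤-trans (l i) (P.x∧y≤y _ _))) ⟫

  ∧-cong : ∀ {u u′ v v′} → u ≅ u′ → v ≅ v′ → (u ∧ v) ≅ (u′ ∧ v′)
  ∧-cong ⟪ h , h′ ⟫ ⟪ k , k′ ⟫ = ⟪
      (λ x l y m → l y λ (z , uz , vz) → m (z , h z uz , k z vz))
    , (λ x l y m → l y λ (z , uz , vz) → m (z , h′ z uz , k′ z vz)) ⟫

  -- Both sides are infima of the corresponding terms over upper bounds, so the axiom of A applies
  -- index by index. `j⁎-∔`, `α-left` and `α-right` follow the same scheme.
  double-∔ : ∀ u v → double (u ∔ v) ≅ (double u ∔ double v)
  double-∔ u v = begin
    double (u ∔ v)                                                            ≈⟨ ⟪ double-⋀ _ ⟫ ⟩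
    ⋀φ {I = Upper u × Upper v} (λ ((a , _) , (b , _)) → A.double (a A.∔ b))   ≈⟨ ⋀φ-cong (λ _ → A.double-∔ _ _) ⟩
    ⋀φ {I = Upper u × Upper v} (λ ((a , _) , (b , _)) → A.double a A.∔ A.double b) ≈⟨ ⟪ ∔-⋀ _ _ ⟫ ⟨
    double u ∔ double v                                                       ∎

  j⁎-∔ : ∀ u v → j⁎ (double v ∔ u) ≅ (v ∔ j⁎ u)
  j⁎-∔ u v = begin
    j⁎ (double v ∔ u)
      ≈⟨ j⁎-cong {double v ∔ u} {double v ∔ ⋀φ {I = Upper u} proj₁} (∔-cong {double v} ≅-refl (≅-sym (inf u))) ⟩
    j⁎ (double v ∔ ⋀φ {I = Upper u} proj₁)
      ≈⟨ j⁎-cong {double v ∔ ⋀φ {I = Upper u} proj₁} {⋀φ {I = Upper v × Upper u} λ ((a , _) , (b , _)) → A.double a A.∔ b} ⟪ ∔-⋀ _ _ ⟫ ⟩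
    j⁎ (⋀φ {I = Upper v × Upper u} λ ((a , _) , (b , _)) → A.double a A.∔ b)
      ≈⟨ ⟪ j⁎-⋀ _ ⟫ ⟩
    ⋀φ {I = Upper v × Upper u} (λ ((a , _) , (b , _)) → A.j⁎ (A.double a A.∔ b))
      ≈⟨ ⋀φ-cong (λ _ → A.j⁎-∔ _ _) ⟩
    ⋀φ {I = Upper v × Upper u} (λ ((a , _) , (b , _)) → a A.∔ A.j⁎ b)
      ≈⟨ ⟪ ∔-⋀ _ _ ⟫ ⟨
    ⋀φ {I = Upper v} proj₁ ∔ j⁎ u
      ≈⟨ ∔-cong {v = j⁎ u} (inf v) ≅-refl ⟩
    v ∔ j⁎ u ∎

  α-left : ∀ v → α (double v ∧ j⁎ v) ≅ v
  α-left v = begin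
    α (double v ∧ j⁎ v) ≈⟨ α-cong (∧-⋀ _ _) ⟩
    α (⋀φ {I = Upper v} λ (a , _) → A.double a A.∧ A.j⁎ a) ≈⟨ ⟪ α-⋀ _ ⟫ ⟩
    ⋀φ {I = Upper v} (λ (a , _) → A.α (A.double a A.∧ A.j⁎ a)) ≈⟨ ⋀φ-cong (λ _ → A.α-left _) ⟩
    ⋀φ {I = Upper v} proj₁ ≈⟨ inf v ⟩
    v ∎

  α-right : ∀ v → (double (α v) ∧ j⁎ (α v)) ≅ v
  α-right v = begin
    double (α v) ∧ j⁎ (α v) ≈⟨ ∧-cong {double (α v)} {⋀φ {I = Upper v} λ (a , _) → A.double (A.α a)}
                                {j⁎ (α v)} {⋀φ {I = Upper v} λ (a , _) → A.j⁎ (A.α a)} ⟪ double-⋀ _ ⟫ ⟪ j⁎-⋀ _ ⟫ ⟩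
    ⋀φ {I = Upper v} (λ (a , _) → A.double (A.α a)) ∧ ⋀φ {I = Upper v} (λ (a , _) → A.j⁎ (A.α a)) ≈⟨ ∧-⋀ _ _ ⟩
    ⋀φ {I = Upper v} (λ (a , _) → A.double (A.α a) A.∧ A.j⁎ (A.α a)) ≈⟨ ⋀φ-cong (λ _ → A.α-right _) ⟩
    ⋀φ {I = Upper v} proj₁ ≈⟨ inf v ⟩
    v ∎

  φ-isHomomorphic : IsHomomorphic A.structure (Completion.structure A) φ
  φ-isHomomorphic = record
    { ∨-homo = λ a b →
        (λ x l (y , h , k) → ≤-trans l (P.∨-least h k)) ,
        (λ x l → l (_ , P.x≤x∨y a b , P.y≤x∨y a b))
    ; ∧-homo = λ a b →
        (λ x l y m → ≤-trans l (m (_ , P.x∧y≤x a b , P.x∧y≤y a b))) ,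
        (λ x l → l _ λ (_ , h , k) → P.∧-greatest h k)
    ; ∔-homo = λ a b →
        (λ x l ((_ , h) , (_ , k)) → ≤-trans l (P.∔-mono h k)) ,
        (λ x l → l ((a , ≤-refl) , (b , ≤-refl)))
    ; ∸-homo = λ a b →
        (λ x l y m → ≤-trans l (m ((a , ≤-refl) , (b , ≤-refl)))) ,
        (λ x l → l _ λ ((_ , h) , (_ , k)) → to-∸ (≤-trans h (≤-trans (from-∸ ≤-refl) (P.∔-monoʳ k))))
    ; halve-homo  = λ a → (λ x l y m → ≤-trans l (m (a , ≤-refl))) , (λ x l → l _ λ (_ , h) → A.halve-mono h)
    ; double-homo = λ a → (λ x l (_ , h) → ≤-trans l (A.double-mono h)) , (λ x l → l (a , ≤-refl))
    ; j⁎-homo     = λ a → (λ x l (_ , h) → ≤-trans l (A.j⁎-mono h)) , (λ x l → l (a , ≤-refl))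
    ; j-homo      = λ a → (λ x l y m → ≤-trans l (m (a , ≤-refl))) , (λ x l → l _ λ (_ , h) → A.j-mono h)
    ; α-homo      = λ a → (λ x l (_ , h) → ≤-trans l (A.α-mono h)) , (λ x l → l (a , ≤-refl))
    ; 𝟎-homo      = (λ x l y m → ≤-trans l (m (A.𝟎 , P.minimum))) , (λ x l → l _ λ (_ , h) → h _)
    ; 𝟏-homo      = (λ x l (_ , h) → h x) , (λ x l → l (A.𝟏 , P.maximum))
    }
  open IsHomomorphic φ-isHomomorphic

  φ-halves : ∀ n → φ (P.halves n) ≅ fold (j⁎ 𝟎) halve n
  φ-halves zero    = ≅-trans ⟪ j⁎-homo A.𝟎 ⟫ (j⁎-cong {φ A.𝟎} {𝟎} ⟪ 𝟎-homo ⟫)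
  φ-halves (ℕ.suc n) = ≅-trans ⟪ halve-homo (P.halves n) ⟫ (halve-cong (φ-halves n))

  φ-multiple : ∀ {a u} → φ a ≅ u → ∀ k → φ (fold A.𝟎 (a A.∔_) k) ≅ fold 𝟎 (u ∔_) k
  φ-multiple e zero    = ⟪ 𝟎-homo ⟫
  φ-multiple {a} e (ℕ.suc k) = ≅-trans ⟪ ∔-homo a _ ⟫ (∔-cong e (φ-multiple e k))

  φ-dyadic : ∀ k m → φ (A.dyadic k m) ≅ dyadic k m
  φ-dyadic zero    zero    = ⟪ 𝟎-homo ⟫
  φ-dyadic (ℕ.suc k) zero    = ⟪ 𝟏-homo ⟫
  φ-dyadic k       (ℕ.suc m) = by (2 ∣? k)
    where
    by : (d : Dec (2 ∣ k)) →
         φ (if does d then A.dyadic ⌊ k /2⌋ m else fold A.𝟎 (P.halves m A.∔_) k) ≅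
         (if does d then dyadic ⌊ k /2⌋ m else fold 𝟎 (fold (j⁎ 𝟎) halve m ∔_) k)
    by (yes _) = φ-dyadic ⌊ k /2⌋ m
    by (no _)  = φ-multiple (φ-halves m) k

  φ-≲ : ∀ a b → a A.≲ b ⇔ Structure._≲_ (Completion.structure A) (φ a) (φ b)
  φ-≲ a b = mk⇔ (λ h n x l → proj₁ (un (e n)) x (φ-mono (h n) x l))
                (λ h n → to (φ-order _ _) λ x l → proj₂ (un (e n)) x (h n x l))
    where
    e : ∀ n → φ (b A.∔ A.dyadic 1 n) ≅ φ b ∔ dyadic 1 n
    e n = ≅-trans ⟪ ∔-homo b (A.dyadic 1 n) ⟫ (∔-cong {φ b} ≅-refl (φ-dyadic 1 n))

  φ-α^ : ∀ n a → φ (A.α^ n a) ≅ α^ n (φ a)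
  φ-α^ zero    a = ≅-refl
  φ-α^ (ℕ.suc n) a = ≅-trans ⟪ α-homo (A.α^ n a) ⟫ (α-cong (φ-α^ n a))

  α^-⋀ : ∀ n {I : Set ℓ} (a : I → A.Carrier) → α^ n (⋀φ a) ≅ ⋀φ λ i → A.α^ n (a i)
  α^-⋀ zero    a = ≅-refl
  α^-⋀ (ℕ.suc n) a = ≅-trans (α-cong (α^-⋀ n a)) ⟪ α-⋀ _ ⟫

  α^-cong : ∀ n {u v} → u ≅ v → α^ n u ≅ α^ n v
  α^-cong zero    e = e
  α^-cong (ℕ.suc n) e = α-cong (α^-cong n e)

  ∔-dyadic : ∀ v k m → (v ∔ dyadic k m) ≅ ⋀φ {I = Upper v} λ (a , _) → a A.∔ A.dyadic k m
  ∔-dyadic v k m = ≅-trans (∔-cong (≅-sym (inf v)) (≅-sym (φ-dyadic k m))) (∔-φ _ _)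

  -- Dyadic elements are principal cuts, so the whole term is an infimum over `Upper v` alone. The
  -- two axiom schemes with `α^` can thus be checked for one upper bound of v at a time.
  dyadic-α^ : ∀ v k l m n → (dyadic k m ∔ α^ n (v ∔ dyadic l m)) ≅
              ⋀φ {I = Upper v} λ (a , _) → A.dyadic k m A.∔ A.α^ n (a A.∔ A.dyadic l m)
  dyadic-α^ v k l m n = begin
    dyadic k m ∔ α^ n (v ∔ dyadic l m)
      ≈⟨ ∔-comm (dyadic k m) (α^ n (v ∔ dyadic l m)) ⟩
    α^ n (v ∔ dyadic l m) ∔ dyadic k m
      ≈⟨ ∔-cong
           (≅-trans (α^-cong n (∔-dyadic v l m)) (α^-⋀ n _)) (≅-sym (φ-dyadic k m)) ⟩
    ⋀φ {I = Upper v} (λ (a , _) → A.α^ n (a A.∔ A.dyadic l m)) ∔ φ (A.dyadic k m)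
      ≈⟨ ∔-φ _ _ ⟩
    ⋀φ {I = Upper v} (λ (a , _) → A.α^ n (a A.∔ A.dyadic l m) A.∔ A.dyadic k m)
      ≈⟨ ⋀φ-cong (λ _ → P.∔-comm _ _) ⟩
    ⋀φ {I = Upper v} (λ (a , _) → A.dyadic k m A.∔ A.α^ n (a A.∔ A.dyadic l m)) ∎

  -- In `α^-upper` the meet stands on the left, so an estimate from above suffices.
  meet-⊑-φ : ∀ n {t : ℕ → Cut} {s : ℕ → A.Carrier} → (∀ k → t k ⊑ φ (s k)) → meet n t ⊑ φ (A.meet n s)
  meet-⊑-φ zero    h x l = P.maximum x
  meet-⊑-φ (ℕ.suc n) {t} {s} h x l = l _ λ (z , tz , mz) →
    P.∧-greatest (h 1 z tz) (meet-⊑-φ n {λ k → t (ℕ.suc k)} {λ k → s (ℕ.suc k)} (λ k → h (ℕ.suc k)) z mz)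

  Ā-isModel : IsModel (Completion.structure A)
  Ā-isModel = record
    { isBoundedLattice = record
      { isLattice = record
        { isPartialOrder = record
          { isPreorder = record
            { isEquivalence = ≋-isEquivalence
            ; reflexive     = proj₁
            ; trans         = λ h k x z → k x (h x z)
            }
          ; antisym = _,_
          }
        ; supremum = λ u v → let h , k = to (∨-join u v (u ∨ v)) (λ _ z → z) in
            h , k , λ w p q → from (∨-join u v w) (p , q)
        ; infimum  = λ u v → let h , k = to (∧-meet u v (u ∧ v)) (λ _ z → z) in
            h , k , λ w p q → from (∧-meet u v w) (p , q)
        }
      ; maximum = 𝟏-greatest
      ; minimum = 𝟎-least
      }
    ; ∔-isCommutativeMonoid = record
      { isMonoid = record
        { isSemigroup = record
          { isMagma = record
            { isEquivalence = ≋-isEquivalence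
            ; ∙-cong        = λ {u} {u′} {v} {v′} e f → un (∔-cong {u} {u′} {v} {v′} ⟪ e ⟫ ⟪ f ⟫)
            }
          ; assoc = λ u v w → un (∔-assoc u v w)
          }
        ; identity = (λ u → un (≅-trans (∔-comm 𝟎 u) (∔-identityʳ u))) , λ u → un (∔-identityʳ u)
        }
      ; comm = λ u v → un (∔-comm u v)
      }
    ; ∸-residual = λ u v w → mk⇔
        (λ h x l → lower-max u λ y uy → l y λ ((a , wa) , (b , vb)) → to-∸ (h a wa ((y , uy) , (b , vb))))
        (λ h x wx ((y , uy) , (b , vb)) → from-∸ (lower≤upper u (h _ λ z k → k ((x , wx) , (b , vb))) uy))
    ; double-mono  = λ {u} {v} → double-mono {u} {v}
    ; halve-mono   = λ {u} {v} → halve-mono {u} {v}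
    ; j⁎-mono      = λ {u} {v} → j⁎-mono {u} {v}
    ; j-mono       = λ {u} {v} → j-mono {u} {v}
    ; α-mono       = λ {u} {v} → α-mono {u} {v}
    ; halve-double = λ v → from (halve-adjoint (double v) v) (λ _ z → z)
    ; double-halve = λ v → to (halve-adjoint v (halve v)) (λ _ z → z)
    ; j-j⁎         = λ v → from (j-adjoint (j⁎ v) v) (λ _ z → z)
    ; j⁎-j         = λ v → to (j-adjoint v (j v)) (λ _ z → z)
    ; double-∔     = λ u v → un (double-∔ u v)
    ; j⁎-∔         = λ u v → un (j⁎-∔ u v)
    ; double-infl  = λ v x vx (a , va) → ≤-trans (lower≤upper v vx va) (A.double-infl a)
    ; j⁎-infl      = λ v x vx (a , va) → ≤-trans (lower≤upper v vx va) (A.j⁎-infl a)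
    ; α-left       = λ v → un (α-left v)
    ; α-right      = λ v → un (α-right v)
    ; 𝟏≤double-j⁎𝟎 = λ x _ (a , h) → ≤-trans (P.maximum x) (≤-trans A.𝟏≤double-j⁎𝟎
        (A.double-mono (h _ λ (b , k) → A.j⁎-mono (k (_ , P.minimum)))))
    -- `v ∔ v` ranges over pairs of upper bounds a, b, but `double v` over single ones; a ∧ b is an
    -- upper bound of v below both.
    ; double≤∔     = λ v x l ((a , va) , (b , vb)) →
        ≤-trans (l (a A.∧ b , upper-max v λ y vy → P.∧-greatest (lower≤upper v vy va) (lower≤upper v vy vb)))
          (≤-trans (A.double≤∔ _) (P.∔-mono (P.x∧y≤x a b) (P.x∧y≤y a b)))
    ; α^-halves    = λ n →
        let a = A.α^ (ℕ.suc n) (A.j⁎ A.𝟎)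
            u = α^ (ℕ.suc n) (j⁎ 𝟎)
        in proj₂ (un {φ (a A.∔ a)} {u ∔ u} (≅-trans ⟪ ∔-homo a a ⟫ (∔-cong (φ-α^j⁎𝟎 (ℕ.suc n)) (φ-α^j⁎𝟎 (ℕ.suc n)))))
        ⨾ φ-mono (A.α^-halves n) ⨾ proj₁ (un (φ-α^j⁎𝟎 n))
    ; α^-lower     = λ k m h n v → (λ x vx (a , va) → ≤-trans (lower≤upper v vx va) (A.α^-lower k m h n a))
        ⨾ proj₂ (un (dyadic-α^ v k (2 ^ m ℕ.∸ k) m n))
    ; α^-upper     = λ n v → (λ x l (a , va) → ≤-trans
          (meet-⊑-φ (2 ^ ℕ.suc n ℕ.∸ 1) {λ k → dyadic (2 ^ ℕ.suc n ℕ.∸ k) (ℕ.suc n) ∔ α^ (ℕ.suc n) (v ∔ dyadic k (ℕ.suc n))}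
            {λ k → A.dyadic (2 ^ ℕ.suc n ℕ.∸ k) (ℕ.suc n) A.∔ A.α^ (ℕ.suc n) (a A.∔ A.dyadic k (ℕ.suc n))} 
            (λ k x l → proj₁ (un (dyadic-α^ v (2 ^ ℕ.suc n ℕ.∸ k) k (ℕ.suc n) (ℕ.suc n))) x l (a , va)) x l)
          (A.α^-upper n a))
        ⨾ proj₂ (un (∔-dyadic v 1 n))
    }
    where
    ≋-isEquivalence : IsEquivalence _≋_
    ≋-isEquivalence = record
      { refl  = λ {u} → un (≅-refl {u})
      ; sym   = λ {u} {v} e → un (≅-sym {u} {v} ⟪ e ⟫)
      ; trans = λ {u} {v} {w} e f → un (≅-trans {u} {v} {w} ⟪ e ⟫ ⟪ f ⟫)
      }
    infixr 4 _⨾_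
    _⨾_ : ∀ {p q r} {F : A.Carrier → Set p} {G : A.Carrier → Set q} {H : A.Carrier → Set r} →
          (∀ x → F x → G x) → (∀ x → G x → H x) → ∀ x → F x → H x
    (h ⨾ k) x z = k x (h x z)
    φ-α^j⁎𝟎 : ∀ n → φ (A.α^ n (A.j⁎ A.𝟎)) ≅ α^ n (j⁎ 𝟎)
    φ-α^j⁎𝟎 n = ≅-trans (φ-α^ n _) (α^-cong n (φ-halves 0))

  -- Excluded middle shrinks the family of all upper bounds to Set ℓ.
  Ā-complete : Classical → Complete (Completion.structure A)
  Ā-complete em P = ⋀φ {I = I} proj₁
    , (λ c Pc x l → lower-max c λ y cy → l (y , lift (fromWitness {a? = em} (c , Pc , cy))))
    , (λ w h x wx (y , lift b) → let c , Pc , cy = toWitness b in lower≤upper c (h c Pc x wx) cy)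
    where
    I : Set ℓ
    I = Σ[ y ∈ A.Carrier ] Lift ℓ (True (em {P = ∃ λ c → P c × upper c y}))

-- Adjunctions in USC(L)

-- For linear arithmetic: x ≤ y is certified by y − x = b − a.
shift-≤ : ∀ {a b x y} → a ℚ.≤ b → x ℚ.+ b ≡ y ℚ.+ a → x ℚ.≤ y
shift-≤ h e = ℚ.≮⇒≥ λ y<x → ℚ.<-irrefl (sym e) (ℚ.+-mono-<-≤ y<x h)

shift-< : ∀ {a b x y} → a ℚ.< b → x ℚ.+ b ≡ y ℚ.+ a → x ℚ.< y
shift-< h e = ℚ.≰⇒> λ y≤x → ℚ.<-irrefl (sym e) (ℚ.+-mono-≤-< y≤x h)

double-cancel-≤ : ∀ {r s} → r ℚ.+ r ℚ.≤ s ℚ.+ s → r ℚ.≤ s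
double-cancel-≤ h = ℚ.≮⇒≥ λ s<r → ℚ.<-irrefl refl (ℚ.<-≤-trans (ℚ.+-mono-< s<r s<r) h)

sum-max : ∀ x {s} → cut (x +ʳ x) s → ∃ λ m → cut x m × s ℚ.≤ m ℚ.+ m
sum-max x (a , b , xa , xb , h) = a ℚ.⊔ b , ⊔-cut x xa xb
  , ℚ.≤-trans h (ℚ.+-mono-≤ (ℚ.p≤p⊔q a b) (ℚ.p≤q⊔p a b))

stretch-elim : ∀ q {s} → cut (value (stretch q)) s → 0ℚ ℚ.≤ s → ∃ λ m → cut (value q) m × s ℚ.+ 1ℚ ℚ.< m ℚ.+ m
stretch-elim q {s} (inj₁ (t , c , u , c<-1 , k)) 0≤s with sum-max (value q) u
... | m , qm , h = m , qm , shift-< (ℚ.+-mono-≤-< (ℚ.+-mono-≤ h k) c<-1)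
      (solve 4 (λ s t c m → (s :+ con 1ℚ) :+ (m :+ m :+ (t :+ c) :+ con (- 1ℚ)) := m :+ m :+ (t :+ s :+ c)) refl s t c m)
stretch-elim q (inj₂ s<0) 0≤s = ⊥-elim (ℚ.<-irrefl refl (ℚ.<-≤-trans s<0 0≤s))

stretch-intro : ∀ q {s m} → cut (value q) m → s ℚ.+ 1ℚ ℚ.< m ℚ.+ m → cut (value (stretch q)) s
stretch-intro q {s} {m} qm h = inj₁ (m ℚ.+ m , s ℚ.+ - (m ℚ.+ m) , (m , m , qm , qm , ℚ.≤-refl)
  , shift-< h (solve 2 (λ s m → s :+ :- (m :+ m) :+ (m :+ m) := con (- 1ℚ) :+ (s :+ con 1ℚ)) refl s m)
  , ℚ.≤-reflexive (solve 2 (λ s m → s := m :+ m :+ (s :+ :- (m :+ m))) refl s m))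

upperHalf-intro : ∀ q {s m} → cut (value q) s → m ℚ.+ m ℚ.< 1ℚ ℚ.+ s → cut (value (upperHalf q)) m
upperHalf-intro q {s} {m} qs h = (m ℚ.+ m) ℚ.+ - s , s
  , shift-< h (solve 2 (λ s m → (m :+ m) :+ :- s :+ (con 1ℚ :+ s) := con 1ℚ :+ (m :+ m)) refl s m)
  , qs , ℚ.≤-reflexive (solve 2 (λ s m → m :+ m := (m :+ m) :+ :- s :+ s) refl s m)

half≤½ : ∀ q → value (half q) ≤ʳ ½ʳ
half≤½ q {s} h = double-cancel {s} {½} (≤1 q h)

twice-half : ∀ q (h : value (half q) ≤ʳ ½ʳ) → twice (half q) h ≤ⁱ q
twice-half q _ u with sum-max (value (half q)) u
... | m , qm , s≤ = downward (value q) s≤ qm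

half-twice : ∀ q (h : value q ≤ʳ ½ʳ) → q ≤ⁱ half (twice q h)
half-twice q _ {s} qs = s , s , qs , qs , ℚ.≤-refl

upperHalf-stretch : ∀ q → 0ʳ <ʳ value (stretch q) → upperHalf (stretch q) ≤ⁱ q
upperHalf-stretch q (z , qz , z≮0) {s} (a , b , a<1 , qb , h)
  with stretch-elim q (⊔-cut (value (stretch q)) qb qz) (ℚ.≤-trans (ℚ.≮⇒≥ z≮0) (ℚ.p≤q⊔p b z))
... | m , qm , k = downward (value q) (double-cancel-≤ (ℚ.≤-trans h (ℚ.≤-trans
        (ℚ.+-mono-≤ (ℚ.<⇒≤ a<1) (ℚ.p≤p⊔q b z)) (ℚ.≤-trans (ℚ.≤-reflexive (ℚ.+-comm 1ℚ (b ℚ.⊔ z))) (ℚ.<⇒≤ k))))) qm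

stretch-upperHalf : ∀ q → q ≤ⁱ stretch (upperHalf q)
-- Each of the two introduction rules consumes a strict inequality, hence the two enlargements s <
-- s₁ < s₂ within the cut.
stretch-upperHalf q {s} qs with rounded (value q) qs
... | s₁ , s<s₁ , qs₁ with rounded (value q) qs₁
...   | s₂ , s₁<s₂ , qs₂ = stretch-intro (upperHalf q) {m = halfℚ (1ℚ ℚ.+ s₁)}
        (upperHalf-intro q {m = halfℚ (1ℚ ℚ.+ s₁)} qs₂ (subst (ℚ._< 1ℚ ℚ.+ s₂) (sym (halfℚ+halfℚ _)) (ℚ.+-monoʳ-< 1ℚ s₁<s₂)))
        (subst (s ℚ.+ 1ℚ ℚ.<_) (trans (ℚ.+-comm s₁ 1ℚ) (sym (halfℚ+halfℚ _))) (ℚ.+-monoˡ-< 1ℚ s<s₁))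

bend-half : ∀ q → bend (half q) ≤ⁱ q
bend-half q (u , _) with sum-max (value (half q)) u
... | m , qm , s≤ = downward (value q) s≤ qm

bend-stretch : ∀ q → bend (stretch q) ≤ⁱ q
bend-stretch q {s} (u , (a , b , a<1 , qb , h)) with sum-max (value (stretch q)) u
... | m , qm , s≤ with split (m ℚ.⊔ b) 0ℚ
...   | inj₁ M<0 = 0≤ q (ℚ.≤-<-trans s≤ (ℚ.+-mono-< m<0 m<0))
  where m<0 = ℚ.≤-<-trans (ℚ.p≤p⊔q m b) M<0
...   | inj₂ 0≤M with stretch-elim q (⊔-cut (value (stretch q)) qm qb) 0≤M
...     | x , qx , k = downward (value q) (double-cancel-≤ (ℚ.≤-trans h (ℚ.≤-trans
            (ℚ.+-mono-≤ (ℚ.<⇒≤ a<1) (ℚ.p≤q⊔p m b)) (ℚ.≤-trans (ℚ.≤-reflexive (ℚ.+-comm 1ℚ (m ℚ.⊔ b))) (ℚ.<⇒≤ k))))) qx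

-- bend q is 2q below ⅓ and (1+q)/2 above.
≤-bend : Classical → ∀ q → (q ≤ⁱ half (bend q)) ⊎ (q ≤ⁱ stretch (bend q))
≤-bend em q with em {P = ∃ λ s → cut (value q) s × 1ℚ ℚ.≤ s ℚ.+ s ℚ.+ s}
... | no none = inj₁ λ {s} qs → (s , s , qs , qs , ℚ.≤-refl)
      , (s ℚ.+ s ℚ.+ s , s , [ (λ h → h) , (λ h → ⊥-elim (none (s , qs , h))) ]′ (split (s ℚ.+ s ℚ.+ s) 1ℚ)
        , qs , ℚ.≤-reflexive (sym (ℚ.+-assoc (s ℚ.+ s) s s)))
... | yes (s₀ , qs₀ , h₀) = inj₂ λ {s} qs → above (⊔-cut (value q) qs qs₀) (ℚ.p≤p⊔q s s₀) (ℚ.p≤q⊔p s s₀)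
  where
  above : ∀ {s z} → cut (value q) z → s ℚ.≤ z → s₀ ℚ.≤ z → cut (value (stretch (bend q))) s
  above {s} {z} qz s≤z s₀≤z with rounded (value q) qz
  ... | z₁ , z<z₁ , qz₁ with rounded (value q) qz₁
  -- The witness is m = (1 + z₁)/2. From 1 ≤ 3z₁ it follows that m ≤ 2z₁, so m lies in both cuts
  -- whose intersection is `bend q`.
  ...   | z₂ , z₁<z₂ , qz₂ = stretch-intro (bend q) {m = m}
          ( (z₁ , z₁ , qz₁ , qz₁ , double-cancel-≤ (ℚ.≤-trans (ℚ.≤-reflexive m+m)
              (shift-≤ 1≤3z₁ (solve 1 (λ z → con 1ℚ :+ z :+ (z :+ z :+ z) := z :+ z :+ (z :+ z) :+ con 1ℚ) refl z₁))))
          , upperHalf-intro q {m = m} qz₂ (subst (ℚ._< 1ℚ ℚ.+ z₂) (sym m+m) (ℚ.+-monoʳ-< 1ℚ z₁<z₂)))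
          (subst (s ℚ.+ 1ℚ ℚ.<_) (trans (ℚ.+-comm z₁ 1ℚ) (sym m+m)) (ℚ.+-monoˡ-< 1ℚ (ℚ.≤-<-trans s≤z z<z₁)))
    where
    m = halfℚ (1ℚ ℚ.+ z₁)
    m+m = halfℚ+halfℚ (1ℚ ℚ.+ z₁)
    s₀≤z₁ = ℚ.≤-trans s₀≤z (ℚ.<⇒≤ z<z₁)
    1≤3z₁ = ℚ.≤-trans h₀ (ℚ.+-mono-≤ (ℚ.+-mono-≤ s₀≤z₁ s₀≤z₁) s₀≤z₁)

module USCProperties (em : Classical) {ℓ} (L : CommutativeResiduatedCompleteLattice (suc ℓ)) where
  open CommutativeResiduatedCompleteLattice L
  private module O = IsPartialOrder isPartialOrder
  open USC em L

  -- No p lies strictly below such a q, so left continuity bounds the value by the supremum of the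
  -- empty family.
  vanishes-at-0 : ∀ f q → ¬ (0ʳ <ʳ value q) → fun f q ≤ ⊥
  vanishes-at-0 f q 0≮q = leftCts f q ⊥ λ { p (s , qs , ¬ps) →
    ⊥-elim (0≮q (s , qs , λ s<0 → ℚ.<-irrefl refl (ℚ.<-≤-trans s<0 (∉⇒≥0 p ¬ps)))) }

  𝟎-least : ∀ f → 𝟎 ⊑ f
  𝟎-least f q with em {P = 0ʳ <ʳ value q}
  ... | yes _  = ⊤-greatest _
  ... | no 0≮q = vanishes-at-0 f q 0≮q

  𝟏-greatest : ∀ f → f ⊑ 𝟏
  𝟏-greatest f q = ⊥-least _

  halve-adjoint : ∀ f g → halve f ⊑ g ⇔ f ⊑ double g
  halve-adjoint f g = mk⇔ (λ h q → O.trans (h (half q)) (down q)) up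
    where
    down : ∀ q → fun (halve f) (half q) ≤ fun f q
    down q with em {P = value (half q) ≤ʳ ½ʳ}
    ... | yes h = mono f (twice-half q h)
    ... | no ¬h = ⊥-elim (¬h (half≤½ q))
    up : f ⊑ double g → halve f ⊑ g
    up h q with em {P = value q ≤ʳ ½ʳ}
    ... | yes q≤½ = O.trans (mono g (half-twice q q≤½)) (h (twice q q≤½))
    ... | no _    = ⊤-greatest _

  j-adjoint : ∀ f g → j f ⊑ g ⇔ f ⊑ j⁎ g
  j-adjoint f g = mk⇔ (λ h q → O.trans (h (stretch q)) (down q)) up
    where
    down : ∀ q → fun (j f) (stretch q) ≤ fun f q
    down q with em {P = 0ʳ <ʳ value (stretch q)}
    ... | yes 0< = mono f (upperHalf-stretch q 0<)
    ... | no _   = ⊥-least _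
    up : f ⊑ j⁎ g → j f ⊑ g
    up h q with em {P = 0ʳ <ʳ value q}
    ... | yes _  = O.trans (mono g {q} {stretch (upperHalf q)} (stretch-upperHalf q)) (h (upperHalf q))
    ... | no 0≮q = vanishes-at-0 g q 0≮q

  ⊑-double-α : ∀ f → f ⊑ double (α f)
  ⊑-double-α f q = mono f (bend-half q)

  ⊑-j⁎-α : ∀ f → f ⊑ j⁎ (α f)
  ⊑-j⁎-α f q = mono f (bend-stretch q)

  -- With the two preceding inequalities this characterises `α f` as the least g such that f ⊑ 2g
  -- and f ⊑ j⁎ g. A model has the same characterisation, which is how F is shown to preserve `α`.
  α-least : ∀ f g → f ⊑ double g → f ⊑ j⁎ g → α f ⊑ g
  α-least f g h k q with ≤-bend em q
  ... | inj₁ le = O.trans (mono g {q} {half (bend q)} le) (h (bend q))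
  ... | inj₂ le = O.trans (mono g {q} {stretch (bend q)} le) (k (bend q))

-- Crisp elements

half-unique : ∀ {a b} → a ℚ.+ a ≡ b ℚ.+ b → a ≡ b
half-unique e = ℚ.≤-antisym (double-cancel-≤ (ℚ.≤-reflexive e)) (double-cancel-≤ (ℚ.≤-reflexive (sym e)))

+-cancelˡ : ∀ a {b c} → a ℚ.+ b ≡ a ℚ.+ c → b ≡ c
+-cancelˡ a {b} {c} e = ℚ.≤-antisym
  (shift-≤ (ℚ.≤-reflexive e) (solve 3 (λ a b c → b :+ (a :+ c) := c :+ (a :+ b)) refl a b c))
  (shift-≤ (ℚ.≤-reflexive (sym e)) (solve 3 (λ a b c → c :+ (a :+ b) := b :+ (a :+ c)) refl a b c))

-- 1 − 2⁻ⁿ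
belowOne : ℕ → 𝔻
belowOne zero    = 0 /2^ 0
belowOne (ℕ.suc n) = half𝔻 (belowOne n) ⊕ 1 /2^ 1

val-belowOne : ∀ n → val (belowOne n) ℚ.+ unit n ≡ 1ℚ
val-belowOne zero    = refl
val-belowOne (ℕ.suc n) = trans (cong (ℚ._+ unit (ℕ.suc n)) (val-⊕ (half𝔻 (belowOne n)) (1 /2^ 1)))
  (trans (solve 3 (λ x h u → x :+ h :+ u := x :+ u :+ h) refl x ½ (unit (ℕ.suc n))) (cong (ℚ._+ ½) x+u))
  where
  x = val (half𝔻 (belowOne n))
  x+u : x ℚ.+ unit (ℕ.suc n) ≡ ½
  x+u = half-unique (trans (solve 2 (λ x u → x :+ u :+ (x :+ u) := x :+ x :+ (u :+ u)) refl x (unit (ℕ.suc n)))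
    (trans (cong₂ ℚ._+_ (val-half (belowOne n)) (unit-halves n)) (val-belowOne n)))

-- A numerator below 2ⁿ is at most 2ⁿ - 1. Every dyadic number below 1 is thus bounded by an iterate
-- of x ↦ (1 + x)/2 at 0, that is, by an iterate of `j⁎`.
≤belowOne : ∀ k n → val (k /2^ n) ℚ.< 1ℚ → val (k /2^ n) ℚ.≤ val (belowOne n)
≤belowOne k n h = shift-≤ (ℚ.≤-trans (val≤1 {m = n} (val<1⁻¹ k n h)) (ℚ.≤-reflexive (sym (val-belowOne n))))
  (solve 3 (λ k u b → k :+ (b :+ u) := b :+ (u :+ k)) refl (val (k /2^ n)) (unit n) (val (belowOne n)))

module Crisp {ℓ} {S : Structure (suc ℓ) ℓ} (isModel : IsModel S)
  (complete : Complete S) (archimedean : Archimedean S) where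
  open Structure S
  open IsModel isModel
  open ModelProperties isModel

  module _ {I : Set} (f : I → Carrier) where
    private
      family : Carrier → Set (suc ℓ)
      family u = ∃ λ i → u ≡ f i

    ⨅ : Carrier
    ⨅ = proj₁ (complete family)

    ⨅-lower : ∀ i → ⨅ ≤ f i
    ⨅-lower i = proj₁ (proj₂ (complete family)) (f i) (i , refl)

    ⨅-greatest : ∀ {w} → (∀ i → w ≤ f i) → w ≤ ⨅
    ⨅-greatest h = proj₂ (proj₂ (complete family)) _ λ { _ (i , refl) → h i }

    ∔-⨅ : ∀ {u w} → (∀ i → w ≤ u ∔ f i) → w ≤ u ∔ ⨅
    ∔-⨅ h = ≤-trans (from-∸ (⨅-greatest λ i → to-∸ (≤-trans (h i) ∔-swap))) ∔-swap

    -- The inverse w ↦ 2w ∧ j⁎ w is applied to the bound, compared with each `f i`, and undone by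
    -- `α`.
    α-⨅ : ∀ {w} → (∀ i → w ≤ α (f i)) → w ≤ α ⨅
    α-⨅ {w} h = ≤-trans (≥-reflexive (α-left w)) (α-mono (⨅-greatest λ i →
      ≤-trans (∧-greatest (≤-trans (x∧y≤x _ _) (double-mono (h i))) (≤-trans (x∧y≤y _ _) (j⁎-mono (h i))))
              (≤-reflexive (α-right (f i)))))

  Crisp : Carrier → Set ℓ
  Crisp c = double c ≤ c

  crisp-𝟎 : Crisp 𝟎
  crisp-𝟎 = ≤-reflexive double-𝟎

  crisp-𝟏 : Crisp 𝟏
  crisp-𝟏 = maximum _

  crisp-∔ : ∀ {c e} → Crisp c → Crisp e → Crisp (c ∔ e)
  crisp-∔ h k = ≤-trans (≤-reflexive (double-∔ _ _)) (∔-mono h k)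

  crisp-⨅ : {I : Set} (f : I → Carrier) → (∀ i → Crisp (f i)) → Crisp (⨅ f)
  crisp-⨅ f h = ⨅-greatest f λ i → ≤-trans (double-mono (⨅-lower f i)) (h i)

  crisp⇒≤α : ∀ {c} → Crisp c → c ≤ α c
  crisp⇒≤α h = ≤-trans (≥-reflexive (α-left _)) (α-mono (≤-trans (x∧y≤x _ _) h))

  -- Conversely, α e = e yields e = 2e ∧ j⁎ e, and then 2e ≤ e ∔ 2⁻ⁿ by induction on n.
  ≤α⇒crisp : ∀ {e} → e ≤ α e → Crisp e
  ≤α⇒crisp {e} h = archimedean _ _ bound
    where
    fixed : double e ∧ j⁎ e ≤ e
    fixed = ≤-trans (∧-greatest (≤-trans (x∧y≤x _ _) (double-mono h)) (≤-trans (x∧y≤y _ _) (j⁎-mono h)))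
                    (≤-reflexive (α-right e))
    bound : ∀ n → double e ≤ e ∔ δ n
    bound zero    = ≤-trans (maximum _) ≤-∔ˡ
    -- With δ = 2⁻⁽ⁿ⁺¹⁾ the induction hypothesis gives 2e ≤ j⁎(2e) ≤ j⁎(2δ ∔ e) = δ ∔ j⁎ e. Together
    -- with 2e ≤ 2e ∔ δ this yields 2e ≤ (2e ∧ j⁎ e) ∔ δ, and `fixed` applies.
    bound (ℕ.suc n) = ≤-trans (∔-∧ ≤-∔ʳ (≤-trans (j⁎-infl _) (≤-trans
      (j⁎-mono (≤-trans (bound n) (≤-trans ∔-swap (∔-monoˡ (δ≤double-δ n)))))
      (≤-trans (≤-reflexive (j⁎-∔ e (δ (ℕ.suc n)))) ∔-swap)))) (∔-monoˡ fixed)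

  -- Since c ≤ α c, the rule `α⇐` halves the error: c ≤ v ∔ 2δ gives c ≤ 2(v ∔ δ), the hypothesis
  -- gives c ≤ j⁎(v ∔ δ), and so c ≤ v ∔ δ. The induction starts from `δ 0`, which is 𝟏.
  crisp-≤-j⁎ : ∀ {c v} → Crisp c → c ≤ j⁎ v → c ≤ v
  crisp-≤-j⁎ {c} {v} crisp h = archimedean _ _ bound
    where
    bound : ∀ n → c ≤ v ∔ δ n
    bound zero    = ≤-trans (maximum _) ≤-∔ˡ
    bound (ℕ.suc n) = ≤-trans (crisp⇒≤α crisp) (α⇐
      (≤-trans (bound n) (≤-trans (∔-mono (double-infl v) (δ≤double-δ n)) (≥-reflexive (double-∔ _ _))))
      (≤-trans h (j⁎-mono ≤-∔ʳ)))

  -- One may take d = bₙ = 1 - 2⁻ⁿ. As bₙ₊₁ = j⁎ bₙ, the axiom `j⁎-∔` gives e ∔ bₙ₊₁ = j⁎(2e ∔ bₙ);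
  -- dropping `j⁎` and using 2e ≤ e leads from bₙ₊₁ to bₙ, and finally to b₀ = 0.
  crisp-≤-∔ : ∀ {c e} → Crisp c → Crisp e → ∀ d → val d ℚ.< 1ℚ → c ≤ e ∔ D d → c ≤ e
  crisp-≤-∔ {c} {e} crisp-c crisp-e (k /2^ n) d<1 h =
    descend n (≤-trans h (∔-monoʳ (D-mono (k /2^ n) (belowOne n) (≤belowOne k n d<1))))
    where
    descend : ∀ n → c ≤ e ∔ D (belowOne n) → c ≤ e
    descend zero    h = ≤-trans h (≤-reflexive (∔-identityʳ e))
    descend (ℕ.suc n) h = descend n (≤-trans (crisp-≤-j⁎ crisp-c (≤-trans h (≤-trans
      (∔-monoʳ (≥-reflexive (j⁎-D (belowOne n)))) (≥-reflexive (j⁎-∔ _ e)))))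
      (∔-monoˡ crisp-e))

-- The residuated lattice of crisp elements

module CrispLattice {ℓ} {S : Structure (suc ℓ) ℓ} (isModel : IsModel S)
  (complete : Complete S) (archimedean : Archimedean S) where
  open Structure S
  open IsModel isModel
  open ModelProperties isModel
  open Crisp isModel complete archimedean

  -- The order of L is the reverse of that of S: a crisp c stands for the truth value "c vanishes".
  L : CommutativeResiduatedCompleteLattice (suc ℓ)
  L = record
    { Carrier        = Σ Carrier Crisp
    ; _≈_            = λ (c , _) (e , _) → Lift _ (c ≈ e)
    ; _≤_            = _⊑_
    ; isPartialOrder = record
      { isPreorder = record
        { isEquivalence = record
          { refl  = lift Eq.refl
          ; sym   = λ (lift h) → lift (Eq.sym h)
          ; trans = λ (lift h) (lift k) → lift (Eq.trans h k)
          }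
        ; reflexive = λ (lift h) → lift (≥-reflexive h)
        ; trans     = λ (lift h) (lift k) → lift (≤-trans k h)
        }
      ; antisym = λ (lift h) (lift k) → lift (antisym k h)
      }
    ; ⋁ = ⋁
    ; ⋀ = λ P → ⋁ (λ c → ∀ e → P e → c ⊑ e)
    ; ⋁-isSupremum = λ P → ⋁-upper P , ⋁-least P
    ; ⋀-isInfimum  = λ P → (λ c Pc → ⋁-least _ c λ e h → h c Pc) , (λ c h → ⋁-upper _ c h)
    ; ⊥ = 𝟏 , crisp-𝟏
    ; ⊤ = 𝟎 , crisp-𝟎
    ; ⊥-least    = λ _ → lift (maximum _)
    ; ⊤-greatest = λ _ → lift (minimum _)
    ; _⊗_ = _⊗_
    ; _↛_ = λ c e → ⋁ (λ x → (x ⊗ c) ⊑ e)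
    ; ⊗-isCommutativeMonoid = record
      { isMonoid = record
        { isSemigroup = record
          { isMagma = record
            { isEquivalence = record
              { refl  = lift Eq.refl
              ; sym   = λ (lift h) → lift (Eq.sym h)
              ; trans = λ (lift h) (lift k) → lift (Eq.trans h k)
              }
            ; ∙-cong = λ (lift h) (lift k) → lift (∔-cong h k)
            }
          ; assoc = λ _ _ _ → lift (∔-assoc _ _ _)
          }
        ; identity = (λ _ → lift (∔-identityˡ _)) , (λ _ → lift (∔-identityʳ _))
        }
      ; comm = λ _ _ → lift (∔-comm _ _)
      }
    -- The implication is an infimum of crisp elements and so crisp by construction. `_∸_` is used
    -- to carry the inequality through that infimum.
    ; residual = λ u v w → mk⇔ (⋁-upper _ u)
        (λ (lift h) → lift (≤-trans (from-∸ (meet-greatest-of (λ x → (x ⊗ v) ⊑ w) λ _ (lift k) → to-∸ k)) (∔-monoˡ h)))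
    }
    where
    _⊑_ : Σ Carrier Crisp → Σ Carrier Crisp → Set (suc ℓ)
    (c , _) ⊑ (e , _) = Lift _ (e ≤ c)

    _⊗_ : Σ Carrier Crisp → Σ Carrier Crisp → Σ Carrier Crisp
    (c , h) ⊗ (e , k) = c ∔ e , crisp-∔ h k

    module _ (P : Σ Carrier Crisp → Set (suc ℓ)) where
      family : Carrier → Set (suc ℓ)
      family u = ∃ λ c → P c × u ≡ proj₁ c

      glb : Carrier
      glb = proj₁ (complete family)

      meet-greatest-of : ∀ {w} → (∀ c → P c → w ≤ proj₁ c) → w ≤ glb
      meet-greatest-of h = proj₂ (proj₂ (complete family)) _ λ { _ (c , Pc , refl) → h c Pc }

      meet-lower-of : ∀ c → P c → glb ≤ proj₁ c
      meet-lower-of c Pc = proj₁ (proj₂ (complete family)) _ (c , Pc , refl)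

      ⋁ : Σ Carrier Crisp
      ⋁ = glb , meet-greatest-of λ c Pc → ≤-trans (double-mono (meet-lower-of c Pc)) (proj₂ c)

      ⋁-upper : ∀ c → P c → c ⊑ ⋁
      ⋁-upper c Pc = lift (meet-lower-of c Pc)

      ⋁-least : ∀ c → (∀ e → P e → e ⊑ c) → ⋁ ⊑ c
      ⋁-least c h = lift (meet-greatest-of λ e Pe → lower (h e Pe))

-- The isomorphism of a complete archimedean model with USC(L)

ι : ∀ d → val d ℚ.≤ 1ℚ → 𝕀
ι d = rational (val d) (val-nonNeg d)

abstract
  -- A downward search through the multiples of 2⁻ᵐ, starting at 1, which lies outside the cut. It
  -- stops at the least multiple d outside, and t is its predecessor.
  approximate : Classical → ∀ p m →
    Σ[ d ∈ 𝔻 ] val d ℚ.≤ 1ℚ × ¬ cut (value p) (val d) × ∃ λ t → cut (value p) t × t ℚ.+ unit m ≡ val d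
  approximate em p m = search (2 ^ m) ℕ.≤-refl λ h → ℚ.<-irrefl (2^·unit m) (≤1 p h)
    where
    search : ∀ k → k ℕ.≤ 2 ^ m → ¬ cut (value p) (val (k /2^ m)) →
      Σ[ d ∈ 𝔻 ] val d ℚ.≤ 1ℚ × ¬ cut (value p) (val d) × ∃ λ t → cut (value p) t × t ℚ.+ unit m ≡ val d
    -- For p = 0 the predecessor of d = 0 is the negative number -2⁻ᵐ, which belongs to the cut
    -- because p ≥ 0.
    search zero    k≤ ¬p = 0 /2^ m , val≤1 {m = m} k≤ , ¬p
      , - unit m , 0≤ p (ℚ.neg-antimono-< (unit-pos m)) , ℚ.+-inverseˡ (unit m)
    search (ℕ.suc k) k≤ ¬p with em {P = cut (value p) (val (k /2^ m))}
    ... | yes pk = ℕ.suc k /2^ m , val≤1 {m = m} k≤ , ¬p , val (k /2^ m) , pk , ℚ.+-comm (val (k /2^ m)) (unit m)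
    ... | no ¬pk = search k (ℕ.<⇒≤ k≤) ¬pk

  unit-below : ∀ {a b} → a ℚ.< b → ∃ λ m → a ℚ.+ unit m ℚ.≤ b
  unit-below {a} {b} a<b = proj₁ small , shift-≤ (proj₂ small)
      (solve 3 (λ a b u → a :+ u :+ (b :+ :- a) := b :+ u) refl a b (unit (proj₁ small)))
    where
    small : ∃ λ m → unit m ℚ.≤ b ℚ.+ - a
    small = unit-small (b ℚ.+ - a) (shift-< a<b (solve 2 (λ a b → con 0ℚ :+ b := b :+ :- a :+ a) refl a b))

  dyadic-between : Classical → ∀ {a b} → 0ℚ ℚ.≤ a → a ℚ.≤ 1ℚ → a ℚ.< b → Σ[ d ∈ 𝔻 ] a ℚ.≤ val d × val d ℚ.< b
  dyadic-between em {a} {b} 0≤a a≤1 a<b =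
    let m , h = unit-below a<b
        d , _ , d≮a , t , t<a , e = approximate em (rational a 0≤a a≤1) m
    in d , ℚ.≮⇒≥ d≮a , subst (ℚ._< b) e (ℚ.<-≤-trans (ℚ.+-monoˡ-< (unit m) t<a) h)

  dyadic-strictly-between : Classical → ∀ {a b} → 0ℚ ℚ.≤ a → b ℚ.≤ 1ℚ → a ℚ.< b → Σ[ d ∈ 𝔻 ] a ℚ.< val d × val d ℚ.< b
  dyadic-strictly-between em 0≤a b≤1 a<b =
    let t , a<t , t<b = ℚ.<-dense a<b
        d , t≤d , d<b = dyadic-between em (ℚ.≤-trans 0≤a (ℚ.<⇒≤ a<t)) (ℚ.≤-trans (ℚ.<⇒≤ t<b) b≤1) t<b
    in d , ℚ.<-≤-trans a<t t≤d , d<b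

+<1 : ∀ {a b c} → b ℚ.+ c ≡ 1ℚ → a ℚ.< b → a ℚ.+ c ℚ.< 1ℚ
+<1 {a} {b} {c} e a<b = ℚ.<-≤-trans (ℚ.+-monoˡ-< c a<b) (ℚ.≤-reflexive e)

1≤+ : ∀ {a b c} → b ℚ.+ c ≡ 1ℚ → b ℚ.≤ a → 1ℚ ℚ.≤ a ℚ.+ c
1≤+ {a} {b} {c} e b≤a = ℚ.≤-trans (ℚ.≤-reflexive (sym e)) (ℚ.+-monoˡ-≤ c b≤a)

abstract
  val-half⊕½ : ∀ d → val (half𝔻 d ⊕ 1 /2^ 1) ≡ val (half𝔻 d) ℚ.+ ½
  val-half⊕½ d = val-⊕ (half𝔻 d) (1 /2^ 1)

  half⊕½ : ∀ d → val (half𝔻 d ⊕ 1 /2^ 1) ℚ.+ val (half𝔻 d ⊕ 1 /2^ 1) ≡ val d ℚ.+ 1ℚ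
  half⊕½ d = trans (cong₂ ℚ._+_ (val-half⊕½ d) (val-half⊕½ d)) (trans
    (solve 1 (λ h → h :+ con ½ :+ (h :+ con ½) := h :+ h :+ con 1ℚ) refl (val (half𝔻 d))) (cong (ℚ._+ 1ℚ) (val-half d)))

  half-complement : ∀ r r′ → val r ℚ.+ val r′ ≡ 1ℚ → val (half𝔻 r) ℚ.+ val (half𝔻 r′ ⊕ 1 /2^ 1) ≡ 1ℚ
  half-complement r r′ e = half-unique (trans
    (solve 2 (λ h k → h :+ k :+ (h :+ k) := h :+ h :+ (k :+ k)) refl (val (half𝔻 r)) (val (half𝔻 r′ ⊕ 1 /2^ 1)))
    (trans (cong₂ ℚ._+_ (val-half r) (half⊕½ r′)) (trans (sym (ℚ.+-assoc (val r) (val r′) 1ℚ)) (cong (ℚ._+ 1ℚ) e))))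

  complement-double : ∀ r r′ y → val r ℚ.+ val r′ ≡ 1ℚ → val (r′ ⊕ r′) ℚ.+ val y ≡ 1ℚ → val y ℚ.+ 1ℚ ≡ val r ℚ.+ val r
  complement-double r r′ y k e = +-cancelˡ (val r′ ℚ.+ val r′) (trans (sym (ℚ.+-assoc (val r′ ℚ.+ val r′) (val y) 1ℚ))
    (trans (cong (ℚ._+ 1ℚ) (trans (cong (ℚ._+ val y) (sym (val-⊕ r′ r′))) e)) (trans (sym (cong₂ ℚ._+_ k k))
      (solve 2 (λ r s → r :+ s :+ (r :+ s) := s :+ s :+ (r :+ r)) refl (val r) (val r′)))))

  double-complement : ∀ r r′ y → val r ℚ.+ val r′ ≡ 1ℚ → val (r ⊕ r) ℚ.+ val y ≡ 1ℚ → val (half𝔻 y ⊕ 1 /2^ 1) ≡ val r′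
  double-complement r r′ y k e = half-unique (trans (half⊕½ y)
    (complement-double r′ r y (trans (ℚ.+-comm (val r′) (val r)) k) e))

  sum-of-approximations : ∀ m {a b x y s} → a ℚ.+ unit (ℕ.suc m) ≡ x → b ℚ.+ unit (ℕ.suc m) ≡ y →
                          a ℚ.+ b ℚ.< s → x ℚ.+ y ℚ.< s ℚ.+ unit m
  sum-of-approximations m {a} {b} {s = s} refl refl h = subst (ℚ._< s ℚ.+ unit m)
    (trans (cong (a ℚ.+ b ℚ.+_) (sym (unit-halves m)))
      (solve 3 (λ a b u → a :+ b :+ (u :+ u) := a :+ u :+ (b :+ u)) refl a b (unit (ℕ.suc m))))
    (ℚ.+-monoˡ-< (unit m) h)

module Representation (em : Classical) {ℓ} {S : Structure (suc ℓ) ℓ} (isModel : IsModel S)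
  (complete : Complete S) (archimedean : Archimedean S) where
  open Structure S hiding (_≃_; _≲_)
  open IsModel isModel
  open ModelProperties isModel
  open Crisp isModel complete archimedean
  open CrispLattice isModel complete archimedean public using (L)
  private
    module L = CommutativeResiduatedCompleteLattice L
    module U = USC em L
    module UP = USCProperties em L
    module LO = IsPartialOrder L.isPartialOrder
  open U using (Map; fun; mono; leftCts; _⊑_; _≋_)
  open CommutativeSemigroup (CommutativeMonoid.commutativeSemigroup ∔-commutativeMonoid) using (interchange)

  κ : Carrier → Carrier
  κ w = ⨅ λ n → α^ n w

  -- `α` commutes with the infimum and merely shifts the sequence, so κ w ≤ α (κ w).
  κ-crisp : ∀ w → Crisp (κ w)
  κ-crisp w = ≤α⇒crisp (α-⨅ _ λ n → ⨅-lower _ (ℕ.suc n))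

  crisp-≤-κ : ∀ {c w} → Crisp c → c ≤ w → c ≤ κ w
  crisp-≤-κ {c} {w} crisp h = ⨅-greatest _ bound
    where
    bound : ∀ n → c ≤ α^ n w
    bound zero    = h
    bound (ℕ.suc n) = ≤-trans (crisp⇒≤α crisp) (α-mono (bound n))

  -- The complement 1 - d is carried as any dyadic number d′ with the right sum, so that whichever
  -- representative a computation produces can be used.
  record Index (q : 𝕀) : Set where
    constructor index
    field
      d d′ : 𝔻
      sum  : val d ℚ.+ val d′ ≡ 1ℚ
      d<q  : cut (value q) (val d)

  ∣_∣ : Map → 𝕀 → Carrier
  ∣ f ∣ q = proj₁ (fun f q)

  level : Carrier → 𝕀 → Carrier
  level u q = ⨅ λ (i : Index q) → κ (u ∔ D (Index.d′ i))

  level-crisp : ∀ u q → Crisp (level u q)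
  level-crisp u q = crisp-⨅ _ λ i → κ-crisp _

  level-≤ : ∀ u {q} (i : Index q) → level u q ≤ u ∔ D (Index.d′ i)
  level-≤ u i = ≤-trans (⨅-lower _ i) (⨅-lower _ 0)

  -- With `level-≤` this says that `level u q` is the largest crisp element below all u ∔ (1 - r)
  -- with r < q. The proofs that F preserves the operations rely on this and never unfold `κ`.
  ≤-level : ∀ {c u} q → Crisp c → (∀ (i : Index q) → c ≤ u ∔ D (Index.d′ i)) → c ≤ level u q
  ≤-level q crisp h = ⨅-greatest _ λ i → crisp-≤-κ crisp (h i)

  level-mono : ∀ {u v} q → u ≤ v → level u q ≤ level v q
  level-mono q h = ≤-level q (level-crisp _ q) λ i → ≤-trans (level-≤ _ i) (∔-monoˡ h)

  level-antitone : ∀ u {p q} → p ≤ⁱ q → level u q ≤ level u p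
  level-antitone u {p} {q} p≤q = ≤-level p (level-crisp _ q) λ (index d d′ e h) → level-≤ u (index d d′ e (p≤q h))

  -- F u sends q to the truth value "u < q".
  F : Carrier → Map
  F u = U.mkMap (λ q → level u q , level-crisp u q) (λ p q p≤q → lift (level-antitone u {p} {q} p≤q))
    λ q (c , crisp) h → lift (≤-level q crisp λ (index d d′ e d<q) →
      let p , p<q , d<p = between q (val d) (val-nonNeg d) d<q in
      ≤-trans (lower (h p p<q)) (level-≤ u (index d d′ e d<p)))

  record Point : Set where
    constructor point
    field
      d   : 𝔻
      d≤1 : val d ℚ.≤ 1ℚ

  -- For a number f, d ∔ f d is d if f < d and 1 otherwise, and f is the infimum of these.
  G : Map → Carrier
  G f = ⨅ λ ((point d d≤1) : Point) → D d ∔ ∣ f ∣ (ι d d≤1)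

  G-≤ : ∀ f d (d≤1 : val d ℚ.≤ 1ℚ) → G f ≤ D d ∔ ∣ f ∣ (ι d d≤1)
  G-≤ f d d≤1 = ⨅-lower _ (point d d≤1)

  G-mono : ∀ {f g} → f ⊑ g → G f ≤ G g
  G-mono {f} h = ⨅-greatest _ λ (point d d≤1) → ≤-trans (G-≤ f d d≤1) (∔-monoʳ (lower (h (ι d d≤1))))

  -- ∔ distributes over the infima inside `level`, which leaves u ≤ d ∔ αⁿ(u ∔ (1 - r)) for r < d:
  -- the axiom `α^-lower` at r, weakened by r ≤ d.
  ≤-GF : ∀ u → u ≤ G (F u)
  ≤-GF u = ⨅-greatest _ λ (point d d≤1) → ∔-⨅ _ λ (index r r′ e r<d) → ∔-⨅ _ λ n → lower-axiom d r r′ e r<d n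
    where
    lower-axiom : ∀ d r r′ → val r ℚ.+ val r′ ≡ 1ℚ → val r ℚ.< val d → ∀ n → u ≤ D d ∔ α^ n (u ∔ D r′)
    lower-axiom d r@(k /2^ m) r′ e r<d n = ≤-trans (α^-lower k m k≤2^m n u) (∔-mono
      (≤-trans (≤-reflexive (dyadic≈D k m k≤2^m)) (D-mono r d (ℚ.<⇒≤ r<d)))
      (α^-mono n (∔-monoʳ (≤-trans (≤-reflexive (dyadic≈D (2 ^ m ℕ.∸ k) m (ℕ.m∸n≤m (2 ^ m) k)))
        (≤-reflexive (D-cong (co r) r′ (+-cancelˡ (val r) (trans (val-co r r≤1) (sym e)))))))))
      where
      r≤1 : val r ℚ.≤ 1ℚ
      r≤1 = subst (val r ℚ.≤_) e (ℚ.≤-trans (ℚ.≤-reflexive (sym (ℚ.+-identityʳ _))) (ℚ.+-monoʳ-≤ (val r) (val-nonNeg r′)))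
      k≤2^m = val≤1⁻¹ k m r≤1

  -- `level` at d only involves r < d, while the axiom pairs r with itself. Hence d is taken one
  -- grid step above r = 1 - (i + 1)/2ᵐ, at the cost of the summand `δ m`.
  GF-bound : ∀ u m i → ℕ.suc i ℕ.≤ 2 ^ m →
             G (F u) ≤ (dyadic (2 ^ m ℕ.∸ ℕ.suc i) m ∔ α^ m (u ∔ dyadic (ℕ.suc i) m)) ∔ δ m
  GF-bound u m i 1+i≤2^m = ≤-trans (G-≤ (F u) d d≤1) (≤-trans ∔-assoc≤ (≤-trans ∔-swap (∔-monoˡ (∔-mono
      (≥-reflexive (dyadic≈D (2 ^ m ℕ.∸ ℕ.suc i) m (ℕ.m∸n≤m (2 ^ m) (ℕ.suc i))))
      (≤-trans (⨅-lower _ (index r r′ r+r′ (·ℚ-mono-< (ℕ.n<1+n (2 ^ m ℕ.∸ ℕ.suc i)) (unit-pos m))))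
        (≤-trans (⨅-lower _ m) (α^-mono m (∔-monoʳ (≥-reflexive (dyadic≈D (ℕ.suc i) m 1+i≤2^m))))))))))
    where
    r r′ d : 𝔻
    r  = (2 ^ m ℕ.∸ ℕ.suc i) /2^ m
    r′ = ℕ.suc i /2^ m
    d  = ℕ.suc (2 ^ m ℕ.∸ ℕ.suc i) /2^ m
    d≤1 : val d ℚ.≤ 1ℚ
    d≤1 = val≤1 {m = m} (ℕ.≤-trans (ℕ.≤-trans (ℕ.s≤s (ℕ.m≤m+n (2 ^ m ℕ.∸ ℕ.suc i) i))
      (ℕ.≤-reflexive (sym (ℕ.+-suc (2 ^ m ℕ.∸ ℕ.suc i) i)))) (ℕ.≤-reflexive (ℕ.m∸n+n≡m 1+i≤2^m)))
    r+r′ : val r ℚ.+ val r′ ≡ 1ℚ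
    r+r′ = trans (sym (·ℚ-homo-+ (unit m) (2 ^ m ℕ.∸ ℕ.suc i) (ℕ.suc i)))
      (trans (cong (_·ℚ unit m) (ℕ.m∸n+n≡m 1+i≤2^m)) (2^·unit m))

  GF-≤ : ∀ u → G (F u) ≤ u
  -- On the grid of step 2⁻⁽ⁿ⁺²⁾ the axiom has error 2⁻⁽ⁿ⁺¹⁾ and `GF-bound` adds one grid step; both
  -- together stay below 2⁻ⁿ.
  GF-≤ u = archimedean _ _ λ n → ≤-trans
    (from-∸ (≤-trans (meet-greatest (2 ^ ℕ.suc (ℕ.suc n) ℕ.∸ 1)
      {λ k → dyadic (2 ^ ℕ.suc (ℕ.suc n) ℕ.∸ k) (ℕ.suc (ℕ.suc n)) ∔ α^ (ℕ.suc (ℕ.suc n)) (u ∔ dyadic k (ℕ.suc (ℕ.suc n)))} λ i i< →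
      to-∸ (GF-bound u (ℕ.suc (ℕ.suc n)) i (ℕ.≤-trans i< (ℕ.m∸n≤m (2 ^ ℕ.suc (ℕ.suc n)) 1)))) (α^-upper (ℕ.suc n) u)))
    (≤-trans ∔-assoc≤ (∔-monoʳ (≤-trans (∔-monoʳ (δ-mono (ℕ.suc n))) (δ-∔-≤ n))))

  -- For each d in the infimum `G f`, either r < d and d ∔ (1 - r) is already 𝟏, or d ≤ r < q and
  -- the monotonicity of f applies.
  FG-≥ : ∀ f q → ∣ f ∣ q ≤ level (G f) q
  FG-≥ f q = ≤-level q (proj₂ (fun f q)) λ (index r r′ r+r′ r<q) → ≤-trans (∔-⨅ _ λ (point d d≤1) →
    [ (λ r<d → ≤-trans (maximum _) (≤-trans (𝟏≤D (d ⊕ r′) (ℚ.≤-trans (1≤+ r+r′ (ℚ.<⇒≤ r<d)) (ℚ.≤-reflexive (sym (val-⊕ d r′)))))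
        (≤-trans (≤-reflexive (D-⊕ d r′)) (≤-trans ∔-swap (∔-monoʳ ≤-∔ʳ)))))
    , (λ d≤r → ≤-trans (lower (mono f {ι d d≤1} {q} λ s<d → downward (value q) (ℚ.<⇒≤ (ℚ.<-≤-trans s<d d≤r)) r<q))
        (≤-trans ≤-∔ˡ ≤-∔ˡ))
    ]′ (split (val r) (val d))) ∔-swap

  -- By left continuity it suffices to bound by the value at p < q. With p ≤ d < r < q, the element
  -- is below f d ∔ (d + (1 - r)); the dyadic part is less than 1 and drops out by `crisp-≤-∔`.
  FG-≤ : ∀ f q → level (G f) q ≤ ∣ f ∣ q
  FG-≤ f q = lower (leftCts f q (level (G f) q , level-crisp _ q) λ p p<q → lift (bound p p<q))
    where
    bound : ∀ p → p <ⁱ q → level (G f) q ≤ ∣ f ∣ p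
    bound p (s , qs , ¬ps) with rounded (value q) qs
    ... | s₁ , s<s₁ , qs₁ with dyadic-between em (∉⇒≥0 p ¬ps) (ℚ.<⇒≤ (ℚ.<-trans s<s₁ (≤1 q qs₁))) s<s₁
    ...   | d , s≤d , d<s₁ with dyadic-strictly-between em (val-nonNeg d) (ℚ.<⇒≤ (≤1 q qs₁)) d<s₁
    ...     | r , d<r , r<s₁ = ≤-trans
        (crisp-≤-∔ (level-crisp _ q) (proj₂ (fun f (ι d d≤1))) (d ⊕ co r)
          (subst (ℚ._< 1ℚ) (sym (val-⊕ d (co r))) (+<1 r+r′ d<r))
          (≤-trans (level-≤ (G f) (index r (co r) r+r′ (downward (value q) (ℚ.<⇒≤ r<s₁) qs₁)))
            (≤-trans (∔-monoˡ (≤-trans (G-≤ f d d≤1) ∔-swap)) (≤-trans ∔-assoc≤ (∔-monoʳ (≥-reflexive (D-⊕ d (co r))))))))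
        (lower (mono f {p} {ι d d≤1} λ pt → ℚ.<-≤-trans (cut-< (value p) pt ¬ps) s≤d))
      where
      r≤1 = ℚ.<⇒≤ (ℚ.<-trans r<s₁ (≤1 q qs₁))
      d≤1 = ℚ.<⇒≤ (ℚ.<-≤-trans d<r r≤1)
      r+r′ = val-co r r≤1

  FG : ∀ f → F (G f) ≋ f
  FG f q = lift (antisym (FG-≤ f q) (FG-≥ f q))

  -- The identity u ∔ j⁎(1 - x) = j⁎(2u ∔ (1 - x)) links the two sides, where j⁎(1 - x) = 1 - x/2.
  -- In one direction `j⁎` is introduced by `j⁎-infl`, in the other it is removed from above a crisp
  -- element.
  F-double : ∀ u → F (double u) ≋ U.double (F u)
  F-double u q = lift (antisym (≤-level (half q) (level-crisp _ q) forth) (≤-level q (level-crisp u (half q)) back))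
    where
    forth : (i : Index (half q)) → level (double u) q ≤ u ∔ D (Index.d′ i)
    forth (index r r′ r+r′ 2r<q) = ≤-trans (j⁎-infl _) (≤-trans
      (j⁎-mono (level-≤ (double u) (index x (co x) x+co-x (subst (cut (value q)) (sym (val-⊕ r r)) 2r<q))))
      (≤-trans (≤-reflexive (j⁎-∔ _ u)) (∔-monoʳ (≤-reflexive
        (Eq.trans (j⁎-D (co x)) (D-cong (half𝔻 (co x) ⊕ 1 /2^ 1) r′ half-co-x))))))
      where
      x : 𝔻
      x = r ⊕ r
      x+co-x : val x ℚ.+ val (co x) ≡ 1ℚ
      x+co-x = val-co x (ℚ.<⇒≤ (subst (ℚ._< 1ℚ) (sym (val-⊕ r r)) (≤1 q 2r<q)))
      half-co-x : val (half𝔻 (co x) ⊕ 1 /2^ 1) ≡ val r′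
      half-co-x = double-complement r r′ (co x) r+r′ x+co-x
    back : (i : Index q) → level u (half q) ≤ double u ∔ D (Index.d′ i)
    back (index r r′ r+r′ r<q) = crisp-≤-j⁎ (level-crisp u (half q)) (≤-trans
      (level-≤ u (index (half𝔻 r) (half𝔻 r′ ⊕ 1 /2^ 1) (half-complement r r′ r+r′)
        (subst (cut (value q)) (sym (val-half r)) r<q)))
      (≤-trans (∔-monoʳ (≥-reflexive (j⁎-D r′))) (≥-reflexive (j⁎-∔ _ u))))

  -- The link is j⁎ u ∔ (1 - x)/2 = j⁎(u ∔ (1 - x)), with `j⁎` removed or introduced as for
  -- `double`.
  F-j⁎ : ∀ u → F (j⁎ u) ≋ U.j⁎ (F u)
  F-j⁎ u q = lift (antisym (≤-level (stretch q) (level-crisp _ q) forth) (≤-level q (level-crisp u (stretch q)) back))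
    where
    forth : (i : Index (stretch q)) → level (j⁎ u) q ≤ u ∔ D (Index.d′ i)
    forth (index r r′ r+r′ r<) = crisp-≤-j⁎ (level-crisp _ q) (≤-trans
      (level-≤ (j⁎ u) (index (half𝔻 r ⊕ 1 /2^ 1) (half𝔻 r′) sum <q))
      (≤-trans ∔-swap (≤-trans (≥-reflexive (j⁎-∔ u _)) (j⁎-mono (≤-trans ∔-swap (∔-monoʳ (≤-reflexive (double-D r′))))))))
      where
      sum : val (half𝔻 r ⊕ 1 /2^ 1) ℚ.+ val (half𝔻 r′) ≡ 1ℚ
      sum = trans (ℚ.+-comm (val (half𝔻 r ⊕ 1 /2^ 1)) (val (half𝔻 r′))) 
              (half-complement r′ r (trans (ℚ.+-comm (val r′) (val r)) r+r′))
      <q : cut (value q) (val (half𝔻 r ⊕ 1 /2^ 1))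
      <q with stretch-elim q r< (val-nonNeg r)
      ... | m , qm , h = downward (value q) (ℚ.<⇒≤ (double-cancel (subst (ℚ._< m ℚ.+ m) (sym (half⊕½ r)) h))) qm
    back : (i : Index q) → level u (stretch q) ≤ j⁎ u ∔ D (Index.d′ i)
    -- The index 2r - 1 exists only for r ≥ ½. If 1 - r ≥ ½, the right side is at least ½ ∔ ½ = 𝟏,
    -- since j⁎ u ≥ j⁎ 𝟎 = ½.
    back (index r r′ r+r′ r<q) with split (val r′) ½
    ... | inj₂ ½≤r′ = ≤-trans (maximum _) (≤-trans (𝟏≤D (1 /2^ 1 ⊕ 1 /2^ 1) (ℚ.≤-reflexive refl))
            (≤-trans (≤-reflexive (D-⊕ (1 /2^ 1) (1 /2^ 1)))
            (∔-mono (≤-trans (≤-reflexive D1≈j⁎𝟎) (j⁎-mono (minimum u))) (D-mono (1 /2^ 1) r′ ½≤r′))))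
    ... | inj₁ r′<½ = ≤-trans (j⁎-infl _) (≤-trans (j⁎-mono (≤-trans
            (level-≤ u (index (co x) x (trans (ℚ.+-comm (val (co x)) (val x)) x+co-x) co-x<))
            (≤-trans ∔-swap (∔-monoˡ (≥-reflexive (double-D x))))))
            (≤-trans (≤-reflexive (j⁎-∔ u _)) (≤-trans ∔-swap (∔-monoʳ (≤-reflexive (D-cong (half𝔻 x) r′ half-x))))))
      where
      x : 𝔻
      x = r′ ⊕ r′
      x+co-x : val x ℚ.+ val (co x) ≡ 1ℚ
      x+co-x = val-co x (ℚ.≤-trans (ℚ.≤-reflexive (val-⊕ r′ r′)) (ℚ.<⇒≤ (ℚ.+-mono-< r′<½ r′<½)))
      half-x : val (half𝔻 x) ≡ val r′
      half-x = half-unique (trans (val-half x) (val-⊕ r′ r′))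
      co-x< : cut (value (stretch q)) (val (co x))
      co-x< with rounded (value q) r<q
      ... | m , r<m , qm = stretch-intro q qm (subst (ℚ._< m ℚ.+ m)
              (sym (complement-double r r′ (co x) r+r′ x+co-x)) (ℚ.+-mono-< r<m r<m))

  -- Dyadic d and e are chosen just above p and r so that d + e < z < q. Then u ≤ d ∔ level u p and
  -- likewise for v, and the remaining summand d + e + (1 - z) is below 1 and drops out by
  -- `crisp-≤-∔`.
  level-∔-≤ : ∀ u v p r q → value p +ʳ value r <ʳ value q → level (u ∔ v) q ≤ level u p ∔ level v r
  level-∔-≤ u v p r q (s , qs , ¬s) =
    let s₁ , s<s₁ , qs₁          = rounded (value q) qs
        t , s<t , t<s₁           = ℚ.<-dense s<s₁
        s₁≤1                     = ℚ.<⇒≤ (≤1 q qs₁)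
        m , s+u≤t                = unit-below s<t
        -- Precision `suc m` for each summand: the two overshoots add up to 2⁻ᵐ, which fits into the
        -- gap between s and t.
        d , d≤1 , ¬pd , a , pa , a+u = approximate em p (ℕ.suc m)
        e , e≤1 , ¬re , b , rb , b+u = approximate em r (ℕ.suc m)
        z , t≤z , z<s₁ = dyadic-between em (ℚ.≤-trans (sum-≥0 p r ¬s) (ℚ.<⇒≤ s<t)) (ℚ.≤-trans (ℚ.<⇒≤ t<s₁) s₁≤1) t<s₁
        z+co-z = val-co z (ℚ.≤-trans (ℚ.<⇒≤ z<s₁) s₁≤1)
        a+b<s = cut-< (value p +ʳ value r) (a , b , pa , rb , ℚ.≤-refl) ¬s
        d+e<z = ℚ.<-≤-trans (sum-of-approximations m {a} {b} a+u b+u a+b<s) (ℚ.≤-trans s+u≤t t≤z)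
    in crisp-≤-∔ (level-crisp _ q) (crisp-∔ (level-crisp u p) (level-crisp v r)) (d ⊕ e ⊕ co z)
        (subst (ℚ._< 1ℚ) (sym (trans (val-⊕ (d ⊕ e) (co z)) (cong (ℚ._+ val (co z)) (val-⊕ d e)))) (+<1 z+co-z d+e<z))
        (≤-trans (level-≤ (u ∔ v) (index z (co z) z+co-z (downward (value q) (ℚ.<⇒≤ z<s₁) qs₁)))
          (≤-trans (∔-monoˡ (∔-mono (near u p d d≤1 ¬pd) (near v r e e≤1 ¬re)))
          (≤-trans (∔-monoˡ (≤-trans (≤-reflexive (interchange _ _ _ _)) ∔-swap))
          (≤-trans ∔-assoc≤ (∔-monoʳ (≤-trans (∔-monoˡ (≥-reflexive (D-⊕ d e))) (≥-reflexive (D-⊕ (d ⊕ e) (co z)))))))))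
    where
    near : ∀ u p d (d≤1 : val d ℚ.≤ 1ℚ) → ¬ cut (value p) (val d) → u ≤ D d ∔ level u p
    near u p d d≤1 ¬pd = ≤-trans (≤-trans (≤-GF u) (G-≤ (F u) d d≤1))
      (∔-monoʳ (level-antitone u {p} {ι d d≤1} λ pt → cut-< (value p) pt ¬pd))

  -- For the direction not covered by `level-∔-≤`, u and v are replaced by G (F u) and G (F v) and
  -- their infima expanded over d and e. If d + e < s, the pair occurs in the supremum defining the
  -- sum at q; otherwise d + e + (1 - s) reaches 1.
  F-∔ : ∀ u v → F (u ∔ v) ≋ F u U.∔ F v
  F-∔ u v q = LO.antisym {fun (F (u ∔ v)) q} {fun (F u U.∔ F v) q}
    (lift (≤-level q (proj₂ (fun (F u U.∔ F v) q)) λ (index s s′ s+s′ s<q) →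
      ≤-trans (bound s s′ s+s′ s<q) (∔-monoˡ (∔-mono (GF-≤ u) (GF-≤ v)))))
    (U.⋁-least {y = fun (F (u ∔ v)) q} λ { x (p , r , lt , lift e) → lift (≤-trans (level-∔-≤ u v p r q lt) (≥-reflexive e)) })
    where
    w = ∣ F u U.∔ F v ∣ q
    bound : ∀ s s′ → val s ℚ.+ val s′ ≡ 1ℚ → cut (value q) (val s) → w ≤ G (F u) ∔ G (F v) ∔ D s′
    bound s s′ s+s′ s<q = ≤-trans (∔-⨅ _ λ (point e e≤1) → ≤-trans (∔-⨅ _ λ (point d d≤1) → term d d≤1 e e≤1)
        (≤-trans ∔-swap ∔-assoc≥)) ∔-swapʳ
      where
      term : ∀ d (d≤1 : val d ℚ.≤ 1ℚ) e (e≤1 : val e ℚ.≤ 1ℚ) →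
             w ≤ D s′ ∔ (D e ∔ level v (ι e e≤1)) ∔ (D d ∔ level u (ι d d≤1))
      term d d≤1 e e≤1 with split (val d ℚ.+ val e) (val s)
      ... | inj₁ d+e<s = ≤-trans (lower (U.⋁-upper {x = fun (F u) (ι d d≤1) L.⊗ fun (F v) (ι e e≤1)}
              (ι d d≤1 , ι e e≤1 , (val s , s<q , d+e≮s) , lift Eq.refl)))
            (≤-trans ∔-swap (∔-mono (≤-trans ≤-∔ˡ ≤-∔ˡ) ≤-∔ˡ))
        where
        d+e≮s : ¬ cut (value (ι d d≤1) +ʳ value (ι e e≤1)) (val s)
        d+e≮s (a , b , a<d , b<e , h) = ℚ.<-asym d+e<s (ℚ.≤-<-trans h (ℚ.+-mono-< a<d b<e))
      ... | inj₂ s≤d+e = ≤-trans (maximum _) (≤-trans (𝟏≤D (d ⊕ e ⊕ s′) (ℚ.≤-trans (1≤+ s+s′ s≤d+e)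
              (ℚ.≤-reflexive (sym (trans (val-⊕ (d ⊕ e) s′) (cong (ℚ._+ val s′) (val-⊕ d e)))))))
            (≤-trans (≤-reflexive (D-⊕ (d ⊕ e) s′)) (≤-trans (∔-monoˡ (≤-trans (≤-reflexive (D-⊕ d e)) ∔-swap))
              (≤-trans ∔-swap (≤-trans ∔-assoc≥ (∔-mono (∔-monoʳ ≤-∔ʳ) ≤-∔ʳ))))))

  -- _⊑_ unfolds, which would prevent the inference of its arguments.
  infix 4 _⊴_
  record _⊴_ (f g : Map) : Set (suc ℓ) where
    constructor ⟪_⟫
    field un : f ⊑ g
  open _⊴_

  ⊴-trans : ∀ {f g h} → f ⊴ g → g ⊴ h → f ⊴ h
  ⊴-trans {f} {g} {h} ⟪ f⊑g ⟫ ⟪ g⊑h ⟫ = ⟪ (λ q → LO.trans {fun h q} {fun g q} {fun f q} (g⊑h q) (f⊑g q)) ⟫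

  ⊴-antisym : ∀ {f g} → f ⊴ g → g ⊴ f → f ≋ g
  ⊴-antisym {f} {g} ⟪ h ⟫ ⟪ k ⟫ q = LO.antisym {fun f q} {fun g q} (k q) (h q)

  ≋⇒⊴⊵ : ∀ f g → f ≋ g → f ⊴ g × g ⊴ f
  ≋⇒⊴⊵ f g e = ⟪ (λ q → lift (≤-reflexive (lower (e q)))) ⟫ , ⟪ (λ q → lift (≥-reflexive (lower (e q)))) ⟫

  F-mono : ∀ {u v} → u ≤ v → F u ⊴ F v
  F-mono h = ⟪ (λ q → lift (level-mono q h)) ⟫

  F⊴⇒≤G : ∀ {u f} → F u ⊴ f → u ≤ G f
  F⊴⇒≤G {u} {f} ⟪ h ⟫ = ≤-trans (≤-GF u) (G-mono {F u} {f} h)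

  F-cancel : ∀ {u v} → F u ⊴ F v → u ≤ v
  F-cancel h = ≤-trans (F⊴⇒≤G h) (GF-≤ _)

  FG-⊴ : ∀ {f} → F (G f) ⊴ f
  FG-⊴ {f} = proj₁ (≋⇒⊴⊵ (F (G f)) f (FG f))

  FG-⊵ : ∀ {f} → f ⊴ F (G f)
  FG-⊵ {f} = proj₂ (≋⇒⊴⊵ (F (G f)) f (FG f))

  ≤G⇒F⊴ : ∀ {u f} → u ≤ G f → F u ⊴ f
  ≤G⇒F⊴ h = ⊴-trans (F-mono h) FG-⊴

  G≤⇒⊴F : ∀ {f u} → G f ≤ u → f ⊴ F u
  G≤⇒⊴F h = ⊴-trans FG-⊵ (F-mono h)

  F-double-⊴⊵ : ∀ v → F (double v) ⊴ U.double (F v) × U.double (F v) ⊴ F (double v)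
  F-double-⊴⊵ v = ≋⇒⊴⊵ _ (U.double (F v)) (F-double v)

  F-j⁎-⊴⊵ : ∀ v → F (j⁎ v) ⊴ U.j⁎ (F v) × U.j⁎ (F v) ⊴ F (j⁎ v)
  F-j⁎-⊴⊵ v = ≋⇒⊴⊵ _ (U.j⁎ (F v)) (F-j⁎ v)

  F-∔-⊴⊵ : ∀ u v → F (u ∔ v) ⊴ F u U.∔ F v × F u U.∔ F v ⊴ F (u ∔ v)
  F-∔-⊴⊵ u v = ≋⇒⊴⊵ _ (F u U.∔ F v) (F-∔ u v)

  -- Left adjoints are determined by their right adjoints, which F respects. Writing k⁻ (F u) as F
  -- of its image under G makes the adjunction of the model applicable.
  F-adjoint : (h⁻ h : Carrier → Carrier) (k⁻ k : Map → Map) →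
              (∀ u v → h⁻ u ≤ v ⇔ u ≤ h v) → (∀ f g → k⁻ f ⊑ g ⇔ f ⊑ k g) →
              (∀ v → F (h v) ⊴ k (F v) × k (F v) ⊴ F (h v)) → ∀ u → F (h⁻ u) ≋ k⁻ (F u)
  F-adjoint h⁻ h k⁻ k adj adj′ F-h u = ⊴-antisym {g = k⁻ (F u)}
    (≤G⇒F⊴ (from (adj u _) (F-cancel (⊴-trans ⟪ to (adj′ (F u) _) (un (FG-⊵ {k⁻ (F u)})) ⟫ (proj₂ (F-h (G (k⁻ (F u)))))))))
    ⟪ from (adj′ (F u) (F (h⁻ u))) (un (⊴-trans (F-mono (to (adj u (h⁻ u)) ≤-refl)) (proj₁ (F-h (h⁻ u))))) ⟫

  F-α : ∀ u → F (α u) ≋ U.α (F u)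
  F-α u = ⊴-antisym
    (≤G⇒F⊴ {f = f} (α⇐
      (F-cancel (⊴-trans {g = U.double (F (G f))} (⊴-trans {g = U.double f} ⟪ UP.⊑-double-α (F u) ⟫
        ⟪ (λ q → un (FG-⊵ {f}) (half q)) ⟫) (proj₂ (F-double-⊴⊵ (G f)))))
      (F-cancel (⊴-trans {g = U.j⁎ (F (G f))} (⊴-trans {g = U.j⁎ f} ⟪ UP.⊑-j⁎-α (F u) ⟫
        ⟪ (λ q → un (FG-⊵ {f}) (stretch q)) ⟫) (proj₂ (F-j⁎-⊴⊵ (G f)))))))
    ⟪ UP.α-least (F u) (F (α u))
      (un (⊴-trans (F-mono (α⇒double ≤-refl)) (proj₁ (F-double-⊴⊵ (α u)))))
      (un (⊴-trans (F-mono (α⇒j⁎ ≤-refl)) (proj₁ (F-j⁎-⊴⊵ (α u))))) ⟫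
    where f = U.α (F u)

  private module US = Structure U.structure

  F-∨ : ∀ u v → F (u ∨ v) ≋ F u US.∨ F v
  F-∨ u v = ⊴-antisym {F (u ∨ v)} {F u US.∨ F v}
    ⟪ proj₂ inf (F (u ∨ v)) (λ h (u⊑h , v⊑h) → un (≤G⇒F⊴ {f = h} (∨-least (F⊴⇒≤G {f = h} ⟪ u⊑h ⟫) (F⊴⇒≤G {f = h} ⟪ v⊑h ⟫)))) ⟫
    ⟪ proj₁ inf (F (u ∨ v)) (un (F-mono (x≤x∨y u v)) , un (F-mono (y≤x∨y u v))) ⟫
    where inf = U.inf-isInfimum (λ h → F u ⊑ h × F v ⊑ h)

  F-∧ : ∀ u v → F (u ∧ v) ≋ F u US.∧ F v
  F-∧ u v = ⊴-antisym {g = f}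
    ⟪ proj₂ inf (F (u ∧ v)) (λ
      { h (inj₁ e) → un (⊴-trans (F-mono (x∧y≤x u v)) (proj₂ (≋⇒⊴⊵ h (F u) e)))
      ; h (inj₂ e) → un (⊴-trans (F-mono (x∧y≤y u v)) (proj₂ (≋⇒⊴⊵ h (F v) e))) }) ⟫
    (G≤⇒⊴F {f} (∧-greatest
      (F-cancel (⊴-trans {g = f} FG-⊴ ⟪ proj₁ inf (F u) (inj₁ λ _ → lift Eq.refl) ⟫))
      (F-cancel (⊴-trans {g = f} FG-⊴ ⟪ proj₁ inf (F v) (inj₂ λ _ → lift Eq.refl) ⟫))))
    where
    f = F u US.∧ F v
    inf = U.inf-isInfimum (λ h → h ≋ F u ⊎ h ≋ F v)

  U-∔-monoʳ : ∀ f {g h} → g ⊴ h → f U.∔ g ⊴ f U.∔ h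
  U-∔-monoʳ f {g} {h} ⟪ g⊑h ⟫ = ⟪ (λ q → U.⋁-least {y = fun (f U.∔ g) q} λ { x (p , r , lt , lift e) →
    LO.trans {x} {fun f p L.⊗ fun g r} {fun (f U.∔ g) q}
      (lift (≤-trans (∔-monoʳ (lower (g⊑h r))) (≥-reflexive e)))
      (U.⋁-upper {x = fun f p L.⊗ fun g r} (p , r , lt , lift Eq.refl)) }) ⟫

  F-∸ : ∀ u v → F (u ∸ v) ≋ F u U.∸ F v
  F-∸ u v = ⊴-antisym {g = f}
    (≤G⇒F⊴ {f = f} (to-∸ (≤-trans (F-cancel (⊴-trans {g = F v U.∔ F (G f)}
      (⊴-trans {g = F v U.∔ f} ⟪ proj₁ least ⟫ (U-∔-monoʳ (F v) {f} FG-⊵)) (proj₂ (F-∔-⊴⊵ v (G f))))) ∔-swap)))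
    ⟪ proj₂ least (F (u ∸ v)) (un (⊴-trans (F-mono (≤-trans (from-∸ ≤-refl) ∔-swap)) (proj₁ (F-∔-⊴⊵ v (u ∸ v))))) ⟫
    where
    f = F u U.∸ F v
    least = U.∸-least (F u) (F v)

  representation : Isomorphism S U.structure
  representation = record
    { to = F
    ; isOrderIsomorphism = record
      { isOrderMonomorphism = record
        { isOrderHomomorphism = record
          { cong = λ e → ⊴-antisym (F-mono (≤-reflexive e)) (F-mono (≥-reflexive e))
          ; mono = λ h → un (F-mono h)
          }
        ; injective = λ {u} {v} e → let h , k = ≋⇒⊴⊵ (F u) (F v) e in antisym (F-cancel h) (F-cancel k)
        ; cancel    = λ {u} {v} h → F-cancel {u} {v} ⟪ h ⟫
        }
      ; surjective = λ f → G f , λ e → ⊴-antisym {g = f} (≤G⇒F⊴ (≤-reflexive e)) (G≤⇒⊴F (≥-reflexive e))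
      }
    ; isHomomorphic = record
      { ∨-homo      = F-∨
      ; ∧-homo      = F-∧
      ; ∔-homo      = F-∔
      ; ∸-homo      = F-∸
      ; halve-homo  = F-adjoint halve double U.halve U.double (λ u v → mk⇔ halve⇒ halve⇐) UP.halve-adjoint F-double-⊴⊵
      ; double-homo = F-double
      ; j⁎-homo     = F-j⁎
      ; j-homo      = F-adjoint j j⁎ U.j U.j⁎ (λ u v → mk⇔ j⇒ j⇐) UP.j-adjoint F-j⁎-⊴⊵
      ; α-homo      = F-α
      ; 𝟎-homo      = ⊴-antisym (≤G⇒F⊴ {f = U.𝟎} (minimum _)) ⟪ UP.𝟎-least (F 𝟎) ⟫
      ; 𝟏-homo      = ⊴-antisym ⟪ UP.𝟏-greatest (F 𝟏) ⟫ (G≤⇒⊴F {U.𝟏} (maximum _))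
      }
    }

-- From the completion back to the model

module _ {c₁ c₂ c₃ ℓ₁ ℓ₂ ℓ₃} {S : Structure c₁ ℓ₁} {T : Structure c₂ ℓ₂} {V : Structure c₃ ℓ₃} where
  private
    module S = Structure S
    module T = Structure T
    module V = Structure V

  embed-via : Transitive V._≈_ → Embedding S T → Isomorphism T V → Embedding S V
  embed-via ≈-trans f g = record
    { to = λ a → g.to (f.to a)
    ; isOrderMonomorphism = record
      { isOrderHomomorphism = record
        { cong = λ e → g≤.cong (f≤.cong e)
        ; mono = λ h → g≤.mono (f≤.mono h)
        }
      ; injective = λ e → f≤.injective (g≤.injective e)
      ; cancel    = λ h → f≤.cancel (g≤.cancel h)
      }
    ; isHomomorphic = record
      { ∨-homo      = λ a b → ≈-trans (g≤.cong (fₕ.∨-homo a b)) (gₕ.∨-homo _ _)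
      ; ∧-homo      = λ a b → ≈-trans (g≤.cong (fₕ.∧-homo a b)) (gₕ.∧-homo _ _)
      ; ∔-homo      = λ a b → ≈-trans (g≤.cong (fₕ.∔-homo a b)) (gₕ.∔-homo _ _)
      ; ∸-homo      = λ a b → ≈-trans (g≤.cong (fₕ.∸-homo a b)) (gₕ.∸-homo _ _)
      ; halve-homo  = λ a → ≈-trans (g≤.cong (fₕ.halve-homo a)) (gₕ.halve-homo _)
      ; double-homo = λ a → ≈-trans (g≤.cong (fₕ.double-homo a)) (gₕ.double-homo _)
      ; j⁎-homo     = λ a → ≈-trans (g≤.cong (fₕ.j⁎-homo a)) (gₕ.j⁎-homo _)
      ; j-homo      = λ a → ≈-trans (g≤.cong (fₕ.j-homo a)) (gₕ.j-homo _)
      ; α-homo      = λ a → ≈-trans (g≤.cong (fₕ.α-homo a)) (gₕ.α-homo _)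
      ; 𝟎-homo      = ≈-trans (g≤.cong fₕ.𝟎-homo) gₕ.𝟎-homo
      ; 𝟏-homo      = ≈-trans (g≤.cong fₕ.𝟏-homo) gₕ.𝟏-homo
      }
    }
    where
    module f  = Embedding f
    module g  = Isomorphism g
    module f≤ = IsOrderMonomorphism f.isOrderMonomorphism
    module g≤ = IsOrderIsomorphism g.isOrderIsomorphism
    module fₕ = IsHomomorphic f.isHomomorphic
    module gₕ = IsHomomorphic g.isHomomorphic

  /≃-homomorphic : IsModel T → ∀ {f} → IsHomomorphic S T f → IsHomomorphic (S /≃) (T /≃) f
  /≃-homomorphic isModel hom = record
    { ∨-homo      = λ u v → ≈⇒≃ isModel (∨-homo u v)
    ; ∧-homo      = λ u v → ≈⇒≃ isModel (∧-homo u v)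
    ; ∔-homo      = λ u v → ≈⇒≃ isModel (∔-homo u v)
    ; ∸-homo      = λ u v → ≈⇒≃ isModel (∸-homo u v)
    ; halve-homo  = λ v → ≈⇒≃ isModel (halve-homo v)
    ; double-homo = λ v → ≈⇒≃ isModel (double-homo v)
    ; j⁎-homo     = λ v → ≈⇒≃ isModel (j⁎-homo v)
    ; j-homo      = λ v → ≈⇒≃ isModel (j-homo v)
    ; α-homo      = λ v → ≈⇒≃ isModel (α-homo v)
    ; 𝟎-homo      = ≈⇒≃ isModel 𝟎-homo
    ; 𝟏-homo      = ≈⇒≃ isModel 𝟏-homo
    }
    where open IsHomomorphic hom

module _ {ℓ} (A : Model ℓ) where
  open Completion A using (φ)
  open CompletionProperties A using (Ā-isModel; φ-isHomomorphic; φ-≲)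
  open Equivalence

  φ-embedding : Embedding (Model.structure A /≃) (Completion.structure A /≃)
  φ-embedding = record
    { to = φ
    ; isOrderMonomorphism = record
      { isOrderHomomorphism = record
        { cong = λ {a} {b} (h , k) → to (φ-≲ a b) h , to (φ-≲ b a) k
        ; mono = λ {a} {b} → to (φ-≲ a b)
        }
      ; injective = λ {a} {b} (h , k) → from (φ-≲ a b) h , from (φ-≲ b a) k
      ; cancel    = λ {a} {b} → from (φ-≲ a b)
      }
    ; isHomomorphic = /≃-homomorphic {V = Completion.structure A} Ā-isModel φ-isHomomorphic
    }

module CompletionRepresentation (em : Classical) {ℓ : Level} where

  represent : {S : Structure (suc ℓ) ℓ} → IsModel S → Complete S → Archimedean S →
              Σ[ L ∈ CommutativeResiduatedCompleteLattice (suc ℓ) ] Isomorphism S (USC.structure em L)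
  represent isModel complete archimedean = L , representation
    where open Representation em isModel complete archimedean

  represent-/≃ : {S : Structure (suc ℓ) ℓ} → IsModel S → Complete S →
                 Σ[ L ∈ CommutativeResiduatedCompleteLattice (suc ℓ) ] Isomorphism (S /≃) (USC.structure em L)
  represent-/≃ isModel complete = represent (/≃-isModel isModel) (/≃-complete isModel complete) (/≃-archimedean isModel)

  embed : ∀ {c ℓ₁} {S : Structure c ℓ₁} {T : Structure (suc ℓ) ℓ} → Embedding S T →
          Σ[ L ∈ CommutativeResiduatedCompleteLattice (suc ℓ) ] Isomorphism T (USC.structure em L) →
          Σ[ L ∈ CommutativeResiduatedCompleteLattice (suc ℓ) ] Embedding S (USC.structure em L)
  embed f (L , g) = L , embed-via (λ {f} {g} {h} → ≋-trans {f} {g} {h}) f g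
    where
    open USC em L using (_≋_)
    ≋-trans : ∀ {f g h} → f ≋ g → g ≋ h → f ≋ h
    ≋-trans e k q = IsPartialOrder.Eq.trans (CommutativeResiduatedCompleteLattice.isPartialOrder L) (e q) (k q)

  open CompletionProperties using (Ā-isModel; Ā-complete)

  completion-representation : (A : Model ℓ) → Σ[ L ∈ CommutativeResiduatedCompleteLattice (suc ℓ) ]
                              Isomorphism (Completion.structure A /≃) (USC.structure em L)
  completion-representation A = represent-/≃ {S = Completion.structure A} (Ā-isModel A) (Ā-complete A em)

  completion-embedding : (A : Model ℓ) → Σ[ L ∈ CommutativeResiduatedCompleteLattice (suc ℓ) ]
                         Embedding (Model.structure A /≃) (USC.structure em L)
  completion-embedding A = embed {S = Model.structure A /≃} {T = Completion.structure A /≃}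
    (φ-embedding A) (completion-representation A)

theorem3 : (em : Classical) → ∀ {ℓ} →
    (∀ (A : Model ℓ) → Σ[ L ∈ CommutativeResiduatedCompleteLattice (suc ℓ) ]
    Isomorphism (Completion.structure A /≃) (USC.structure em L))
    ×
    (∀ (A : Model ℓ) → Σ[ L ∈ CommutativeResiduatedCompleteLattice (suc ℓ) ]
    Embedding (Model.structure A /≃) (USC.structure em L))
theorem3 em {ℓ} = completion-representation , completion-embedding
  where open CompletionRepresentation em {ℓ}
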